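{- Every toroidal triangulation contains three non-contractible, pairwise non-homotopic cycles that are pairwise edge-disjoint.
   Context: A toroidal triangulation is a graph embedded on the torus with no contractible loop (edge forming a contractible cycle), no homotopic multiple edges (two edges with same endpoints whose union is a contractible cycle), and all faces open disks bounded by three edges. Loops and multiple edges that are not contractible/homotopic are allowed. -}

module Defs where

open import Data.Nat using (ℕ; zero; suc; _+_; _<_)
open import Data.Nat.DivMod using (_%_; m%n<n)
open import Data.Fin using (Fin; toℕ; fromℕ<; _≟_)
open import Data.List using (List; length; filter; allFin)
open import Data.Integer as ℤ using (ℤ; +_)
open import Data.Product using (Σ; Σ-syntax; ∃; ∃-syntax; _×_)
open import Data.Sum using (_⊎_)
open import Data.Fin.Permutation using (Permutation′; _⟨$⟩ʳ_)
open import Relation.Nullary using (¬_)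
open import Relation.Binary.PropositionalEquality using (_≡_; _≢_)

-- Combinatorial maps (rotation systems): the standard combinatorial
-- encoding of a graph cellularly embedded on an orientable surface.
-- Darts are Fin n; α is the (fixed-point-free) edge involution,
-- σ the rotation around vertices; faces are the orbits of φ = σ ∘ α.
-- Vertex of a dart d = σ-orbit of d (its tail); α d is the reverse dart.

record Map : Set where
  field
    n      : ℕ
    σ      : Permutation′ n
    α      : Permutation′ n
    α-invol : ∀ d → α ⟨$⟩ʳ (α ⟨$⟩ʳ d) ≡ d
    α-nofix : ∀ d → α ⟨$⟩ʳ d ≢ d

module _ (M : Map) where
  open Map M

  sig : Fin n → Fin n
  sig d = σ ⟨$⟩ʳ d

  alp : Fin n → Fin n
  alp d = α ⟨$⟩ʳ d

  phi : Fin n → Fin n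
  phi d = sig (alp d)

  iter : (Fin n → Fin n) → ℕ → Fin n → Fin n
  iter f zero d = d
  iter f (suc k) d = f (iter f k d)

  SameOrbit : (Fin n → Fin n) → Fin n → Fin n → Set
  SameOrbit f d d' = ∃[ k ] iter f k d ≡ d'

  SameVertex : Fin n → Fin n → Set
  SameVertex = SameOrbit sig

  HasOrbits : (Fin n → Fin n) → ℕ → Set
  HasOrbits f k = Σ[ rep ∈ (Fin k → Fin n) ]
    ((∀ i j → SameOrbit f (rep i) (rep j) → i ≡ j) ×
     (∀ d → ∃[ i ] SameOrbit f (rep i) d))

  data Reach : Fin n → Fin n → Set where
    here  : ∀ {d} → Reach d d
    stepσ : ∀ {d e} → Reach (sig d) e → Reach d e
    stepα : ∀ {d e} → Reach (alp d) e → Reach d e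

  Chain : Set
  Chain = Fin n → ℤ

  -- a 1-chain is a boundary of a 2-chain (g assigns an integer to each
  -- face, i.e. is constant along φ-orbits)
  IsBoundary : Chain → Set
  IsBoundary c = Σ[ g ∈ (Fin n → ℤ) ]
    ((∀ d → g (phi d) ≡ g d) × (∀ d → c d ≡ g d ℤ.- g (alp d)))

  csuc : ∀ {k} → Fin (suc k) → Fin (suc k)
  csuc {k} i = fromℕ< (m%n<n (suc (toℕ i)) (suc k))

  record Cycle : Set where
    field
      len    : ℕ
      walk   : Fin (suc len) → Fin n
      closed : ∀ i → SameVertex (alp (walk i)) (walk (csuc i))
      distinctV : ∀ i j → i ≢ j → ¬ SameVertex (walk i) (walk j)
      distinctE : ∀ i j → i ≢ j → (walk i ≢ walk j) × (walk i ≢ alp (walk j))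

  open Cycle

  count : ∀ {k} → (Fin k → Fin n) → Fin n → ℕ
  count {k} w d = length (filter (λ i → w i ≟ d) (allFin k))

  chainOf : Cycle → Chain
  chainOf C d = + count (walk C) d ℤ.- + count (walk C) (alp d)

  -- on the torus π₁ is abelian, so a closed curve is contractible iff
  -- its homology class vanishes
  Contractible : Cycle → Set
  Contractible C = IsBoundary (chainOf C)

  -- (unoriented) homotopy of cycles: homology classes equal up to sign
  Homotopic : Cycle → Cycle → Set
  Homotopic C C' = IsBoundary (λ d → chainOf C d ℤ.- chainOf C' d)
                 ⊎ IsBoundary (λ d → chainOf C d ℤ.+ chainOf C' d)

  EdgeDisjoint : Cycle → Cycle → Set
  EdgeDisjoint C C' = ∀ i j → (walk C i ≢ walk C' j) × (walk C i ≢ alp (walk C' j))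

  record IsToroidalTriangulation : Set where
    field
      nonempty  : 0 < n
      connected : ∀ d e → Reach d e
      -- Euler characteristic 0 (connected orientable map ⇒ torus)
      euler     : Σ[ V ∈ ℕ ] Σ[ E ∈ ℕ ] Σ[ F ∈ ℕ ]
                    (HasOrbits sig V × HasOrbits alp E × HasOrbits phi F × V + F ≡ E)
      triangular : ∀ d → (iter phi 3 d ≡ d) × (phi d ≢ d)
      noContrLoop : ∀ (C : Cycle) → len C ≡ 0 → ¬ Contractible C
      -- no homotopic multiple edges (two edges forming a contractible cycle)
      noHomMulti  : ∀ (C : Cycle) → len C ≡ 1 → ¬ Contractible C

module Submission where

-- Homology is handled through integer cocycles on darts.  Gauss elimination over ℤ (no division) and V + F = E
-- provide a cocycle that is not exact, and nondegeneracy of the cup product a second one with nonzero product.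
-- Three edge-disjoint cycles suffice whose vectors of periods are pairwise linearly independent.
--
-- Without loops: grow a closed trail on which both cocycles are exact, by symmetric differences with
-- triangles.  When it cannot grow, every unvisited vertex has only visited neighbours.  As the cup product
-- is nonzero, in the gauge that vanishes on the trail some triangle, or two consecutive edges of some link
-- of an unvisited vertex, span a nonzero area.  Their three vertices cut the trail into three arcs, which
-- close up two edges x and y and the third side (or the path through the unvisited vertex) of class x + y.
--
-- With loops: take a loop l that cuts off the smallest sector of darts at its vertex, and split that vertex
-- into a top (the sector) and a bottom.  Growing a closed trail from the top must reach the bottom, because
-- otherwise the Poincaré dual of l would be exact.  This yields two edge-disjoint paths from top to
-- bottom.  They can be pushed until one of them starts with the first dart of the sector, which has the
-- same end as the last one; exchanging these two darts changes the class by that of l, so that two such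
-- paths of different class exist.

-- Contractibility and homotopy are stated through homology, so periods decide both: a nonzero
-- determinant of two cycles against two cocycles excludes classes that vanish or agree up to sign.
-- Coboundaries change no period of a closed walk; a trail on which the cocycles are exact can thus
-- be gauged to zero, and an edge closed up by one of its arcs has the period of that edge. For
-- connectors of classes x, y and x + y all three determinants are, up to sign, that of x and y, so
-- one nonzero area is enough. Symmetric difference with a triangle presupposes three different
-- corners, which loops destroy. A loop, on the other hand, is itself one of the cycles sought.
-- Smallness of its sector forbids edges with both ends in it, so that any dart of the sector may
-- serve to start a path. A path from top to bottom leaves the sector once and has period 1 against
-- the dual cocycle; two such paths then only need to differ in one further period. Elimination
-- without division produces only multiples. These are harmless for cocycles; for boundaries
-- connectedness allows the factor to be divided out.

open import Defs
open import Data.Bool using (if_then_else_)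
open import Data.Empty using (⊥-elim)
open import Data.Fin as Fin using (Fin; zero; suc; _≟_; toℕ; punchIn; punchOut; splitAt; _↑ˡ_; _↑ʳ_)
open import Data.Fin.Permutation using (Permutation′; _⟨$⟩ʳ_; _⟨$⟩ˡ_; inverseˡ)
import Data.Fin.Properties as Finₚ
open import Data.Integer as ℤ using (ℤ; +_; 0ℤ; 1ℤ; _+_; _*_; -_; _-_)
import Data.Integer.Properties as ℤₚ
open import Data.Integer.Tactic.RingSolver using (solve-∀)
open import Data.List using (List; []; _∷_; _++_; map; filter; length; allFin; lookup)
open import Data.List.Membership.Propositional using (_∈_; _∉_)
open import Data.List.Membership.Propositional.Properties
  using (∈-map⁺; ∈-map⁻; ∈-++⁺ˡ; ∈-++⁺ʳ; ∈-++⁻; ∈-allFin; ∈-∃++; ∈-filter⁺; ∈-lookup)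
open import Data.List.Properties using (filter-notAll; map-++; map-tabulate; tabulate-lookup)
open import Data.List.Relation.Binary.Sublist.Propositional using (_⊆_; []; _∷_; _∷ʳ_; ⊆-refl; ⊆-trans)
open import Data.List.Relation.Binary.Sublist.Propositional.Properties using (All-resp-⊆)
open import Data.List.Relation.Unary.All as All using (All; []; _∷_)
import Data.List.Relation.Unary.All.Properties as Allₚ
open import Data.List.Relation.Unary.AllPairs as AllPairs using (AllPairs; []; _∷_)
import Data.List.Relation.Unary.AllPairs.Properties as AllPairsₚ
open import Data.List.Relation.Unary.Any using (Any; here; there)
open import Data.Nat as ℕ using (ℕ; zero; suc)
import Data.Nat.DivMod as DM
open import Data.Nat.Induction using (<-rec)
import Data.Nat.Properties as ℕₚ
open import Data.Product using (Σ-syntax; ∃-syntax; _×_; _,_; proj₁; proj₂)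
open import Data.Sum using (_⊎_; inj₁; inj₂; [_,_]′)
open import Data.Unit using (⊤; tt)
open import Function using (_∘_; id)
import Relation.Binary.Definitions as Rel
open import Relation.Binary.PropositionalEquality
open import Relation.Nullary using (¬_; Dec; yes; no; does; ¬?; _×-dec_; _⊎-dec_)
open import Relation.Nullary.Decidable using (dec-true; dec-false)
open import Algebra.Properties.Semiring.Sum ℤₚ.+-*-semiring
  using (sum; sum-cong-≗; ∑-distrib-+; *-distribˡ-sum; sum-replicate-zero; sum-permute; ∑-comm)

-- Linear algebra over the integers

Vec : ℕ → Set
Vec n = Fin n → ℤ

δ : ∀ {n} → Fin n → Vec n
δ i j = if does (i ≟ j) then 1ℤ else 0ℤ

δ-refl : ∀ {n} (i : Fin n) → δ i i ≡ 1ℤ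
δ-refl i rewrite dec-true (i ≟ i) refl = refl

δ-≢ : ∀ {n} {i j : Fin n} → i ≢ j → δ i j ≡ 0ℤ
δ-≢ {i = i} {j} i≢j rewrite dec-false (i ≟ j) i≢j = refl

sum-0 : ∀ {n} {f : Vec n} → (∀ i → f i ≡ 0ℤ) → sum f ≡ 0ℤ
sum-0 {n} f≡0 = trans (sum-cong-≗ f≡0) (sum-replicate-zero n)

sum-δ : ∀ {n} (i : Fin n) (f : Vec n) → sum (λ j → δ i j * f j) ≡ f i
sum-δ zero f = trans (cong₂ _+_ (ℤₚ.*-identityˡ (f zero)) (sum-0 (λ j → ℤₚ.*-zeroˡ (f (suc j))))) (ℤₚ.+-identityʳ _)
sum-δ (suc i) f = trans (cong₂ _+_ (ℤₚ.*-zeroˡ (f zero)) (sum-δ i (f ∘ suc))) (ℤₚ.+-identityˡ _)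

opaque
  Σ′ : ∀ {n} → Vec n → ℤ
  Σ′ = sum

  Σ-cong : ∀ {n} {f g : Vec n} → (∀ i → f i ≡ g i) → Σ′ f ≡ Σ′ g
  Σ-cong = sum-cong-≗

  Σ-0 : ∀ {n} {f : Vec n} → (∀ i → f i ≡ 0ℤ) → Σ′ f ≡ 0ℤ
  Σ-0 = sum-0

  Σ-δ : ∀ {n} (i : Fin n) (f : Vec n) → Σ′ (λ j → δ i j * f j) ≡ f i
  Σ-δ = sum-δ

  Σ-lin : ∀ {n} (a b : ℤ) (f g : Vec n) → Σ′ (λ i → a * f i + b * g i) ≡ a * Σ′ f + b * Σ′ g
  Σ-lin a b f g = trans (∑-distrib-+ (λ i → a * f i) (λ i → b * g i))
    (sym (cong₂ _+_ (*-distribˡ-sum a f) (*-distribˡ-sum b g)))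

  Σ-* : ∀ {n} (a : ℤ) (f : Vec n) → Σ′ (λ i → a * f i) ≡ a * Σ′ f
  Σ-* a f = sym (*-distribˡ-sum a f)

  Σ-permute : ∀ {n} (π : Permutation′ n) (f : Vec n) → Σ′ (λ i → f (π ⟨$⟩ʳ i)) ≡ Σ′ f
  Σ-permute π f = sym (sum-permute f π)

opaque
  dot : ∀ {n} → Vec n → Vec n → ℤ
  dot x y = Σ′ (λ i → x i * y i)

  dot-def : ∀ {n} (x y : Vec n) → dot x y ≡ Σ′ (λ i → x i * y i)
  dot-def x y = refl

  dot-cong : ∀ {n} {x x′ y y′ : Vec n} → (∀ i → x i ≡ x′ i) → (∀ i → y i ≡ y′ i) → dot x y ≡ dot x′ y′
  dot-cong p q = Σ-cong (λ i → cong₂ _*_ (p i) (q i))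

  dot-δ : ∀ {n} (i : Fin n) (y : Vec n) → dot (δ i) y ≡ y i
  dot-δ = Σ-δ

  dot-0 : ∀ {n} (η : Vec n) → dot η (λ _ → 0ℤ) ≡ 0ℤ
  dot-0 η = Σ-0 (λ i → ℤₚ.*-zeroʳ (η i))

  dot-linʳ : ∀ {n} (η : Vec n) a b (x y : Vec n) → dot η (λ i → a * x i + b * y i) ≡ a * dot η x + b * dot η y
  dot-linʳ η a b x y = trans (Σ-cong (λ i → lem (η i) (x i) (y i) a b))
    (Σ-lin a b (λ i → η i * x i) (λ i → η i * y i))
    where
    lem : ∀ e x y a b → e * (a * x + b * y) ≡ a * (e * x) + b * (e * y)
    lem = solve-∀

  dot-linˡ : ∀ {n} (η : Vec n) a b (x y : Vec n) → dot (λ i → a * x i + b * y i) η ≡ a * dot x η + b * dot y η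
  dot-linˡ η a b x y = trans (Σ-cong (λ i → lem (η i) (x i) (y i) a b))
    (Σ-lin a b (λ i → x i * η i) (λ i → y i * η i))
    where
    lem : ∀ e x y a b → (a * x + b * y) * e ≡ a * (x * e) + b * (y * e)
    lem = solve-∀

  dot-*ʳ : ∀ {n} (η : Vec n) N (x : Vec n) → dot η (λ i → N * x i) ≡ N * dot η x
  dot-*ʳ η N x = trans (Σ-cong (λ i → lem N (η i) (x i))) (Σ-* N (λ i → η i * x i))
    where
    lem : ∀ N a b → a * (N * b) ≡ N * (a * b)
    lem = solve-∀

*-≢0 : ∀ {a b} → a ≢ 0ℤ → b ≢ 0ℤ → a * b ≢ 0ℤ
*-≢0 {a} a≢0 b≢0 ab≡0 = [ a≢0 , b≢0 ]′ (ℤₚ.i*j≡0⇒i≡0∨j≡0 a ab≡0)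

*≡0⇒ʳ : ∀ {a b} → a ≢ 0ℤ → a * b ≡ 0ℤ → b ≡ 0ℤ
*≡0⇒ʳ {a} a≢0 ab≡0 = [ (λ a≡0 → ⊥-elim (a≢0 a≡0)) , id ]′ (ℤₚ.i*j≡0⇒i≡0∨j≡0 a ab≡0)

-- Vectors are functions, so `ext` stands in for function extensionality.
data Span {n} (vs : List (Vec n)) : Vec n → Set where
  gen : ∀ {v} → v ∈ vs → Span vs v
  nil : Span vs (λ _ → 0ℤ)
  lin : ∀ {x y} a b → Span vs x → Span vs y → Span vs (λ i → a * x i + b * y i)
  ext : ∀ {x y} → (∀ i → x i ≡ y i) → Span vs x → Span vs y

span-orth : ∀ {n} {vs : List (Vec n)} {η x} → All (λ v → dot η v ≡ 0ℤ) vs → Span vs x → dot η x ≡ 0ℤ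
span-orth o (gen v∈) = All.lookup o v∈
span-orth {η = η} o nil = dot-0 η
span-orth {η = η} o (lin {x} {y} a b p q) =
  trans (dot-linʳ η a b x y) (trans (cong₂ _+_ (cong (a *_) (span-orth o p)) (cong (b *_) (span-orth o q))) (lem a b))
  where
  lem : ∀ a b → a * 0ℤ + b * 0ℤ ≡ 0ℤ
  lem = solve-∀
span-orth o (ext e p) = trans (dot-cong (λ _ → refl) (λ i → sym (e i))) (span-orth o p)

span-weaken : ∀ {n} {vs : List (Vec n)} {v x} → Span vs x → Span (v ∷ vs) x
span-weaken (gen v∈) = gen (there v∈)
span-weaken nil = nil
span-weaken (lin a b p q) = lin a b (span-weaken p) (span-weaken q)
span-weaken (ext e p) = ext e (span-weaken p)

-- Gaussian elimination without division; `N` collects the pivots. If a multiple of `v` lies in the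
-- span of `vs`, then `v` may be dropped. Otherwise some `η₀` separates `v`, and `c` is replaced by
-- a combination of `c` and `v` that `η₀` kills.
fredholm : ∀ {n} (vs : List (Vec n)) (c : Vec n) →
  (∃[ N ] (N ≢ 0ℤ × Span vs (λ i → N * c i))) ⊎
  (∃[ η ] (All (λ v → dot η v ≡ 0ℤ) vs × dot η c ≢ 0ℤ))
fredholm [] c with Finₚ.all? (λ i → c i ℤ.≟ 0ℤ)
... | yes c≡0 = inj₁ (1ℤ , (λ ()) , ext (λ i → sym (trans (ℤₚ.*-identityˡ (c i)) (c≡0 i))) nil)
... | no c≢0 with Finₚ.¬∀⟶∃¬ _ _ (λ i → c i ℤ.≟ 0ℤ) c≢0
...   | i , ci≢0 = inj₂ (δ i , [] , λ e → ci≢0 (trans (sym (dot-δ i c)) e))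
fredholm (v ∷ vs) c with fredholm vs v
... | inj₁ (N , N≢0 , Nv) with fredholm vs c
...   | inj₁ (K , K≢0 , Kc) = inj₁ (K , K≢0 , span-weaken Kc)
...   | inj₂ (η , o , ηc) = inj₂ (η , *≡0⇒ʳ N≢0 Nηv ∷ o , ηc)
  where
  Nηv : N * dot η v ≡ 0ℤ
  Nηv = trans (sym (dot-*ʳ η N v)) (span-orth o Nv)
fredholm (v ∷ vs) c | inj₂ (η₀ , o₀ , η₀v) with fredholm vs (λ i → dot η₀ v * c i + (- dot η₀ c) * v i)
...   | inj₁ (N , N≢0 , Nc′) = inj₁ (N * dot η₀ v , *-≢0 N≢0 η₀v ,
        ext (λ i → lem N (dot η₀ v) (dot η₀ c) (c i) (v i)) (lin 1ℤ (N * dot η₀ c) (span-weaken Nc′) (gen (here refl))))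
  where
  lem : ∀ N a b c v → 1ℤ * (N * (a * c + (- b) * v)) + (N * b) * v ≡ (N * a) * c
  lem = solve-∀
-- `η′` corrects `η` by a multiple of `η₀` so as to kill `v`; its value on `c` is that of `η` on the
-- reduced vector, hence nonzero.
...   | inj₂ (η , o , ηc′) = inj₂ (η′ , ηv′ ∷ ortho o o₀ , λ e → ηc′ (trans (dot-linʳ η a (- dot η₀ c) c v) (trans (lem₂ a b (dot η c) (dot η₀ c)) (trans (sym (dot-linˡ c a (- b) η η₀)) e))))
  where
  a = dot η₀ v
  b = dot η v
  η′ = λ i → a * η i + (- b) * η₀ i
  lem₁ : ∀ a b → a * b + (- b) * a ≡ 0ℤ
  lem₁ = solve-∀
  lem₂ : ∀ a b c d → a * c + (- d) * b ≡ a * c + (- b) * d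
  lem₂ = solve-∀
  lem₀ : ∀ a b → a * 0ℤ + (- b) * 0ℤ ≡ 0ℤ
  lem₀ = solve-∀
  ηv′ : dot η′ v ≡ 0ℤ
  ηv′ = trans (dot-linˡ v a (- b) η η₀) (lem₁ a b)
  ortho : ∀ {us} → All (λ v → dot η v ≡ 0ℤ) us → All (λ v → dot η₀ v ≡ 0ℤ) us → All (λ v → dot η′ v ≡ 0ℤ) us
  ortho [] [] = []
  ortho {u ∷ us} (p ∷ ps) (q ∷ qs) =
    trans (dot-linˡ u a (- b) η η₀) (trans (cong₂ (λ s t → a * s + (- b) * t) p q) (lem₀ a b)) ∷ ortho ps qs

-- Linear forms and their common zeros

record Linear {n} (f : Vec n → ℤ) : Set where
  field
    f-ext : ∀ {x y} → (∀ i → x i ≡ y i) → f x ≡ f y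
    f-lin : ∀ a b x y → f (λ i → a * x i + b * y i) ≡ a * f x + b * f y
open Linear

module _ {n} {f : Vec n → ℤ} (L : Linear f) where
  f-0 : ∀ {x} → (∀ i → x i ≡ 0ℤ) → f x ≡ 0ℤ
  f-0 {x} x≡0 = trans (f-ext L {y = λ i → 0ℤ * x i + 0ℤ * x i} (λ i → x≡0 i)) (f-lin L 0ℤ 0ℤ x x)

cons0 : ∀ {n} → Vec n → Vec (suc n)
cons0 x zero = 0ℤ
cons0 x (suc i) = x i

cons0-linear : ∀ {n} {f : Vec (suc n) → ℤ} → Linear f → Linear (f ∘ cons0)
cons0-linear L = record
  { f-ext = λ e → f-ext L (λ { zero → refl ; (suc i) → e i })
  ; f-lin = λ a b x y → trans (f-ext L (λ { zero → lem a b ; (suc i) → refl })) (f-lin L a b (cons0 x) (cons0 y)) }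
  where
  lem : ∀ a b → 0ℤ ≡ a * 0ℤ + b * 0ℤ
  lem = solve-∀

linear-zero : ∀ {n} {f : Vec n → ℤ} → Linear f → (∀ j → f (δ j) ≡ 0ℤ) → ∀ x → f x ≡ 0ℤ
linear-zero {zero} L z x = f-0 L (λ ())
linear-zero {suc n} {f} L z x =
  trans (f-ext L split) (trans (f-lin L (x zero) 1ℤ (δ zero) (cons0 (x ∘ suc)))
    (trans (cong₂ (λ s t → x zero * s + 1ℤ * t) (z zero)
       (linear-zero (cons0-linear L) (λ j → trans (f-ext L (λ { zero → refl ; (suc i) → refl })) (z (suc j))) (x ∘ suc)))
      (lem (x zero))))
  where
  lem : ∀ a → a * 0ℤ + 1ℤ * 0ℤ ≡ 0ℤ
  lem = solve-∀
  lem₁ : ∀ a → a ≡ a * 1ℤ + 1ℤ * 0ℤ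
  lem₁ = solve-∀
  lem₂ : ∀ a b → a ≡ b * 0ℤ + 1ℤ * a
  lem₂ = solve-∀
  split : ∀ i → x i ≡ x zero * δ zero i + 1ℤ * cons0 (x ∘ suc) i
  split zero = lem₁ (x zero)
  split (suc i) = lem₂ (x (suc i)) (x zero)

insert0 : ∀ {n} → Fin (suc n) → Vec n → Vec (suc n)
insert0 j y i with j ≟ i
... | yes _ = 0ℤ
... | no j≢i = y (punchOut j≢i)

insert0-punchIn : ∀ {n} (j : Fin (suc n)) (y : Vec n) i → insert0 j y (punchIn j i) ≡ y i
insert0-punchIn j y i with j ≟ punchIn j i
... | yes e = ⊥-elim (Finₚ.punchInᵢ≢i j i (sym e))
... | no ne = cong y (trans (Finₚ.punchOut-cong j refl) (Finₚ.punchOut-punchIn j))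

insert0-ext : ∀ {n} (j : Fin (suc n)) {x y : Vec n} → (∀ i → x i ≡ y i) → ∀ i → insert0 j x i ≡ insert0 j y i
insert0-ext j e i with j ≟ i
... | yes _ = refl
... | no j≢i = e _

insert0-lin : ∀ {n} (j : Fin (suc n)) a b (x y : Vec n) i →
  insert0 j (λ i → a * x i + b * y i) i ≡ a * insert0 j x i + b * insert0 j y i
insert0-lin j a b x y i with j ≟ i
... | yes _ = lem a b
  where
  lem : ∀ a b → 0ℤ ≡ a * 0ℤ + b * 0ℤ
  lem = solve-∀
... | no j≢i = refl

-- Induction on the number of equations. If `f zero` kills all unit vectors it imposes nothing.
-- Otherwise, with the pivot `a = f zero (δ j)`, the map `ι` embeds the vectors with one coordinate
-- fewer into the kernel of `f zero`; scaling by `a` avoids division and keeps nonzero vectors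
-- nonzero.
common-zero : ∀ {m n} (f : Fin m → Vec n → ℤ) → (∀ i → Linear (f i)) → m ℕ.< n →
  ∃[ x ] ((∃[ j ] x j ≢ 0ℤ) × (∀ i → f i x ≡ 0ℤ))
common-zero {zero} {suc n} f L _ = δ zero , (zero , λ ()) , λ ()
common-zero {suc m} {suc n} f L (ℕ.s≤s m<n) with Finₚ.any? (λ j → ¬? (f zero (δ j) ℤ.≟ 0ℤ))
... | no none = let x , nz , z = common-zero (f ∘ suc) (L ∘ suc) (ℕₚ.m≤n⇒m≤1+n m<n) in
  x , nz , λ { zero → linear-zero (L zero) (λ j → kill j) x ; (suc i) → z i }
  where
  kill : ∀ j → f zero (δ j) ≡ 0ℤ
  kill j with f zero (δ j) ℤ.≟ 0ℤ
  ... | yes e = e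
  ... | no ne = ⊥-elim (none (j , ne))
... | yes (j , a≢0) = let y , (i , yi≢0) , z = common-zero (λ i → f (suc i) ∘ ι) (λ i → ι-linear (L (suc i))) m<n in
  ι y , (punchIn j i , λ e → *-≢0 a≢0 yi≢0 (trans (sym (ι-punchIn y i)) e)) , λ { zero → ι-zero y ; (suc i) → z i }
  where
  a = f zero (δ j)
  ι : Vec n → Vec (suc n)
  ι y k = a * insert0 j y k + (- f zero (insert0 j y)) * δ j k
  ι-punchIn : ∀ y i → ι y (punchIn j i) ≡ a * y i
  ι-punchIn y i = trans (cong₂ (λ s t → a * s + (- f zero (insert0 j y)) * t) (insert0-punchIn j y i) (δ-≢ (Finₚ.punchInᵢ≢i j i ∘ sym)))
    (lem (a * y i) (- f zero (insert0 j y)))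
    where
    lem : ∀ a b → a + b * 0ℤ ≡ a
    lem = solve-∀
  ι-zero : ∀ y → f zero (ι y) ≡ 0ℤ
  ι-zero y = trans (f-lin (L zero) a (- f zero (insert0 j y)) (insert0 j y) (δ j)) (lem a (f zero (insert0 j y)))
    where
    lem : ∀ a b → a * b + (- b) * a ≡ 0ℤ
    lem = solve-∀
  ι-linear : ∀ {g} → Linear g → Linear (g ∘ ι)
  ι-linear Lg = record
    { f-ext = λ e → f-ext Lg (λ k → cong₂ (λ s t → a * s + (- t) * δ j k) (insert0-ext j e k) (f-ext (L zero) (insert0-ext j e)))
    ; f-lin = λ c b x y → trans (f-ext Lg (λ k → trans
        (cong₂ (λ s t → a * s + (- t) * δ j k) (insert0-lin j c b x y k)
          (trans (f-ext (L zero) (insert0-lin j c b x y)) (f-lin (L zero) c b _ _)))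
        (lem a b c (insert0 j x k) (insert0 j y k) (f zero (insert0 j x)) (f zero (insert0 j y)) (δ j k))))
        (f-lin Lg c b (ι x) (ι y)) }
    where
    lem : ∀ a b c x y fx fy d → a * (c * x + b * y) + (- (c * fx + b * fy)) * d ≡ c * (a * x + (- fx) * d) + b * (a * y + (- fy) * d)
    lem = solve-∀

opaque
  unfolding Σ′ dot
  Σ-suc : ∀ {n} (f : Vec (suc n)) → Σ′ f ≡ f zero + Σ′ (f ∘ suc)
  Σ-suc f = refl

  Σ-empty : (f : Vec 0) → Σ′ f ≡ 0ℤ
  Σ-empty f = refl

  Σ-comm : ∀ {m n} (f : Fin m → Fin n → ℤ) → Σ′ (λ i → Σ′ (λ j → f i j)) ≡ Σ′ (λ j → Σ′ (λ i → f i j))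
  Σ-comm = ∑-comm

Σ-add : ∀ {n} (f g : Vec n) → Σ′ (λ i → f i + g i) ≡ Σ′ f + Σ′ g
Σ-add f g = trans (Σ-cong (λ i → sym (one (f i) (g i)))) (trans (Σ-lin 1ℤ 1ℤ f g) (one (Σ′ f) (Σ′ g)))
  where
  one : ∀ a b → 1ℤ * a + 1ℤ * b ≡ a + b
  one = solve-∀

Σ-sub : ∀ {n} (f g : Vec n) → Σ′ (λ i → f i - g i) ≡ Σ′ f - Σ′ g
Σ-sub f g = trans (Σ-cong (λ i → sym (one (f i) (g i)))) (trans (Σ-lin 1ℤ (- 1ℤ) f g) (one (Σ′ f) (Σ′ g)))
  where
  one : ∀ a b → 1ℤ * a + - 1ℤ * b ≡ a - b
  one = solve-∀

sq-nonneg : ∀ a → 0ℤ ℤ.≤ a * a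
sq-nonneg (+ n) = subst (0ℤ ℤ.≤_) (ℤₚ.pos-* n n) (ℤ.+≤+ ℕ.z≤n)
sq-nonneg ℤ.-[1+ n ] = ℤ.+≤+ ℕ.z≤n

Σ-sq-nonneg : ∀ {n} (f : Vec n) → 0ℤ ℤ.≤ Σ′ (λ i → f i * f i)
Σ-sq-nonneg {zero} f = ℤₚ.≤-reflexive (sym (Σ-empty (λ i → f i * f i)))
Σ-sq-nonneg {suc n} f = ℤₚ.≤-trans (ℤₚ.+-mono-≤ (sq-nonneg (f zero)) (Σ-sq-nonneg (f ∘ suc)))
  (ℤₚ.≤-reflexive (sym (Σ-suc (λ i → f i * f i))))

-- The positivity behind the energy argument in `harmonic-not-exact`.
Σ-sq≡0 : ∀ {n} (f : Vec n) → Σ′ (λ i → f i * f i) ≡ 0ℤ → ∀ i → f i ≡ 0ℤ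
Σ-sq≡0 {suc n} f e = go
  where
  e′ : f zero * f zero + Σ′ (λ i → f (suc i) * f (suc i)) ≡ 0ℤ
  e′ = trans (sym (Σ-suc (λ i → f i * f i))) e
  split : ∀ {a b} → 0ℤ ℤ.≤ a → 0ℤ ℤ.≤ b → a + b ≡ 0ℤ → a ≡ 0ℤ × b ≡ 0ℤ
  split {a} {b} a≥0 b≥0 ab = a≡0 , trans (sym (ℤₚ.+-identityˡ b)) (trans (cong (_+ b) (sym a≡0)) ab)
    where
    a≡0 = ℤₚ.≤-antisym (ℤₚ.≤-trans (ℤₚ.≤-reflexive (sym (ℤₚ.+-identityʳ a)))
      (ℤₚ.≤-trans (ℤₚ.+-monoʳ-≤ a b≥0) (ℤₚ.≤-reflexive ab))) a≥0
  both = split (sq-nonneg (f zero)) (Σ-sq-nonneg (f ∘ suc)) e′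
  go : ∀ i → f i ≡ 0ℤ
  go zero = [ id , id ]′ (ℤₚ.i*j≡0⇒i≡0∨j≡0 (f zero) (proj₁ both))
  go (suc i) = Σ-sq≡0 (f ∘ suc) (proj₂ both) i

dot-comm : ∀ {n} (x y : Vec n) → dot x y ≡ dot y x
dot-comm x y = trans (dot-def x y) (trans (Σ-cong (λ i → ℤₚ.*-comm (x i) (y i))) (sym (dot-def y x)))

-- Cocycles on a triangulated map

perm-inj : ∀ {n} (π : Permutation′ n) {x y} → π ⟨$⟩ʳ x ≡ π ⟨$⟩ʳ y → x ≡ y
perm-inj π {x} {y} e = trans (sym (inverseˡ π)) (trans (cong (π ⟨$⟩ˡ_) e) (inverseˡ π))

module Orbits (M : Map) (f : Fin (Map.n M) → Fin (Map.n M)) (inj : ∀ {x y} → f x ≡ f y → x ≡ y) where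
  open Map M using (n)

  it : ℕ → Fin n → Fin n
  it = iter M f

  it-+ : ∀ i j d → it (i ℕ.+ j) d ≡ it i (it j d)
  it-+ zero j d = refl
  it-+ (suc i) j d = cong f (it-+ i j d)

  it-inj : ∀ i {x y} → it i x ≡ it i y → x ≡ y
  it-inj zero e = e
  it-inj (suc i) e = it-inj i (inj e)

  it-≤ : ∀ {i j x y} → i ℕ.≤ j → it i x ≡ it j y → x ≡ it (j ℕ.∸ i) y
  it-≤ {i} {j} {x} {y} i≤j e = it-inj i (trans e (trans (cong (λ k → it k y) (sym (ℕₚ.m+[n∸m]≡n i≤j))) (it-+ i (j ℕ.∸ i) y)))

  period : ∀ d → ∃[ m ] it (suc m) d ≡ d
  period d with Finₚ.pigeonhole (ℕₚ.n<1+n n) (λ i → it (toℕ i) d)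
  ... | i , j , i<j , e = toℕ j ℕ.∸ suc (toℕ i) ,
    trans (cong (λ k → it k d) (sym (ℕₚ.+-∸-assoc 1 i<j))) (sym (it-≤ {toℕ i} (ℕₚ.<⇒≤ i<j) e))

  it-period : ∀ {m d} → it m d ≡ d → ∀ k → it (k ℕ.* m) d ≡ d
  it-period e zero = refl
  it-period {m} {d} e (suc k) = trans (it-+ m (k ℕ.* m) d) (trans (cong (it m) (it-period e k)) e)

  -- `SameOrbit` only iterates forwards. With period `m + 1`, going back `k` steps is going forward
  -- `k * m` steps, because `k * m + k` is a multiple of the period.
  orbit-sym : ∀ {d d′} → SameOrbit M f d d′ → SameOrbit M f d′ d
  orbit-sym {d} {d′} (k , e) = let m , p = period d in k ℕ.* m ,
    trans (cong (it (k ℕ.* m)) (sym e)) (trans (sym (it-+ (k ℕ.* m) k d))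
      (trans (cong (λ j → it j d) (trans (ℕₚ.+-comm (k ℕ.* m) k) (sym (ℕₚ.*-suc k m)))) (it-period p k)))

  orbit-trans : ∀ {x y z} → SameOrbit M f x y → SameOrbit M f y z → SameOrbit M f x z
  orbit-trans {x} (i , e) (j , e′) = j ℕ.+ i , trans (it-+ j i x) (trans (cong (it j) e) e′)

  module Index {k} (H : HasOrbits M f k) where
    rep : Fin k → Fin n
    rep = proj₁ H

    idx : Fin n → Fin k
    idx d = proj₁ (proj₂ (proj₂ H) d)

    rep-idx : ∀ d → SameOrbit M f (rep (idx d)) d
    rep-idx d = proj₂ (proj₂ (proj₂ H) d)

    idx-same : ∀ {d e} → idx d ≡ idx e → SameOrbit M f d e
    idx-same {d} {e} p = orbit-trans (orbit-sym (rep-idx d)) (subst (λ i → SameOrbit M f (rep i) e) (sym p) (rep-idx e))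

    same-idx : ∀ {d e} → SameOrbit M f d e → idx d ≡ idx e
    same-idx {d} {e} o = proj₁ (proj₂ H) _ _ (orbit-trans (rep-idx d) (orbit-trans o (orbit-sym (rep-idx e))))

    idx-rep : ∀ i → idx (rep i) ≡ i
    idx-rep i = proj₁ (proj₂ H) _ _ (rep-idx (rep i))

    idx-step : ∀ d → idx (f d) ≡ idx d
    idx-step d = sym (same-idx (1 , refl))

    inv-idx : ∀ {A : Set} (h : Fin n → A) → (∀ d → h (f d) ≡ h d) → ∀ d → h d ≡ h (rep (idx d))
    inv-idx h inv d = let k , e = rep-idx d in trans (cong h (sym e)) (go k _)
      where
      go : ∀ k x → h (it k x) ≡ h x
      go zero x = refl
      go (suc k) x = trans (inv _) (go k x)

module Homology (M : Map) (triangular : ∀ d → (iter M (phi M) 3 d ≡ d) × (phi M d ≢ d)) where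
  open Map M using (n; σ; α; α-invol; α-nofix)

  Dart : Set
  Dart = Fin n

  -- As `f` has order three on the darts of a triangle, `b` is the inverse of the rotation `s`.
  s a f b : Dart → Dart
  s = sig M
  a = alp M
  f = phi M
  b d = a (f (f d))

  s-inj : ∀ {x y} → s x ≡ s y → x ≡ y
  s-inj = perm-inj σ

  a-inj : ∀ {x y} → a x ≡ a y → x ≡ y
  a-inj = perm-inj α

  f-inj : ∀ {x y} → f x ≡ f y → x ≡ y
  f-inj = a-inj ∘ s-inj

  aa : ∀ d → a (a d) ≡ d
  aa = α-invol

  fff : ∀ d → f (f (f d)) ≡ d
  fff d = proj₁ (triangular d)

  fa : ∀ d → f (a d) ≡ s d
  fa d = cong s (aa d)

  sb : ∀ d → s (b d) ≡ d
  sb d = fff d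

  bs : ∀ d → b (s d) ≡ d
  bs d = s-inj (sb (s d))

  Σ-a : ∀ (g : Vec n) → Σ′ (λ d → g (a d)) ≡ Σ′ g
  Σ-a = Σ-permute α

  Σ-s : ∀ (g : Vec n) → Σ′ (λ d → g (s d)) ≡ Σ′ g
  Σ-s = Σ-permute σ

  Σ-f : ∀ (g : Vec n) → Σ′ (λ d → g (f d)) ≡ Σ′ g
  Σ-f g = trans (Σ-a (g ∘ s)) (Σ-s g)

  -- Cocycles and the cup product

  record Cocycle (η : Vec n) : Set where
    field
      anti : ∀ d → η (a d) ≡ - η d
      closed : ∀ d → η d + η (f d) + η (f (f d)) ≡ 0ℤ
  open Cocycle public

  -- On cocycles this is six times the cup product paired with the fundamental class: the three
  -- darts of a triangle contribute three times the determinant on two consecutive sides, and that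
  -- determinant is twice the antisymmetrised product.
  W : Vec n → Vec n → ℤ
  W ω η = Σ′ (λ d → ω d * (η (f d) - η (f (f d))))

  -- Compares the triangles on the two sides of an edge: closedness of both leaves only the
  -- neighbours `b d` and `s d` of `d` in the rotation.
  turn : ∀ {η} → Cocycle η → ∀ d →
    (η (f d) - η (f (f d))) - (η (f (a d)) - η (f (f (a d)))) ≡ + 2 * (η (b d) - η (s d))
  turn {η} c d = trans (cong₂ (λ x y → (η (f d) - η (f (f d))) - (x - y)) (cong η (fa d)) (cong (η ∘ f) (fa d)))
    (trans (lem (η d) (η (f d)) (η (f (f d))) (η (s d)) (η (f (s d))) (closed c d) closed′)
      (cong (λ x → + 2 * (x - η (s d))) (sym (anti c (f (f d))))))
    where
    closed′ : - η d + η (s d) + η (f (s d)) ≡ 0ℤ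
    closed′ = trans (cong₂ (λ x y → x + y + η (f (s d))) (sym (anti c d)) (cong η (sym (fa d))))
      (trans (cong (λ x → η (a d) + η (f (a d)) + η (f x)) (sym (fa d))) (closed c (a d)))
    lem : ∀ x y z u v → x + y + z ≡ 0ℤ → - x + u + v ≡ 0ℤ → (y - z) - (u - v) ≡ + 2 * (- z - u)
    lem x y z u v p q = trans (eq x y z u v) (trans (cong₂ (λ i j → + 2 * (- z - u) + i + j) p q) (eq₀ (+ 2 * (- z - u))))
      where
      eq : ∀ x y z u v → (y - z) - (u - v) ≡ + 2 * (- z - u) + (x + y + z) + (- x + u + v)
      eq = solve-∀
      eq₀ : ∀ t → t + 0ℤ + 0ℤ ≡ t
      eq₀ = solve-∀

  -- Summation by parts over opposite darts, followed by `turn`. `χ` need not be constant at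
  -- vertices: besides potentials, for which the right side vanishes, it will be the indicator of a
  -- sector, of which only the ends contribute.
  W-coboundary : ∀ (χ : Vec n) {η} → Cocycle η →
    W (λ d → χ d - χ (a d)) η ≡ + 2 * Σ′ (λ d → χ d * (η (b d) - η (s d)))
  W-coboundary χ {η} c = begin
    Σ′ (λ d → (χ d - χ (a d)) * B d)                          ≡⟨ Σ-cong (λ d → dist (χ d) (χ (a d)) (B d)) ⟩
    Σ′ (λ d → χ d * B d - χ (a d) * B d)                      ≡⟨ Σ-sub (λ d → χ d * B d) (λ d → χ (a d) * B d) ⟩
    Σ′ (λ d → χ d * B d) - Σ′ (λ d → χ (a d) * B d)           ≡⟨ cong (λ t → Σ′ (λ d → χ d * B d) - t) flip ⟩
    Σ′ (λ d → χ d * B d) - Σ′ (λ d → χ d * B (a d))           ≡⟨ Σ-sub (λ d → χ d * B d) (λ d → χ d * B (a d)) ⟨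
    Σ′ (λ d → χ d * B d - χ d * B (a d))                      ≡⟨ Σ-cong (λ d → fact (χ d) (B d) (B (a d)) (η (b d) - η (s d)) (turn c d)) ⟩
    Σ′ (λ d → + 2 * (χ d * (η (b d) - η (s d))))              ≡⟨ Σ-* (+ 2) (λ d → χ d * (η (b d) - η (s d))) ⟩
    + 2 * Σ′ (λ d → χ d * (η (b d) - η (s d)))                ∎
    where
    open ≡-Reasoning
    B : Vec n
    B d = η (f d) - η (f (f d))
    dist : ∀ x y z → (x - y) * z ≡ x * z - y * z
    dist = solve-∀
    flip : Σ′ (λ d → χ (a d) * B d) ≡ Σ′ (λ d → χ d * B (a d))
    flip = trans (sym (Σ-a (λ d → χ (a d) * B d))) (Σ-cong (λ d → cong (λ x → χ x * B (a d)) (aa d)))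
    fact : ∀ x y z t → y - z ≡ + 2 * t → x * y - x * z ≡ + 2 * (x * t)
    fact x y z t e = trans (eq x y z) (trans (cong (x *_) e) (eq′ x t))
      where
      eq : ∀ x y z → x * y - x * z ≡ x * (y - z)
      eq = solve-∀
      eq′ : ∀ x t → x * (+ 2 * t) ≡ + 2 * (x * t)
      eq′ = solve-∀

  W-exact : ∀ (π : Vec n) → (∀ d → π (s d) ≡ π d) → ∀ {η} → Cocycle η → W (λ d → π d - π (a d)) η ≡ 0ℤ
  W-exact π inv {η} c = trans (W-coboundary π c) (cong (+ 2 *_) (begin
    Σ′ (λ d → π d * (η (b d) - η (s d)))                  ≡⟨ Σ-cong (λ d → dist (π d) (η (b d)) (η (s d))) ⟩
    Σ′ (λ d → π d * η (b d) - π d * η (s d))              ≡⟨ Σ-sub (λ d → π d * η (b d)) (λ d → π d * η (s d)) ⟩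
    Σ′ (λ d → π d * η (b d)) - Σ′ (λ d → π d * η (s d))   ≡⟨ cong₂ _-_ e₁ e₂ ⟩
    Σ′ (λ d → π d * η d) - Σ′ (λ d → π d * η d)           ≡⟨ ℤₚ.+-inverseʳ (Σ′ (λ d → π d * η d)) ⟩
    0ℤ ∎))
    where
    open ≡-Reasoning
    dist : ∀ x y z → x * (y - z) ≡ x * y - x * z
    dist = solve-∀
    e₁ : Σ′ (λ d → π d * η (b d)) ≡ Σ′ (λ d → π d * η d)
    e₁ = trans (sym (Σ-s (λ d → π d * η (b d)))) (Σ-cong (λ d → cong₂ _*_ (inv d) (cong η (bs d))))
    e₂ : Σ′ (λ d → π d * η (s d)) ≡ Σ′ (λ d → π d * η d)
    e₂ = trans (Σ-cong (λ d → cong (_* η (s d)) (sym (inv d)))) (Σ-s (λ d → π d * η d))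

  W-sub : ∀ ω ω′ η → W (λ d → ω d - ω′ d) η ≡ W ω η - W ω′ η
  W-sub ω ω′ η = trans (Σ-cong (λ d → dist (ω d) (ω′ d) (η (f d) - η (f (f d)))))
    (Σ-sub (λ d → ω d * (η (f d) - η (f (f d)))) (λ d → ω′ d * (η (f d) - η (f (f d)))))
    where
    dist : ∀ x y z → (x - y) * z ≡ x * z - y * z
    dist = solve-∀

  -- Reindexing half of the terms along `f` turns each summand into a determinant on two consecutive
  -- sides.
  W-shift : ∀ ω η → W ω η ≡ Σ′ (λ d → ω d * η (f d) - ω (f d) * η d)
  W-shift ω η = begin
    W ω η                                                       ≡⟨ Σ-cong (λ d → dist (ω d) (η (f d)) (η (f (f d)))) ⟩
    Σ′ (λ d → ω d * η (f d) - ω d * η (f (f d)))                ≡⟨ Σ-sub (λ d → ω d * η (f d)) (λ d → ω d * η (f (f d))) ⟩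
    Σ′ (λ d → ω d * η (f d)) - Σ′ (λ d → ω d * η (f (f d)))     ≡⟨ cong (λ t → Σ′ (λ d → ω d * η (f d)) - t) shift ⟩
    Σ′ (λ d → ω d * η (f d)) - Σ′ (λ d → ω (f d) * η d)         ≡⟨ Σ-sub (λ d → ω d * η (f d)) (λ d → ω (f d) * η d) ⟨
    Σ′ (λ d → ω d * η (f d) - ω (f d) * η d)                    ∎
    where
    open ≡-Reasoning
    dist : ∀ x y z → x * (y - z) ≡ x * y - x * z
    dist = solve-∀
    shift : Σ′ (λ d → ω d * η (f (f d))) ≡ Σ′ (λ d → ω (f d) * η d)
    shift = trans (sym (Σ-f (λ d → ω d * η (f (f d))))) (Σ-cong (λ d → cong (λ x → ω (f d) * η x) (fff d)))

  W-antisym : ∀ ω η → W ω η ≡ - W η ω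
  W-antisym ω η = trans (W-shift ω η) (trans (Σ-cong (λ d → eq (ω d) (η (f d)) (ω (f d)) (η d)))
    (trans (Σ-* (- 1ℤ) (λ d → η d * ω (f d) - η (f d) * ω d)) (trans (cong (- 1ℤ *_) (sym (W-shift η ω))) (neg (W η ω)))))
    where
    eq : ∀ x y z w → x * y - z * w ≡ - 1ℤ * (w * z - y * x)
    eq = solve-∀
    neg : ∀ x → - 1ℤ * x ≡ - x
    neg = solve-∀

  -- Exhibits the chain dual to `ω`, to which `alternative` can be applied.
  W-dot : ∀ ω η → W ω η ≡ dot η (λ d → ω (f (f d)) - ω (f d))
  W-dot ω η = trans (W-shift ω η) (trans (Σ-sub (λ d → ω d * η (f d)) (λ d → ω (f d) * η d))
    (trans (cong (_- Σ′ (λ d → ω (f d) * η d)) shift) (trans (sym (Σ-sub (λ d → ω (f (f d)) * η d) (λ d → ω (f d) * η d)))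
    (trans (Σ-cong (λ d → eq (ω (f (f d))) (η d) (ω (f d)))) (sym (dot-def η (λ d → ω (f (f d)) - ω (f d))))))))
    where
    eq : ∀ x y z → x * y - z * y ≡ y * (x - z)
    eq = solve-∀
    shift : Σ′ (λ d → ω d * η (f d)) ≡ Σ′ (λ d → ω (f (f d)) * η d)
    shift = trans (sym (trans (Σ-f (λ d → ω (f d) * η (f (f d)))) (Σ-f (λ d → ω d * η (f d)))))
      (Σ-cong (λ d → cong (λ x → ω (f (f d)) * η x) (fff d)))

  -- The span of the relations "antisymmetric" and "closed" consists of sums of an α-invariant and a φ-invariant function.
  Relation : Vec n → Set
  Relation x = Σ[ u ∈ Vec n ] Σ[ g ∈ Vec n ] ((∀ d → u (a d) ≡ u d) × (∀ d → g (f d) ≡ g d) × (∀ d → x d ≡ u d + g d))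

  relations : List (Vec n)
  relations = map (λ d x → δ d x + δ (a d) x) (allFin n) ++ map (λ d x → δ d x + δ (f d) x + δ (f (f d)) x) (allFin n)

  δ-eq : ∀ {p q r t : Dart} → (p ≡ q → r ≡ t) → (r ≡ t → p ≡ q) → δ p q ≡ δ r t
  δ-eq {p} {q} {r} {t} to from with p ≟ q
  ... | yes e = sym (trans (cong (δ r) (sym (to e))) (δ-refl r))
  ... | no ne = sym (δ-≢ (ne ∘ from))

  span⇒relation : ∀ {x} → Span relations x → Relation x
  span⇒relation (gen v∈) with ∈-++⁻ (map (λ d x → δ d x + δ (a d) x) (allFin n)) v∈
  ... | inj₁ p with ∈-map⁻ (λ d x → δ d x + δ (a d) x) p
  ...   | d , _ , refl = (λ x → δ d x + δ (a d) x) , (λ _ → 0ℤ) , inv , (λ _ → refl) , (λ x → sym (ℤₚ.+-identityʳ _))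
    where
    inv : ∀ x → δ d (a x) + δ (a d) (a x) ≡ δ d x + δ (a d) x
    inv x = trans (cong₂ _+_ (δ-eq {d} {a x} {a d} {x} (λ e → trans (cong a e) (aa x)) (λ e → trans (sym (aa d)) (cong a e)))
      (δ-eq {a d} {a x} {d} {x} a-inj (cong a))) (ℤₚ.+-comm (δ (a d) x) (δ d x))
  span⇒relation (gen v∈) | inj₂ p with ∈-map⁻ (λ d x → δ d x + δ (f d) x + δ (f (f d)) x) p
  ...   | d , _ , refl = (λ _ → 0ℤ) , (λ x → δ d x + δ (f d) x + δ (f (f d)) x) , (λ _ → refl) , inv , (λ x → sym (ℤₚ.+-identityˡ _))
    where
    inv : ∀ x → δ d (f x) + δ (f d) (f x) + δ (f (f d)) (f x) ≡ δ d x + δ (f d) x + δ (f (f d)) x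
    inv x = trans (cong₂ _+_ (cong₂ _+_ (δ-eq {d} {f x} {f (f d)} {x} (λ e → trans (cong (f ∘ f) e) (fff x)) (λ e → trans (sym (fff d)) (cong f e)))
      (δ-eq {f d} {f x} {d} {x} f-inj (cong f)))
      (δ-eq {f (f d)} {f x} {f d} {x} f-inj (cong f))) (rot (δ (f (f d)) x) (δ d x) (δ (f d) x))
      where
      rot : ∀ x y z → x + y + z ≡ y + z + x
      rot = solve-∀
  span⇒relation nil = (λ _ → 0ℤ) , (λ _ → 0ℤ) , (λ _ → refl) , (λ _ → refl) , (λ _ → refl)
  span⇒relation (lin p q S T) with span⇒relation S | span⇒relation T
  ... | u , g , ui , gi , e | u′ , g′ , ui′ , gi′ , e′ =
    (λ d → p * u d + q * u′ d) , (λ d → p * g d + q * g′ d) ,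
    (λ d → cong₂ (λ x y → p * x + q * y) (ui d) (ui′ d)) , (λ d → cong₂ (λ x y → p * x + q * y) (gi d) (gi′ d)) ,
    (λ d → trans (cong₂ (λ x y → p * x + q * y) (e d) (e′ d)) (eq p q (u d) (g d) (u′ d) (g′ d)))
    where
    eq : ∀ p q u g u′ g′ → p * (u + g) + q * (u′ + g′) ≡ (p * u + q * u′) + (p * g + q * g′)
    eq = solve-∀
  span⇒relation (ext e S) with span⇒relation S
  ... | u , g , ui , gi , e′ = u , g , ui , gi , (λ d → trans (sym (e d)) (e′ d))

  orth⇒cocycle : ∀ {η} → All (λ v → dot η v ≡ 0ℤ) relations → Cocycle η
  orth⇒cocycle {η} o = record { anti = an ; closed = cl }
    where
    η·δ : ∀ d → dot η (δ d) ≡ η d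
    η·δ d = trans (dot-comm η (δ d)) (dot-δ d η)
    η·+ : ∀ x y → dot η (λ i → x i + y i) ≡ dot η x + dot η y
    η·+ x y = trans (dot-cong (λ _ → refl) (λ i → sym (one (x i) (y i)))) (trans (dot-linʳ η 1ℤ 1ℤ x y) (one (dot η x) (dot η y)))
      where
      one : ∀ a b → 1ℤ * a + 1ℤ * b ≡ a + b
      one = solve-∀
    an : ∀ d → η (a d) ≡ - η d
    an d = solve₁ (trans (sym (trans (η·+ (δ d) (δ (a d))) (cong₂ _+_ (η·δ d) (η·δ (a d)))))
      (All.lookup o (∈-++⁺ˡ (∈-map⁺ (λ d x → δ d x + δ (a d) x) (∈-allFin d)))))
      where
      solve₁ : ∀ {x y} → x + y ≡ 0ℤ → y ≡ - x
      solve₁ {x} {y} e = trans (eq x y) (trans (cong (_- x) e) (ℤₚ.+-identityˡ (- x)))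
        where
        eq : ∀ x y → y ≡ x + y - x
        eq = solve-∀
    cl : ∀ d → η d + η (f d) + η (f (f d)) ≡ 0ℤ
    cl d = trans (sym (trans (η·+ (λ x → δ d x + δ (f d) x) (δ (f (f d)))) (cong₂ _+_
      (trans (η·+ (δ d) (δ (f d))) (cong₂ _+_ (η·δ d) (η·δ (f d)))) (η·δ (f (f d))))))
      (All.lookup o (∈-++⁺ʳ (map (λ d x → δ d x + δ (a d) x) (allFin n)) (∈-map⁺ (λ d x → δ d x + δ (f d) x + δ (f (f d)) x) (∈-allFin d))))

  -- A functional orthogonal to the relations is a cocycle, so a chain that no cocycle detects is a
  -- relation up to a factor.
  alternative : ∀ (c : Vec n) → (∃[ N ] (N ≢ 0ℤ × Relation (λ d → N * c d))) ⊎ (Σ[ η ∈ Vec n ] (Cocycle η × dot η c ≢ 0ℤ))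
  alternative c with fredholm relations c
  ... | inj₁ (N , N≢0 , S) = inj₁ (N , N≢0 , span⇒relation S)
  ... | inj₂ (η , o , ne) = inj₂ (η , orth⇒cocycle o , ne)

  -- If the chain dual to ω is the boundary of g (up to N), then h is a potential of 6 N ω.
  cup-nondegenerate : ∀ {ω} → Cocycle ω →
    (Σ[ η ∈ Vec n ] (Cocycle η × W ω η ≢ 0ℤ)) ⊎
    (∃[ N ] Σ[ h ∈ Vec n ] (N ≢ 0ℤ × (∀ d → h (s d) ≡ h d) × (∀ d → N * ω d ≡ h d - h (a d))))
  cup-nondegenerate {ω} cω with alternative (λ d → ω (f (f d)) - ω (f d))
  ... | inj₂ (η , cη , ne) = inj₁ (η , cη , λ e → ne (trans (sym (W-dot ω η)) e))
  ... | inj₁ (N , N≢0 , u , g , ui , gi , e) = inj₂ (+ 6 * N , h , *-≢0 {+ 6} {N} (λ ()) N≢0 , h-s , h-a)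
    where
    -- Across an edge `g` jumps by multiples of `ω`. The two further terms, one for each side of the
    -- corner between `b d` and `d`, compensate the jumps, so that `h` descends from corners to
    -- vertices.
    h : Vec n
    h d = g d + + 2 * (N * ω d) + + 2 * (N * ω (b d))
    jump : ∀ d → g d + + 2 * (N * ω (b d)) ≡ g (s d) + + 2 * (N * ω (s d))
    jump d = trans (lem N (ω (f d)) (ω (f (f d))) (ω (f (a d))) (ω (f (f (a d)))) (ω (b d)) (ω (s d)) (u d) (g d) (g (a d)) (u (a d)) (e d) (e (a d)) (ui d) (turn cω d))
      (cong (_+ + 2 * (N * ω (s d))) (trans (sym (gi (a d))) (cong g (fa d))))
      where
      lem : ∀ N x y x′ y′ p q u g g′ u′ → N * (y - x) ≡ u + g → N * (y′ - x′) ≡ u′ + g′ → u′ ≡ u → (x - y) - (x′ - y′) ≡ + 2 * (p - q) →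
        g + + 2 * (N * p) ≡ g′ + + 2 * (N * q)
      lem N x y x′ y′ p q u g g′ .u e₁ e₂ refl e₃ =
        trans (eq g u N p) (trans (cong₂ (λ i j → i + j) (sym e₁) (cong (λ t → - u + N * t) (shift p q x y x′ y′ e₃)))
          (trans (eq₂ N x y x′ y′ q u) (trans (cong (λ t → t - u + + 2 * (N * q)) e₂) (eq₃ u g′ N q))))
        where
        shift : ∀ p q x y x′ y′ → (x - y) - (x′ - y′) ≡ + 2 * (p - q) → + 2 * p ≡ (x - y) - (x′ - y′) + + 2 * q
        shift p q x y x′ y′ e = trans (eq′ p q) (cong (_+ + 2 * q) (sym e))
          where
          eq′ : ∀ p q → + 2 * p ≡ + 2 * (p - q) + + 2 * q
          eq′ = solve-∀
        eq : ∀ g u N p → g + + 2 * (N * p) ≡ (u + g) + (- u + N * (+ 2 * p))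
        eq = solve-∀
        eq₂ : ∀ N x y x′ y′ q u → N * (y - x) + (- u + N * ((x - y) - (x′ - y′) + + 2 * q)) ≡ N * (y′ - x′) - u + + 2 * (N * q)
        eq₂ = solve-∀
        eq₃ : ∀ u g′ N q → u + g′ - u + + 2 * (N * q) ≡ g′ + + 2 * (N * q)
        eq₃ = solve-∀
    h-s : ∀ d → h (s d) ≡ h d
    h-s d = trans (cong (λ t → g (s d) + + 2 * (N * ω (s d)) + + 2 * (N * ω t)) (bs d))
      (trans (cong (_+ + 2 * (N * ω d)) (sym (jump d))) (eq (g d) (+ 2 * (N * ω (b d))) (+ 2 * (N * ω d))))
      where
      eq : ∀ x y z → x + y + z ≡ x + z + y
      eq = solve-∀
    h-a : ∀ d → + 6 * N * ω d ≡ h d - h (a d)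
    h-a d = sym (trans (cong₂ _-_
        (trans (eq₁ (g d) (+ 2 * (N * ω d)) (+ 2 * (N * ω (b d)))) (cong (_+ + 2 * (N * ω d)) (jump d)))
        (cong₂ (λ x y → x + + 2 * (N * y) + + 2 * (N * ω (b (a d)))) (trans (sym (gi (a d))) (cong g (fa d))) (anti cω d)))
      (trans (cong (λ t → g (s d) + + 2 * (N * ω (s d)) + + 2 * (N * ω d) - (g (s d) + + 2 * (N * - ω d) + + 2 * (N * t))) ba)
        (eq₂ (g (s d)) N (ω (s d)) (ω d))))
      where
      eq₁ : ∀ x y z → x + y + z ≡ x + z + y
      eq₁ = solve-∀
      eq₂ : ∀ g N x y → g + + 2 * (N * x) + + 2 * (N * y) - (g + + 2 * (N * - y) + + 2 * (N * (x - y))) ≡ + 6 * N * y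
      eq₂ = solve-∀
      ba : ω (b (a d)) ≡ ω (s d) - ω d
      ba = trans (anti cω (f (f (a d)))) (trans (lem (ω (a d)) (ω (f (a d))) (ω (f (f (a d)))) (closed cω (a d)))
        (cong₂ (λ x y → x + y) (cong ω (fa d)) (anti cω d)))
        where
        lem : ∀ x y z → x + y + z ≡ 0ℤ → - z ≡ y + x
        lem x y z e = trans (eq x y z) (trans (cong (λ t → y + x - t) e) (ℤₚ.+-identityʳ (y + x)))
          where
          eq : ∀ x y z → - z ≡ y + x - (x + y + z)
          eq = solve-∀

-- Cocycles on a toroidal triangulation

module Surface (M : Map) (T : IsToroidalTriangulation M) where
  open IsToroidalTriangulation T
  open Homology M triangular public
  open Map M using (n; σ; α; α-invol; α-nofix)

  private
    V E F : ℕ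
    V = proj₁ euler
    E = proj₁ (proj₂ euler)
    F = proj₁ (proj₂ (proj₂ euler))

    HV : HasOrbits M s V
    HV = proj₁ (proj₂ (proj₂ (proj₂ euler)))
    HE : HasOrbits M a E
    HE = proj₁ (proj₂ (proj₂ (proj₂ (proj₂ euler))))
    HF : HasOrbits M f F
    HF = proj₁ (proj₂ (proj₂ (proj₂ (proj₂ (proj₂ euler)))))
    V+F≡E : V ℕ.+ F ≡ E
    V+F≡E = proj₂ (proj₂ (proj₂ (proj₂ (proj₂ (proj₂ euler)))))

  private
    module VI = Orbits.Index M s s-inj HV
    module EI = Orbits.Index M a a-inj HE
    module FI = Orbits.Index M f f-inj HF

  nv : ℕ
  nv = V

  opaque
    vtx : Dart → Fin V
    vtx = VI.idx

    vrep : Fin V → Dart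
    vrep = VI.rep

    vtx-s : ∀ d → vtx (s d) ≡ vtx d
    vtx-s = VI.idx-step

    vtx-rep : ∀ v → vtx (vrep v) ≡ v
    vtx-rep = VI.idx-rep

    vtx-same : ∀ {d e} → vtx d ≡ vtx e → SameVertex M d e
    vtx-same = VI.idx-same

    same-vtx : ∀ {d e} → SameVertex M d e → vtx d ≡ vtx e
    same-vtx = VI.same-idx

    vertex-invariant : ∀ {A : Set} (h : Dart → A) → (∀ d → h (s d) ≡ h d) → ∀ d → h d ≡ h (vrep (vtx d))
    vertex-invariant = VI.inv-idx

  vtx-face : ∀ d → vtx (a d) ≡ vtx (f d)
  vtx-face d = sym (vtx-s (a d))

  opaque
    ed : Dart → Fin E
    ed = EI.idx

    ed-a : ∀ d → ed (a d) ≡ ed d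
    ed-a = EI.idx-step

    erep : Fin E → Dart
    erep = EI.rep

    ed-rep : ∀ i → ed (erep i) ≡ i
    ed-rep = EI.idx-rep

    ed-same : ∀ {d e} → ed d ≡ ed e → e ≡ d ⊎ e ≡ a d
    ed-same {d} p = let k , q = EI.idx-same p in subst (λ x → x ≡ d ⊎ x ≡ a d) q (go k)
      where
      go : ∀ k → iter M a k d ≡ d ⊎ iter M a k d ≡ a d
      go zero = inj₁ refl
      go (suc k) with go k
      ... | inj₁ e = inj₂ (cong a e)
      ... | inj₂ e = inj₁ (trans (cong a e) (aa d))

  -- A harmonic cocycle

  private
    sg : Dart → ℤ
    sg d with d ≟ erep (ed d)
    ... | yes _ = 1ℤ
    ... | no _ = - 1ℤ

    sg-rep : ∀ {d} → d ≡ erep (ed d) → sg d ≡ 1ℤ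
    sg-rep {d} e with d ≟ erep (ed d)
    ... | yes _ = refl
    ... | no ne = ⊥-elim (ne e)

    sg-nonrep : ∀ {d} → d ≢ erep (ed d) → sg d ≡ - 1ℤ
    sg-nonrep {d} ne with d ≟ erep (ed d)
    ... | yes e = ⊥-elim (ne e)
    ... | no _ = refl

    sg-a : ∀ d → sg (a d) ≡ - sg d
    sg-a d with ed-same {erep (ed d)} {d} (ed-rep (ed d))
    ... | inj₁ e = trans (sg-nonrep (λ e′ → α-nofix d (trans e′ (trans (cong erep (ed-a d)) (sym e))))) (cong -_ (sym (sg-rep e)))
    ... | inj₂ e = trans (sg-rep (trans (cong a e) (trans (aa _) (cong erep (sym (ed-a d)))))) (cong -_ (sym (sg-nonrep (λ e′ → α-nofix d (trans (cong a e′) (sym e))))))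

    -- Coordinates for antisymmetric cochains: one unknown per edge, signed by the chosen
    -- representative dart, hence `E` unknowns.
    spread : Vec E → Vec n
    spread x d = sg d * x (ed d)

    spread-lin : ∀ p q x y d → spread (λ i → p * x i + q * y i) d ≡ p * spread x d + q * spread y d
    spread-lin p q x y d = lem p q (x (ed d)) (y (ed d)) (sg d)
      where
      lem : ∀ p q x y t → t * (p * x + q * y) ≡ p * (t * x) + q * (t * y)
      lem = solve-∀

    spread-anti : ∀ x d → spread x (a d) ≡ - spread x d
    spread-anti x d = trans (cong₂ (λ t i → t * x i) (sg-a d) (ed-a d)) (sym (ℤₚ.neg-distribˡ-* (sg d) (x (ed d))))

    div : Vec n → Fin V → ℤ
    div ω i = Σ′ (λ d → δ (vtx d) i * ω d)

    face : Vec n → Fin F → ℤ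
    face ω j = let r = FI.rep j in ω r + ω (f r) + ω (f (f r))

    div-linear : ∀ i → Linear (λ x → div (spread x) i)
    div-linear i = record
      { f-ext = λ e → Σ-cong (λ d → cong (λ t → δ (vtx d) i * (sg d * t)) (e (ed d)))
      ; f-lin = λ p q x y → trans (Σ-cong (λ d → trans (cong (δ (vtx d) i *_) (spread-lin p q x y d)) (lem p q (spread x d) (spread y d) (δ (vtx d) i))))
          (Σ-lin p q (λ d → δ (vtx d) i * spread x d) (λ d → δ (vtx d) i * spread y d)) }
      where
      lem : ∀ p q x y t → t * (p * x + q * y) ≡ p * (t * x) + q * (t * y)
      lem = solve-∀

    face-linear : ∀ j → Linear (λ x → face (spread x) j)
    face-linear j = record
      { f-ext = λ e → cong₂ _+_ (cong₂ _+_ (cong (sg r *_) (e (ed r))) (cong (sg (f r) *_) (e (ed (f r))))) (cong (sg (f (f r)) *_) (e (ed (f (f r)))))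
      ; f-lin = λ p q x y → trans (cong₂ _+_ (cong₂ _+_ (spread-lin p q x y r) (spread-lin p q x y (f r))) (spread-lin p q x y (f (f r))))
          (lem p q (spread x r) (spread y r) (spread x (f r)) (spread y (f r)) (spread x (f (f r))) (spread y (f (f r)))) }
      where
      r = FI.rep j
      lem : ∀ p q x y x′ y′ x″ y″ → (p * x + q * y) + (p * x′ + q * y′) + (p * x″ + q * y″) ≡ p * (x + x′ + x″) + q * (y + y′ + y″)
      lem = solve-∀

    constraints : ∀ {v} → V ≡ suc v → Fin (v ℕ.+ F) → Vec E → ℤ
    constraints {v} e k x = [ (λ i → div (spread x) (subst Fin (sym e) (suc i))) , face (spread x) ]′ (splitAt v k)

    constraints-linear : ∀ {v} (e : V ≡ suc v) k → Linear (constraints e k)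
    constraints-linear {v} e k with splitAt v k
    ... | inj₁ i = div-linear (subst Fin (sym e) (suc i))
    ... | inj₂ j = face-linear j

    all-but-one : ∀ {m v} (e : m ≡ suc v) (g : Vec m) → Σ′ g ≡ 0ℤ → (∀ i → g (subst Fin (sym e) (suc i)) ≡ 0ℤ) → ∀ i → g i ≡ 0ℤ
    all-but-one refl g t z (suc i) = z i
    all-but-one refl g t z zero = trans (sym (ℤₚ.+-identityʳ (g zero))) (trans (cong (λ x → g zero + x) (sym (Σ-0 z))) (trans (sym (Σ-suc g)) t))

    positive : ∀ {m} → Fin m → ∃[ v ] m ≡ suc v
    positive {suc v} _ = v , refl

    -- The constraints "closed and coclosed" number V + F, one of which is redundant, while there are E = V + F unknowns.
    harmonic : Σ[ ω ∈ Vec n ] (Cocycle ω × (∀ i → div ω i ≡ 0ℤ) × (∃[ d ] ω d ≢ 0ℤ))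
    harmonic = spread x , record { anti = spread-anti x ; closed = cl } , all-but-one e (div (spread x)) total divs , erep j , nz
      where
      d₀ : Dart
      d₀ = Fin.fromℕ< nonempty
      v = proj₁ (positive (vtx d₀))
      e : V ≡ suc v
      e = proj₂ (positive (vtx d₀))
      sol = common-zero (constraints e) (constraints-linear e) (ℕₚ.≤-reflexive (trans (cong (ℕ._+ F) (sym e)) V+F≡E))
      x = proj₁ sol
      j = proj₁ (proj₁ (proj₂ sol))
      z : ∀ k → constraints e k x ≡ 0ℤ
      z = proj₂ (proj₂ sol)
      divs : ∀ i → div (spread x) (subst Fin (sym e) (suc i)) ≡ 0ℤ
      divs i = trans (sym (cong [ (λ i → div (spread x) (subst Fin (sym e) (suc i))) , face (spread x) ]′ (Finₚ.splitAt-↑ˡ v i F))) (z (i ↑ˡ F))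
      faces : ∀ i → face (spread x) i ≡ 0ℤ
      faces i = trans (sym (cong [ (λ i → div (spread x) (subst Fin (sym e) (suc i))) , face (spread x) ]′ (Finₚ.splitAt-↑ʳ v F i))) (z (v ↑ʳ i))
      -- Opposite darts cancel. Hence the divergences sum to zero, and the one left out of
      -- `constraints` vanishes with the others.
      Σ-spread : Σ′ (spread x) ≡ 0ℤ
      Σ-spread = half (trans (sym (Σ-a (spread x))) (trans (Σ-cong (λ d → trans (spread-anti x d) (sym (neg (spread x d))))) (trans (Σ-* (- 1ℤ) (spread x)) (neg (Σ′ (spread x))))))
        where
        neg : ∀ t → - 1ℤ * t ≡ - t
        neg = solve-∀
        half : ∀ {t} → t ≡ - t → t ≡ 0ℤ
        half {t} p = *≡0⇒ʳ {+ 2} (λ ()) (trans (two t) (trans (cong (λ x → t + x) p) (ℤₚ.+-inverseʳ t)))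
          where
          two : ∀ t → + 2 * t ≡ t + t
          two = solve-∀
      total : Σ′ (div (spread x)) ≡ 0ℤ
      total = trans (Σ-comm (λ i d → δ (vtx d) i * spread x d)) (trans (Σ-cong (λ d → trans (Σ-cong (λ i → ℤₚ.*-comm (δ (vtx d) i) (spread x d)))
        (trans (Σ-* (spread x d) (δ (vtx d))) (trans (cong (spread x d *_) (trans (Σ-cong (λ i → sym (ℤₚ.*-identityʳ (δ (vtx d) i)))) (Σ-δ (vtx d) (λ _ → 1ℤ)))) (ℤₚ.*-identityʳ (spread x d)))))) Σ-spread)
      nz : spread x (erep j) ≢ 0ℤ
      nz p = proj₂ (proj₁ (proj₂ sol)) (trans (sym (trans (cong₂ (λ t i → t * x i) (sg-rep (cong erep (sym (ed-rep j)))) (ed-rep j)) (ℤₚ.*-identityˡ (x j)))) p)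
      rot : ∀ {x y z} → x + y + z ≡ 0ℤ → y + z + x ≡ 0ℤ
      rot {x} {y} {z} p = trans (eq x y z) p
        where
        eq : ∀ x y z → y + z + x ≡ x + y + z
        eq = solve-∀
      cl : ∀ d → spread x d + spread x (f d) + spread x (f (f d)) ≡ 0ℤ
      cl d = let k , p = FI.rep-idx d in subst (λ d → spread x d + spread x (f d) + spread x (f (f d)) ≡ 0ℤ) p (go k)
        where
        go : ∀ k → let d′ = iter M f k (FI.rep (FI.idx d)) in spread x d′ + spread x (f d′) + spread x (f (f d′)) ≡ 0ℤ
        go zero = faces (FI.idx d)
        go (suc k) = let d′ = iter M f k (FI.rep (FI.idx d)) in
          trans (cong (λ t → spread x (f d′) + spread x (f (f d′)) + spread x t) (fff d′)) (rot {spread x d′} (go k))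

    vertex-function-orthogonal : ∀ ω → (∀ i → div ω i ≡ 0ℤ) → (H : Vec V) → Σ′ (λ d → ω d * H (vtx d)) ≡ 0ℤ
    vertex-function-orthogonal ω dz H = begin
      Σ′ (λ d → ω d * H (vtx d))                                ≡⟨ Σ-cong (λ d → expand d) ⟩
      Σ′ (λ d → Σ′ (λ i → H i * (δ (vtx d) i * ω d)))           ≡⟨ Σ-comm (λ d i → H i * (δ (vtx d) i * ω d)) ⟩
      Σ′ (λ i → Σ′ (λ d → H i * (δ (vtx d) i * ω d)))           ≡⟨ Σ-0 (λ i → trans (Σ-* (H i) (λ d → δ (vtx d) i * ω d)) (trans (cong (H i *_) (dz i)) (ℤₚ.*-zeroʳ (H i)))) ⟩
      0ℤ                                                        ∎
      where
      open ≡-Reasoning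
      swap : ∀ x y z → x * (y * z) ≡ z * (y * x)
      swap = solve-∀
      expand : ∀ d → ω d * H (vtx d) ≡ Σ′ (λ i → H i * (δ (vtx d) i * ω d))
      expand d = trans (cong (ω d *_) (sym (Σ-δ (vtx d) H)))
        (trans (sym (Σ-* (ω d) (λ i → δ (vtx d) i * H i))) (Σ-cong (λ i → swap (ω d) (δ (vtx d) i) (H i))))

    -- Energy argument: `N` times the sum of squares of `ω` is the pairing of `ω` with the
    -- differences of `h`, which vanishes because `ω` is divergence-free and `h` lives on vertices.
    harmonic-not-exact : ∀ {ω} → Cocycle ω → (∀ i → div ω i ≡ 0ℤ) → ∀ N (h : Vec n) → N ≢ 0ℤ → (∀ d → h (s d) ≡ h d) →
      (∀ d → N * ω d ≡ h d - h (a d)) → ∀ d → ω d ≡ 0ℤ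
    harmonic-not-exact {ω} c dz N h N≢0 hs e = Σ-sq≡0 ω (*≡0⇒ʳ N≢0 (trans (sym (Σ-* N (λ d → ω d * ω d)))
      (trans (Σ-cong square) (trans (Σ-sub (λ d → ω d * h d) (λ d → ω d * h (a d)))
        (trans (cong₂ (λ x y → x - y) orth orth′) refl)))))
      where
      orth : Σ′ (λ d → ω d * h d) ≡ 0ℤ
      orth = trans (Σ-cong (λ d → cong (ω d *_) (vertex-invariant h hs d))) (vertex-function-orthogonal ω dz (λ i → h (vrep i)))
      neg : ∀ x y → - x * y ≡ - 1ℤ * (x * y)
      neg = solve-∀
      flip : ∀ d → ω (a d) * h (a (a d)) ≡ - 1ℤ * (ω d * h d)
      flip d = trans (cong₂ _*_ (anti c d) (cong h (aa d))) (neg (ω d) (h d))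
      orth′ : Σ′ (λ d → ω d * h (a d)) ≡ 0ℤ
      orth′ = trans (sym (Σ-a (λ d → ω d * h (a d)))) (trans (Σ-cong flip) (trans (Σ-* (- 1ℤ) (λ d → ω d * h d)) (cong (- 1ℤ *_) orth)))
      square : ∀ d → N * (ω d * ω d) ≡ ω d * h d - ω d * h (a d)
      square d = trans (swap N (ω d)) (trans (cong (ω d *_) (e d)) (dist (ω d) (h d) (h (a d))))
        where
        swap : ∀ N x → N * (x * x) ≡ x * (N * x)
        swap = solve-∀
        dist : ∀ x y z → x * (y - z) ≡ x * y - x * z
        dist = solve-∀

  independent-cocycles : Σ[ ω ∈ Vec n ] Σ[ η ∈ Vec n ] (Cocycle ω × Cocycle η × W ω η ≢ 0ℤ)
  independent-cocycles = go harmonic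
    where
    go : Σ[ ω ∈ Vec n ] (Cocycle ω × (∀ i → div ω i ≡ 0ℤ) × (∃[ d ] ω d ≢ 0ℤ)) →
      Σ[ ω ∈ Vec n ] Σ[ η ∈ Vec n ] (Cocycle ω × Cocycle η × W ω η ≢ 0ℤ)
    go (ω , c , dz , d , nz) with cup-nondegenerate c
    ... | inj₁ (η , cη , ne) = ω , η , c , cη , ne
    ... | inj₂ (N , h , N≢0 , hs , e) = ⊥-elim (nz (harmonic-not-exact c dz N h N≢0 hs e d))

  -- Integral boundaries and the class of a loop

  private
    -- `g` is constant on faces and jumps by multiples of `K` across edges. By connectedness
    -- `g - g d₀` is divisible by `K` everywhere; the quotient `h` is accumulated along the
    -- connecting walks instead of being divided out.
    torsion-free : ∀ K (g c : Vec n) → K ≢ 0ℤ → (∀ d → g (f d) ≡ g d) → (∀ d → K * c d ≡ g d - g (a d)) → IsBoundary M c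
    torsion-free K g c K≢0 gf e = h , (λ d → cancel (step₁ d)) , (λ d → cancel (step₂ d))
      where
      d₀ : Dart
      d₀ = Fin.fromℕ< nonempty
      walk : ∀ {d d′} → Reach M d d′ → ∃[ h ] (g d ≡ g d′ + K * h)
      walk {d} here = 0ℤ , trans (sym (ℤₚ.+-identityʳ (g d))) (cong (λ x → g d + x) (sym (ℤₚ.*-zeroʳ K)))
      walk {d} {d′} (stepσ r) = let h , p = walk r in h + c d ,
        trans (eq (g d) (g (a d))) (trans (cong₂ _+_ (trans (sym (gf (a d))) (trans (cong g (fa d)) p)) (sym (e d))) (eq′ (g d′) K h (c d)))
        where
        eq : ∀ x y → x ≡ y + (x - y)
        eq = solve-∀
        eq′ : ∀ x K h c → x + K * h + K * c ≡ x + K * (h + c)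
        eq′ = solve-∀
      walk {d} {d′} (stepα r) = let h , p = walk r in h + c d ,
        trans (eq (g d) (g (a d))) (trans (cong₂ _+_ p (sym (e d))) (eq′ (g d′) K h (c d)))
        where
        eq : ∀ x y → x ≡ y + (x - y)
        eq = solve-∀
        eq′ : ∀ x K h c → x + K * h + K * c ≡ x + K * (h + c)
        eq′ = solve-∀
      h : Vec n
      h d = proj₁ (walk (connected d d₀))
      gh : ∀ d → g d ≡ g d₀ + K * h d
      gh d = proj₂ (walk (connected d d₀))
      cancel : ∀ {x y} → K * x ≡ K * y → x ≡ y
      cancel {x} {y} p = ℤₚ.i-j≡0⇒i≡j x y (*≡0⇒ʳ K≢0 (trans (eq K x y) (trans (cong (_- K * y) p) (ℤₚ.+-inverseʳ (K * y)))))
        where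
        eq : ∀ K x y → K * (x - y) ≡ K * x - K * y
        eq = solve-∀
      Kh : ∀ d → K * h d ≡ g d - g d₀
      Kh d = trans (eq (g d₀) (K * h d)) (cong (_- g d₀) (sym (gh d)))
        where
        eq : ∀ x y → y ≡ x + y - x
        eq = solve-∀
      step₁ : ∀ d → K * h (f d) ≡ K * h d
      step₁ d = trans (Kh (f d)) (trans (cong (_- g d₀) (gf d)) (sym (Kh d)))
      step₂ : ∀ d → K * c d ≡ K * (h d - h (a d))
      step₂ d = trans (e d) (trans (eq (g d) (g (a d)) (g d₀)) (trans (cong₂ _-_ (sym (Kh d)) (sym (Kh (a d)))) (eq′ K (h d) (h (a d)))))
        where
        eq : ∀ x y z → x - y ≡ (x - z) - (y - z)
        eq = solve-∀
        eq′ : ∀ K x y → K * x - K * y ≡ K * (x - y)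
        eq′ = solve-∀

    -- Antisymmetry of `c` cancels the invariant part `u`, at the price of a factor 2.
    relation⇒boundary : ∀ (c : Vec n) → (∀ d → c (a d) ≡ - c d) → ∀ {N} → N ≢ 0ℤ → Relation (λ d → N * c d) → IsBoundary M c
    relation⇒boundary c ca {N} N≢0 (u , g , ui , gi , e) = torsion-free (+ 2 * N) g c (*-≢0 {+ 2} (λ ()) N≢0) gi (λ d →
      lem (c d) (c (a d)) (u d) (u (a d)) (g d) (g (a d)) (ca d) (ui d) (e d) (e (a d)))
      where
      lem : ∀ c c′ u u′ g g′ → c′ ≡ - c → u′ ≡ u → N * c ≡ u + g → N * c′ ≡ u′ + g′ → + 2 * N * c ≡ g - g′
      lem c .(- c) u .u g g′ refl refl p q = trans (eq N c) (trans (cong₂ _-_ p q) (eq′ u g g′))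
        where
        eq : ∀ N c → + 2 * N * c ≡ N * c - N * - c
        eq = solve-∀
        eq′ : ∀ u g g′ → u + g - (u + g′) ≡ g - g′
        eq′ = solve-∀

  -- If no cocycle detected `l`, a multiple of its chain would be a relation, so the chain itself a
  -- boundary and `l` a contractible loop.
  loop-class : ∀ l → vtx (a l) ≡ vtx l → Σ[ η ∈ Vec n ] (Cocycle η × η l ≢ 0ℤ)
  loop-class l loop with alternative (λ d → δ l d - δ (a l) d)
  ... | inj₂ (η , c , ne) = η , c , λ e → ne (trans (dot-comm η _) (trans (dot-sub η)
          (trans (cong (λ x → η l - x) (anti c l)) (cong (λ t → t - - t) e))))
    where
    dot-sub : ∀ η → dot (λ d → δ l d - δ (a l) d) η ≡ η l - η (a l)
    dot-sub η = trans (dot-cong (λ d → sym (one (δ l d) (δ (a l) d))) (λ _ → refl))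
      (trans (dot-linˡ η 1ℤ (- 1ℤ) (δ l) (δ (a l))) (trans (cong₂ (λ x y → 1ℤ * x + - 1ℤ * y) (dot-δ l η) (dot-δ (a l) η)) (one (η l) (η (a l)))))
      where
      one : ∀ x y → 1ℤ * x + - 1ℤ * y ≡ x - y
      one = solve-∀
  ... | inj₁ (N , N≢0 , R) = ⊥-elim (noContrLoop C refl (proj₁ B , proj₁ (proj₂ B) , λ d → trans (chain d) (proj₂ (proj₂ B) d)))
    where
    C : Cycle M
    C = record
      { len = 0
      ; walk = λ _ → l
      ; closed = λ i → vtx-same loop
      ; distinctV = λ { zero zero ne → ⊥-elim (ne refl) }
      ; distinctE = λ { zero zero ne → ⊥-elim (ne refl) } }
    c : Vec n
    c d = δ l d - δ (a l) d
    ca : ∀ d → c (a d) ≡ - c d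
    ca d = trans (cong₂ _-_ (δ-eq {l} {a d} {a l} {d} (λ e → trans (cong a e) (aa d)) (λ e → trans (sym (aa l)) (cong a e))) (δ-eq {a l} {a d} {l} {d} a-inj (cong a)))
      (eq (δ l d) (δ (a l) d))
      where
      eq : ∀ x y → y - x ≡ - (x - y)
      eq = solve-∀
    B : IsBoundary M c
    B = relation⇒boundary c ca N≢0 R
    count-δ : ∀ d → + count M {1} (λ _ → l) d ≡ δ l d
    count-δ d with l ≟ d
    ... | yes _ = refl
    ... | no _ = refl
    chain : ∀ d → chainOf M C d ≡ c d
    chain d = cong₂ _-_ (count-δ d) (trans (count-δ (a d)) (δ-eq {l} {a d} {a l} {d} (λ e → trans (cong a e) (aa d)) (λ e → trans (sym (aa l)) (cong a e))))

-- Walks, trails and paths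

saturate : ∀ {ℓ K} {S : Set ℓ} {Goal : Set} (Vis : S → Fin K → Set) → (∀ s w → Dec (Vis s w)) →
  (∀ s → Goal ⊎ (Σ[ s′ ∈ S ] ((∀ {w} → Vis s w → Vis s′ w) × (∃[ w ] (¬ Vis s w × Vis s′ w))))) → S → Goal
saturate {K = K} {S} {Goal} Vis vis? step s = go _ s (allFin K) ℕₚ.≤-refl (λ w _ → ∈-allFin w)
  where
  go : ∀ k s todo → length todo ℕ.≤ k → (∀ w → ¬ Vis s w → w ∈ todo) → Goal
  go k s todo len cover with step s
  ... | inj₁ g = g
  ... | inj₂ (s′ , mono , w , new , seen) with cover w new
  ...   | w∈ with k
  go k s [] len cover | inj₂ (s′ , mono , w , new , seen) | () | _
  ...     | zero with todo
  go k s (_ ∷ _) () cover | inj₂ (s′ , mono , w , new , seen) | w∈ | zero | _ ∷ _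
  go k s todo len cover | inj₂ (s′ , mono , w , new , seen) | w∈ | suc k′ =
    go k′ s′ (filter (λ v → ¬? (v ≟ w)) todo)
      (ℕₚ.≤-pred (ℕₚ.≤-trans (filter-notAll (λ v → ¬? (v ≟ w)) todo (lose w∈)) len))
      (λ v nv → ∈-filter⁺ (λ v → ¬? (v ≟ w)) (cover v (nv ∘ mono)) (λ { refl → nv seen }))
    where
    lose : ∀ {xs} → w ∈ xs → Any (λ v → ¬ (v ≢ w)) xs
    lose (here refl) = here (λ ne → ne refl)
    lose (there p) = there (lose p)

-- Tails and edge labels are abstract because the module is used twice: for the vertices of the map,
-- and for those after the base of a loop has been split.
module Walks {n K E : ℕ} (a : Fin n → Fin n) (aa : ∀ d → a (a d) ≡ d)
  (vt : Fin n → Fin K) (ed : Fin n → Fin E) (ed-a : ∀ d → ed (a d) ≡ ed d)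
  (ed-same : ∀ {d e} → ed d ≡ ed e → e ≡ d ⊎ e ≡ a d) where

  open import Data.List.Membership.DecPropositional (_≟_ {K}) using (_∈?_)
  open import Data.List.Membership.DecPropositional (_≟_ {n}) using () renaming (_∈?_ to _∈ᵈ?_)

  Darts : Set
  Darts = List (Fin n)

  hd : Fin n → Fin K
  hd d = vt (a d)

  hd-a : ∀ d → hd (a d) ≡ vt d
  hd-a d = cong vt (aa d)

  data Walk : Fin K → Darts → Fin K → Set where
    [] : ∀ {u} → Walk u [] u
    _∷_ : ∀ {u v d ds} → vt d ≡ u → Walk (hd d) ds v → Walk u (d ∷ ds) v

  _++ʷ_ : ∀ {u v w xs ys} → Walk u xs v → Walk v ys w → Walk u (xs ++ ys) w
  [] ++ʷ q = q
  (e ∷ p) ++ʷ q = e ∷ (p ++ʷ q)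

  rev : Darts → Darts
  rev [] = []
  rev (d ∷ ds) = rev ds ++ a d ∷ []

  Walk-rev : ∀ {u ds v} → Walk u ds v → Walk v (rev ds) u
  Walk-rev [] = []
  Walk-rev {ds = d ∷ ds} (refl ∷ p) = Walk-rev p ++ʷ (refl ∷ subst (λ t → Walk t [] (vt d)) (sym (hd-a d)) [])

  ∈-rev : ∀ {x} ds → x ∈ rev ds → ∃[ y ] (y ∈ ds × x ≡ a y)
  ∈-rev (d ∷ ds) x∈ with ∈-++⁻ (rev ds) x∈
  ... | inj₁ p = let y , y∈ , e = ∈-rev ds p in y , there y∈ , e
  ... | inj₂ (here e) = d , here refl , e

  verts : Fin K → Darts → List (Fin K)
  verts u ds = u ∷ map hd ds

  split : ∀ {u v w ds} → Walk u ds v → w ∈ verts u ds →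
    ∃[ xs ] ∃[ ys ] (ds ≡ xs ++ ys × Walk u xs w × Walk w ys v)
  split {ds = ds} p (here refl) = [] , ds , refl , [] , p
  split {ds = d ∷ ds} (e ∷ p) (there w∈) = let xs , ys , q , p₁ , p₂ = split p w∈ in
    d ∷ xs , ys , cong (d ∷_) q , (e ∷ p₁) , p₂

  Apart : Fin n → Fin n → Set
  Apart d e = ed d ≢ ed e

  Trail : Darts → Set
  Trail = AllPairs Apart

  Disjoint : Darts → Darts → Set
  Disjoint xs ys = ∀ {x y} → x ∈ xs → y ∈ ys → Apart x y

  disjoint-rev : ∀ {xs} ys → Disjoint xs ys → Disjoint xs (rev ys)
  disjoint-rev ys D x∈ y∈ = let z , z∈ , e = ∈-rev ys y∈ in λ q → D x∈ z∈ (trans q (trans (cong ed e) (ed-a z)))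

  disjoint-sym : ∀ {xs ys} → Disjoint xs ys → Disjoint ys xs
  disjoint-sym D y∈ x∈ = D x∈ y∈ ∘ sym

  trail-++ : ∀ {xs ys} → Trail xs → Trail ys → Disjoint xs ys → Trail (xs ++ ys)
  trail-++ p q D = AllPairsₚ.++⁺ p q (All.tabulate (λ x∈ → All.tabulate (λ y∈ → D x∈ y∈)))

  trail-++⁻ : ∀ xs {ys} → Trail (xs ++ ys) → Trail xs × Trail ys × Disjoint xs ys
  trail-++⁻ [] q = [] , q , λ ()
  trail-++⁻ (x ∷ xs) (p ∷ q) = let q₁ , q₂ , D = trail-++⁻ xs q ; p₁ , p₂ = Allₚ.++⁻ xs p in
    p₁ ∷ q₁ , q₂ , λ { (here refl) y∈ → All.lookup p₂ y∈ ; (there x∈) y∈ → D x∈ y∈ }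

  trail-rev : ∀ {xs} → Trail xs → Trail (rev xs)
  trail-rev [] = []
  trail-rev {x ∷ xs} (p ∷ q) = trail-++ (trail-rev q) ([] ∷ [])
    (λ { y∈ (here refl) e → let z , z∈ , r = ∈-rev xs y∈ in
       All.lookup p z∈ (trans (sym (ed-a x)) (trans (sym e) (trans (cong ed r) (ed-a z)))) })

  trail-⊆ : ∀ {xs ys} → xs ⊆ ys → Trail ys → Trail xs
  trail-⊆ [] [] = []
  trail-⊆ (y ∷ʳ s) (_ ∷ q) = trail-⊆ s q
  trail-⊆ (refl ∷ s) (p ∷ q) = All-resp-⊆ s p ∷ trail-⊆ s q

  ⊆⇒∈ : ∀ {xs ys : Darts} → xs ⊆ ys → ∀ {x} → x ∈ xs → x ∈ ys
  ⊆⇒∈ (y ∷ʳ s) x∈ = there (⊆⇒∈ s x∈)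
  ⊆⇒∈ (refl ∷ s) (here e) = here e
  ⊆⇒∈ (refl ∷ s) (there x∈) = there (⊆⇒∈ s x∈)

  disjoint-⊆ : ∀ {xs ys xs′ ys′} → xs′ ⊆ xs → ys′ ⊆ ys → Disjoint xs ys → Disjoint xs′ ys′
  disjoint-⊆ s t D x∈ y∈ = D (⊆⇒∈ s x∈) (⊆⇒∈ t y∈)

  data Path : Fin K → Darts → Fin K → Set where
    [] : ∀ {v} → Path v [] v
    cons : ∀ {u v d ds} → vt d ≡ u → u ∉ verts (hd d) ds → Path (hd d) ds v → Path u (d ∷ ds) v

  Path⇒Walk : ∀ {u ds v} → Path u ds v → Walk u ds v
  Path⇒Walk [] = []
  Path⇒Walk (cons e _ p) = e ∷ Path⇒Walk p

  suffix : ∀ {u v w ds} → Path u ds v → w ∈ verts u ds → ∃[ es ] (Path w es v × es ⊆ ds)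
  suffix {ds = ds} p (here refl) = ds , p , ⊆-refl
  suffix (cons {d = d} _ _ p) (there w∈) = let es , q , s = suffix p w∈ in es , q , d ∷ʳ s

  -- Loop erasure. Recording the result as a sublist lets trails, disjointness and properties of all
  -- darts pass to it.
  simplify : ∀ {u v ds} → Walk u ds v → ∃[ es ] (Path u es v × es ⊆ ds)
  simplify [] = [] , [] , []
  simplify {u} {ds = d ∷ _} (e ∷ p) with simplify p
  ... | es , q , s with u ∈? verts (hd d) es
  ...   | yes u∈ = let es′ , q′ , s′ = suffix q u∈ in es′ , q′ , d ∷ʳ ⊆-trans s′ s
  ...   | no u∉ = d ∷ es , cons e u∉ q , refl ∷ s

  end∈verts : ∀ {u v ds} → Walk u ds v → v ∈ verts u ds
  end∈verts [] = here refl
  end∈verts (_ ∷ p) = there (end∈verts p)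

  tail∈verts : ∀ {u v ds d} → Walk u ds v → d ∈ ds → vt d ∈ verts u ds
  tail∈verts (e ∷ p) (here refl) = here e
  tail∈verts (e ∷ p) (there d∈) = there (tail∈verts p d∈)

  head∈verts : ∀ {u v ds d} → Walk u ds v → d ∈ ds → hd d ∈ verts u ds
  head∈verts p d∈ = there (∈-map⁺ hd d∈)

  tail≢end : ∀ {u v ds d} → Path u ds v → d ∈ ds → vt d ≢ v
  tail≢end (cons e u∉ p) (here refl) refl = u∉ (subst (_∈ _) e (end∈verts (Path⇒Walk p)))
  tail≢end (cons e u∉ p) (there d∈) = tail≢end p d∈

  head≢start : ∀ {u v ds d} → Path u ds v → d ∈ ds → hd d ≢ u
  head≢start (cons e u∉ p) d∈ q = u∉ (subst (_∈ _) q (∈-map⁺ hd d∈))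

  tails-distinct : ∀ {u v ds} → Path u ds v → AllPairs (λ d e → vt d ≢ vt e) ds
  tails-distinct [] = []
  tails-distinct (cons e u∉ p) = All.tabulate (λ d∈ q → u∉ (subst (_∈ _) (trans (sym q) e) (tail∈verts (Path⇒Walk p) d∈))) ∷ tails-distinct p

  -- Both ends of every edge of a walk are vertices of the walk.
  fresh : ∀ {u v ds r x} → Walk u ds v → r ∉ verts u ds → vt x ≡ r ⊎ hd x ≡ r → ∀ {y} → y ∈ ds → Apart x y
  fresh {u} {ds = ds} {x = x} p r∉ e {y} y∈ q with ed-same q | e
  ... | inj₁ refl | inj₁ refl = r∉ (tail∈verts p y∈)
  ... | inj₁ refl | inj₂ refl = r∉ (head∈verts p y∈)
  ... | inj₂ refl | inj₁ refl = r∉ (subst (_∈ verts u ds) (hd-a x) (head∈verts p y∈))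
  ... | inj₂ refl | inj₂ refl = r∉ (tail∈verts p y∈)

  apart-ends : ∀ {x y} → vt x ≢ vt y → vt x ≢ hd y → Apart x y
  apart-ends {x} {y} ne ne′ q with ed-same q
  ... | inj₁ refl = ne refl
  ... | inj₂ refl = ne′ (sym (hd-a x))

  -- Closed trails and how they grow

  record ClosedTrail (b : Fin K) : Set where
    constructor closedTrail
    field
      darts : Darts
      walk : Walk b darts b
      trail : Trail darts

    Vis : Fin K → Set
    Vis w = w ∈ verts b darts

    vis? : ∀ w → Dec (Vis w)
    vis? w = w ∈? verts b darts
  open ClosedTrail

  -- Preservation of `Q` is an implication, so that the old trail can be shown to satisfy `Q`
  -- separately, as when `Q` is vanishing in an updated gauge.
  Grown : (Q : Fin n → Set) {b : Fin K} → ClosedTrail b → List (Fin K) → Set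
  Grown Q {b} T new = Σ[ T′ ∈ ClosedTrail b ]
    ((∀ {w} → Vis T w → Vis T′ w) × All (Vis T′) new × (All Q (darts T) → All Q (darts T′)))

  module _ {Q : Fin n → Set} (Q-a : ∀ {d} → Q d → Q (a d)) {b : Fin K} (T : ClosedTrail b) where

    excursion : ∀ {u es} → Vis T u → Walk u es u → Trail es → Disjoint es (darts T) → All Q es → Grown Q T (map hd es)
    excursion {u} {es} u∈ p t D q with split (walk T) u∈
    ... | xs , ys , refl , p₁ , p₂ =
      closedTrail (xs ++ es ++ ys) (p₁ ++ʷ (p ++ʷ p₂)) (trail-++ t₁ (trail-++ t t₂ (λ x∈ y∈ → D x∈ (∈-++⁺ʳ xs y∈)))
        (λ x∈ y∈ → [ (λ e∈ → D e∈ (∈-++⁺ˡ x∈) ∘ sym) , D₁₂ x∈ ]′ (∈-++⁻ es y∈))) ,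
      (λ { (here e) → here e ; (there w∈) → there (old w∈) }) ,
      All.tabulate (λ w∈ → there (subst (_ ∈_) (sym (trans (map-++ hd xs (es ++ ys)) (cong (map hd xs ++_) (map-++ hd es ys)))) (∈-++⁺ʳ (map hd xs) (∈-++⁺ˡ w∈)))) ,
      (λ qs → let q₁ , q₂ = Allₚ.++⁻ xs qs in Allₚ.++⁺ q₁ (Allₚ.++⁺ q q₂))
      where
      t₁ = proj₁ (trail-++⁻ xs (trail T))
      t₂ = proj₁ (proj₂ (trail-++⁻ xs (trail T)))
      D₁₂ = proj₂ (proj₂ (trail-++⁻ xs (trail T)))
      old : ∀ {w} → w ∈ map hd (xs ++ ys) → w ∈ map hd (xs ++ es ++ ys)
      old w∈ = subst (_ ∈_) (sym (trans (map-++ hd xs (es ++ ys)) (cong (map hd xs ++_) (map-++ hd es ys))))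
        ([ ∈-++⁺ˡ , ∈-++⁺ʳ (map hd xs) ∘ ∈-++⁺ʳ (map hd es) ]′ (∈-++⁻ (map hd xs) (subst (_ ∈_) (map-++ hd xs ys) w∈)))

    detour : ∀ {c x y} → c ∈ darts T → vt x ≡ vt c → hd x ≡ vt y → hd y ≡ hd c → ¬ Vis T (vt y) → Apart x y → Q x → Q y → Grown Q T (vt y ∷ [])
    detour {c} {x} {y} c∈ e₁ e₂ e₃ new xy qx qy with ∈-∃++ c∈
    ... | xs , ys , r = closedTrail (xs ++ x ∷ y ∷ ys) (go xs (subst (λ ds → Walk b ds b) r (walk T)))
        (trail-++ t₁ ((xy ∷ All.tabulate (λ z∈ → newx (∈-++⁺ʳ xs (there z∈)))) ∷ (All.tabulate (λ z∈ → newy (∈-++⁺ʳ xs (there z∈)))) ∷ AllPairs.tail t₂)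
          (λ { z∈ (here refl) → newx (∈-++⁺ˡ z∈) ∘ sym ; z∈ (there (here refl)) → newy (∈-++⁺ˡ z∈) ∘ sym ; z∈ (there (there w∈)) → D z∈ (there w∈) })) ,
      (λ { (here e) → here e ; (there w∈) → there (old xs (subst (λ ds → _ ∈ map hd ds) r w∈)) }) ,
      (there (subst (_ ∈_) (sym (map-++ hd xs (x ∷ y ∷ ys))) (∈-++⁺ʳ (map hd xs) (here (sym e₂)))) ∷ []) ,
      (λ qs → let q₁ , q₂ = Allₚ.++⁻ xs (subst (All Q) r qs) in Allₚ.++⁺ q₁ (qx ∷ qy ∷ All.tail q₂))
      where
      T′ : Trail (xs ++ c ∷ ys)
      T′ = subst Trail r (trail T)
      t₁ = proj₁ (trail-++⁻ xs T′)
      t₂ = proj₁ (proj₂ (trail-++⁻ xs T′))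
      D = proj₂ (proj₂ (trail-++⁻ xs T′))
      newx : ∀ {z} → z ∈ xs ++ c ∷ ys → Apart x z
      newx z∈ = fresh (walk T) new (inj₂ e₂) (subst (_ ∈_) (sym r) z∈)
      newy : ∀ {z} → z ∈ xs ++ c ∷ ys → Apart y z
      newy z∈ = fresh (walk T) new (inj₁ refl) (subst (_ ∈_) (sym r) z∈)
      go : ∀ {u} xs → Walk u (xs ++ c ∷ ys) b → Walk u (xs ++ x ∷ y ∷ ys) b
      go [] (e ∷ p) = trans e₁ e ∷ (sym e₂ ∷ subst (λ u → Walk u ys b) (sym e₃) p)
      go (z ∷ xs) (e ∷ p) = e ∷ go xs p
      old : ∀ {w} xs → w ∈ map hd (xs ++ c ∷ ys) → w ∈ map hd (xs ++ x ∷ y ∷ ys)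
      old [] (here e) = there (here (trans e (sym e₃)))
      old [] (there w∈) = there (there w∈)
      old (z ∷ xs) (here e) = here e
      old (z ∷ xs) (there w∈) = there (old xs w∈)

    -- Symmetric difference with the boundary of a triangle.
    absorb : ∀ {x y z} → hd x ≡ vt y → hd y ≡ vt z → hd z ≡ vt x → vt x ≢ vt y → vt y ≢ vt z → vt x ≢ vt z →
      Vis T (vt x) → ¬ Vis T (vt z) → Q x → Q y → Q z → Grown Q T (vt z ∷ [])
    absorb {x} {y} {z} e₁ e₂ e₃ n₁ n₂ n₃ x∈ z∉ qx qy qz with x ∈ᵈ? darts T | a x ∈ᵈ? darts T
    -- Only the edge of `x` can be on the trail, as `vt z` is unvisited. If `x` is used, the other
    -- two sides replace it backwards; if `a x` is used, they replace it forwards; otherwise the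
    -- whole triangle is inserted.
    ... | yes c∈ | _ = conv (detour {x = a z} {y = a y} c∈ (e₃) (trans (hd-a z) (sym e₂)) (trans (hd-a y) (sym e₁))
            (subst (¬_ ∘ Vis T) (sym e₂) z∉) (apart-ends (λ q → n₃ (trans (sym e₃) (trans q e₂))) (λ q → n₁ (trans (sym e₃) (trans q (hd-a y))))) (Q-a qz) (Q-a qy))
      where
      conv : Grown Q T (vt (a y) ∷ []) → Grown Q T (vt z ∷ [])
      conv = subst (λ v → Grown Q T (v ∷ [])) e₂
    ... | no _ | yes c∈ = detour {x = y} {y = z} c∈ (sym e₁) e₂ (trans e₃ (sym (hd-a x))) z∉
            (apart-ends n₂ (λ q → n₁ (sym (trans q e₃)))) qy qz
    ... | no x∉ | no ax∉ = let T′ , mono , vs , q = inserted in T′ , mono , (subst (Vis T′) e₂ (All.head (All.tail vs)) ∷ []) , q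
      where
      xy : Apart x y
      xy = apart-ends n₁ (λ q → n₃ (trans q e₂))
      xz : Apart x z
      xz q with ed-same q
      ... | inj₁ refl = n₃ refl
      ... | inj₂ refl = n₂ (sym e₁)
      yz : Apart y z
      yz = apart-ends n₂ (λ q → n₁ (sym (trans q e₃)))
      disj : Disjoint (x ∷ y ∷ z ∷ []) (darts T)
      disj (here refl) w∈ q with ed-same q
      ... | inj₁ refl = x∉ w∈
      ... | inj₂ refl = ax∉ w∈
      disj (there (here refl)) w∈ = fresh (walk T) z∉ (inj₂ e₂) w∈
      disj (there (there (here refl))) w∈ = fresh (walk T) z∉ (inj₁ refl) w∈
      inserted : Grown Q T (hd x ∷ hd y ∷ hd z ∷ [])
      inserted = excursion x∈ (refl ∷ (sym e₁ ∷ (sym e₂ ∷ subst (λ u → Walk u [] (vt x)) (sym e₃) [])))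
        ((xy ∷ xz ∷ []) ∷ ((yz ∷ []) ∷ ([] ∷ []))) disj (qx ∷ qy ∷ qz ∷ [])

  -- The directions are those of return paths, closing up connectors from `P₁` to `P₂`, from `P₂` to
  -- `P₃` and from `P₁` to `P₃`.
  record Triangle (Q : Fin n → Set) (P₁ P₂ P₃ : Fin K) : Set where
    field
      {t₁ t₂ t₃} : Darts
      path₁ : Path P₂ t₁ P₁
      path₂ : Path P₃ t₂ P₂
      path₃ : Path P₃ t₃ P₁
      trail₁ : Trail t₁
      trail₂ : Trail t₂
      trail₃ : Trail t₃
      disjoint₁₂ : Disjoint t₁ t₂
      disjoint₁₃ : Disjoint t₁ t₃
      disjoint₂₃ : Disjoint t₂ t₃
      all₁ : All Q t₁
      all₂ : All Q t₂
      all₃ : All Q t₃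

  triangle-of-walks : ∀ {Q P₁ P₂ P₃ t₁ t₂ t₃} → Walk P₂ t₁ P₁ → Walk P₃ t₂ P₂ → Walk P₃ t₃ P₁ →
    Trail t₁ → Trail t₂ → Trail t₃ → Disjoint t₁ t₂ → Disjoint t₁ t₃ → Disjoint t₂ t₃ →
    All Q t₁ → All Q t₂ → All Q t₃ → Triangle Q P₁ P₂ P₃
  triangle-of-walks p₁ p₂ p₃ r₁ r₂ r₃ d₁₂ d₁₃ d₂₃ q₁ q₂ q₃ =
    let _ , p₁′ , s₁ = simplify p₁ ; _ , p₂′ , s₂ = simplify p₂ ; _ , p₃′ , s₃ = simplify p₃ in record
      { path₁ = p₁′ ; path₂ = p₂′ ; path₃ = p₃′
      ; trail₁ = trail-⊆ s₁ r₁ ; trail₂ = trail-⊆ s₂ r₂ ; trail₃ = trail-⊆ s₃ r₃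
      ; disjoint₁₂ = disjoint-⊆ s₁ s₂ d₁₂ ; disjoint₁₃ = disjoint-⊆ s₁ s₃ d₁₃ ; disjoint₂₃ = disjoint-⊆ s₂ s₃ d₂₃
      ; all₁ = All-resp-⊆ s₁ q₁ ; all₂ = All-resp-⊆ s₂ q₂ ; all₃ = All-resp-⊆ s₃ q₃ }

  module _ {Q : Fin n → Set} (Q-a : ∀ {d} → Q d → Q (a d)) where

    all-rev : ∀ {ds} → All Q ds → All Q (rev ds)
    all-rev {ds} qs = All.tabulate (λ x∈ → let y , y∈ , e = ∈-rev ds x∈ in subst Q (sym e) (Q-a (All.lookup qs y∈)))

    -- The trail is rotated to start at `P₁` and cut at `P₂`. `P₃` lies on one of the two pieces,
    -- which is cut once more; reversals produce the required directions. Points may coincide, an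
    -- arc then being empty.
    three-paths : ∀ {b} (T : ClosedTrail b) → All Q (darts T) → ∀ {P₁ P₂ P₃} → Vis T P₁ → Vis T P₂ → Vis T P₃ → Triangle Q P₁ P₂ P₃
    three-paths T qs {P₁} {P₂} {P₃} v₁ v₂ v₃ with split (walk T) v₁
    ... | xs , ys , r , p , q = cut (q ++ʷ p) rotated (Allₚ.++⁺ (proj₂ qq) (proj₁ qq)) (moved v₂) (moved v₃)
      where
      qq = Allₚ.++⁻ xs (subst (All Q) r qs)
      halves = trail-++⁻ xs (subst Trail r (trail T))
      rotated : Trail (ys ++ xs)
      rotated = trail-++ (proj₁ (proj₂ halves)) (proj₁ halves) (disjoint-sym (proj₂ (proj₂ halves)))
      moved : ∀ {w} → Vis T w → w ∈ verts P₁ (ys ++ xs)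
      moved {w} (here refl) = subst (w ∈_) (cong (P₁ ∷_) (sym (map-++ hd ys xs))) (∈-++⁺ˡ {xs = verts P₁ ys} (end∈verts q))
      moved (there w∈) = there (subst (_ ∈_) (sym (map-++ hd ys xs)) ([ ∈-++⁺ʳ (map hd ys) , ∈-++⁺ˡ ]′
        (∈-++⁻ (map hd xs) (subst (_ ∈_) (trans (cong (map hd) r) (map-++ hd xs ys)) w∈))))
      cut : ∀ {ds} → Walk P₁ ds P₁ → Trail ds → All Q ds → P₂ ∈ verts P₁ ds → P₃ ∈ verts P₁ ds → Triangle Q P₁ P₂ P₃
      cut {ds} w t qs m₂ m₃ with split w m₂
      ... | us , vs , refl , pu , pv with ∈-++⁻ (verts P₁ us) (subst (P₃ ∈_) (cong (P₁ ∷_) (map-++ hd us vs)) m₃)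
      ...   | inj₁ m with split pu m
      ...     | u₁ , u₂ , refl , pu₁ , pu₂ = triangle-of-walks pv pu₂ (Walk-rev pu₁) tv tu₂ (trail-rev tu₁)
                  (disjoint-sym (λ x∈ → Duv (∈-++⁺ʳ u₁ x∈))) (disjoint-rev u₁ (disjoint-sym (λ x∈ → Duv (∈-++⁺ˡ x∈)))) (disjoint-rev u₁ (disjoint-sym Du))
                  qv (proj₂ qu) (all-rev (proj₁ qu))
        where
        tu = proj₁ (trail-++⁻ (u₁ ++ u₂) t)
        tv = proj₁ (proj₂ (trail-++⁻ (u₁ ++ u₂) t))
        Duv = proj₂ (proj₂ (trail-++⁻ (u₁ ++ u₂) t))
        tu₁ = proj₁ (trail-++⁻ u₁ tu)
        tu₂ = proj₁ (proj₂ (trail-++⁻ u₁ tu))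
        Du = proj₂ (proj₂ (trail-++⁻ u₁ tu))
        qv = proj₂ (Allₚ.++⁻ (u₁ ++ u₂) qs)
        qu = Allₚ.++⁻ u₁ (proj₁ (Allₚ.++⁻ (u₁ ++ u₂) qs))
      cut {ds} w t qs m₂ m₃ | us , vs , refl , pu , pv | inj₂ m with split pv (there m)
      ...     | v₁ , v₂ , refl , pv₁ , pv₂ = triangle-of-walks (Walk-rev pu) (Walk-rev pv₁) pv₂ (trail-rev tu) (trail-rev tv₁) tv₂
                  (disjoint-rev v₁ (disjoint-sym (disjoint-rev us (disjoint-sym (λ x∈ y∈ → Duv x∈ (∈-++⁺ˡ y∈))))))
                  (disjoint-sym (disjoint-rev us (disjoint-sym (λ x∈ y∈ → Duv x∈ (∈-++⁺ʳ v₁ y∈)))))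
                  (disjoint-sym (disjoint-rev v₁ (disjoint-sym Dv)))
                  (all-rev (proj₁ (Allₚ.++⁻ us qs))) (all-rev (proj₁ qv)) (proj₂ qv)
        where
        tu = proj₁ (trail-++⁻ us t)
        tv = proj₁ (proj₂ (trail-++⁻ us t))
        Duv = proj₂ (proj₂ (trail-++⁻ us t))
        tv₁ = proj₁ (trail-++⁻ v₁ tv)
        tv₂ = proj₁ (proj₂ (trail-++⁻ v₁ tv))
        Dv = proj₂ (proj₂ (trail-++⁻ v₁ tv))
        qv = Allₚ.++⁻ v₁ (proj₂ (Allₚ.++⁻ us qs))

-- Cycles and their periods

lookup-AllPairs : ∀ {A : Set} {R : A → A → Set} → (∀ {x y} → R x y → R y x) → ∀ {xs} → AllPairs R xs →
  ∀ i j → i ≢ j → R (lookup xs i) (lookup xs j)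
lookup-AllPairs R-sym (p ∷ q) zero zero ne = ⊥-elim (ne refl)
lookup-AllPairs R-sym {xs = x ∷ xs} (p ∷ q) zero (suc j) ne = All.lookup p (∈-lookup {xs = xs} j)
lookup-AllPairs R-sym {xs = x ∷ xs} (p ∷ q) (suc i) zero ne = R-sym (All.lookup p (∈-lookup {xs = xs} i))
lookup-AllPairs R-sym (p ∷ q) (suc i) (suc j) ne = lookup-AllPairs R-sym q i j (ne ∘ cong suc)

ThreeDisjointCycles : Map → Set
ThreeDisjointCycles M = Σ[ C₁ ∈ Cycle M ] Σ[ C₂ ∈ Cycle M ] Σ[ C₃ ∈ Cycle M ]
    ((¬ Contractible M C₁) × (¬ Contractible M C₂) × (¬ Contractible M C₃) ×
    (¬ Homotopic M C₁ C₂) × (¬ Homotopic M C₁ C₃) × (¬ Homotopic M C₂ C₃) ×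
    EdgeDisjoint M C₁ C₂ × EdgeDisjoint M C₁ C₃ × EdgeDisjoint M C₂ C₃)

module Cycles (M : Map) (T : IsToroidalTriangulation M) where
  open Surface M T public
  open Map M using (n)
  open Walks a aa vtx ed ed-a ed-same public

  sumL : Vec n → List Dart → ℤ
  sumL ω [] = 0ℤ
  sumL ω (d ∷ ds) = ω d + sumL ω ds

  sumL-++ : ∀ ω xs ys → sumL ω (xs ++ ys) ≡ sumL ω xs + sumL ω ys
  sumL-++ ω [] ys = sym (ℤₚ.+-identityˡ (sumL ω ys))
  sumL-++ ω (x ∷ xs) ys = trans (cong (λ t → ω x + t) (sumL-++ ω xs ys)) (sym (ℤₚ.+-assoc (ω x) (sumL ω xs) (sumL ω ys)))

  record SimpleCycle : Set where
    constructor simpleCycle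
    field
      first : Dart
      rest : List Dart
      isWalk : Walk (vtx first) (first ∷ rest) (vtx first)
      isSimple : AllPairs (λ d e → vtx d ≢ vtx e) (first ∷ rest)
      isTrail : Trail (first ∷ rest)

    dartsOf : List Dart
    dartsOf = first ∷ rest
  open SimpleCycle

  mkCycle : ∀ {u} d ds → Walk u (d ∷ ds) u → AllPairs (λ d e → vtx d ≢ vtx e) (d ∷ ds) → Trail (d ∷ ds) → SimpleCycle
  mkCycle d ds w s t = simpleCycle d ds (conv w) s t
    where
    conv : ∀ {u} → Walk u (d ∷ ds) u → Walk (vtx d) (d ∷ ds) (vtx d)
    conv (refl ∷ p) = refl ∷ p

  walk-next : ∀ {u v ds} → Walk u ds v → ∀ i j → toℕ j ≡ suc (toℕ i) → hd (lookup ds i) ≡ vtx (lookup ds j)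
  walk-next (_ ∷ (e ∷ p)) zero (suc zero) refl = sym e
  walk-next (_ ∷ p) (suc i) (suc j) q = walk-next p i j (ℕₚ.suc-injective q)

  walk-last : ∀ {u v ds} → Walk u ds v → ∀ i → suc (toℕ i) ≡ length ds → hd (lookup ds i) ≡ v
  walk-last (_ ∷ []) zero q = refl
  walk-last (_ ∷ (e ∷ p)) (suc i) q = walk-last (e ∷ p) i (ℕₚ.suc-injective q)

  apart-sym : ∀ {x y} → Apart x y → Apart y x
  apart-sym p q = p (sym q)

  apart⇒distinct : ∀ {x y} → Apart x y → (x ≢ y) × (x ≢ a y)
  apart⇒distinct {y = y} p = (λ e → p (cong ed e)) , (λ e → p (trans (cong ed e) (ed-a y)))

  toCycle : SimpleCycle → Cycle M
  toCycle c = record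
    { len = length (rest c)
    ; walk = lookup (dartsOf c)
    ; closed = λ i → vtx-same (next i)
    ; distinctV = λ i j ne o → lookup-AllPairs (λ p q → p (sym q)) (isSimple c) i j ne (same-vtx o)
    ; distinctE = λ i j ne → apart⇒distinct (lookup-AllPairs apart-sym (isTrail c) i j ne) }
    where
    next : ∀ i → hd (lookup (dartsOf c) i) ≡ vtx (lookup (dartsOf c) (csuc M i))
    -- `csuc` wraps to zero at the last index, where the walk has returned to its start.
    next i with suc (toℕ i) ℕ.≟ length (dartsOf c)
    ... | yes e = trans (walk-last (isWalk c) i e) (cong (λ j → vtx (lookup (dartsOf c) j)) (Finₚ.toℕ-injective {i = zero} (sym
          (trans (Finₚ.toℕ-fromℕ< _) (trans (cong (ℕ._% suc (length (rest c))) e) (DM.n%n≡0 (suc (length (rest c)))))))))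
    ... | no ne = walk-next (isWalk c) i (csuc M i) (trans (Finₚ.toℕ-fromℕ< _) (DM.m<n⇒m%n≡m (ℕₚ.≤∧≢⇒< (Finₚ.toℕ<n i) ne)))

  private
    count-δ : ∀ {k} (w : Fin k → Dart) i is d →
      + length (filter (λ i → w i ≟ d) (i ∷ is)) ≡ δ (w i) d + + length (filter (λ i → w i ≟ d) is)
    count-δ w i is d with w i ≟ d
    ... | yes _ = refl
    ... | no _ = sym (ℤₚ.+-identityˡ _)

    count-sum : ∀ {k} (w : Fin k → Dart) (ω : Vec n) is →
      dot (λ d → + length (filter (λ i → w i ≟ d) is)) ω ≡ sumL ω (map w is)
    count-sum w ω [] = trans (dot-comm (λ _ → 0ℤ) ω) (dot-0 ω)
    count-sum w ω (i ∷ is) = trans (dot-cong {y = ω} (λ d → trans (count-δ w i is d) (one (δ (w i) d) (rem d))) (λ _ → refl))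
      (trans (dot-linˡ ω 1ℤ 1ℤ (δ (w i)) rem) (trans (sym (one (dot (δ (w i)) ω) (dot rem ω)))
        (cong₂ _+_ (dot-δ (w i) ω) (count-sum w ω is))))
      where
      rem : Vec n
      rem d = + length (filter (λ i → w i ≟ d) is)
      one : ∀ x y → x + y ≡ 1ℤ * x + 1ℤ * y
      one = solve-∀

    -- The factor 2: `chainOf` records an edge at both of its darts, and `ω` is antisymmetric.
    chain-sum : ∀ {ω} → Cocycle ω → ∀ c → dot (chainOf M (toCycle c)) ω ≡ + 2 * sumL ω (dartsOf c)
    chain-sum {ω} cω c = trans (dot-cong {y = ω} (λ d → one (k d) (k (a d))) (λ _ → refl))
      (trans (dot-linˡ ω 1ℤ (- 1ℤ) k (k ∘ a)) (trans (cong (λ t → 1ℤ * dot k ω + - 1ℤ * t) flip)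
        (trans (two (dot k ω)) (cong (+ 2 *_) total))))
      where
      k : Vec n
      k d = + count M (lookup (dartsOf c)) d
      one : ∀ x y → x - y ≡ 1ℤ * x + - 1ℤ * y
      one = solve-∀
      two : ∀ x → 1ℤ * x + - 1ℤ * - x ≡ + 2 * x
      two = solve-∀
      neg : ∀ x y → x * - y ≡ - 1ℤ * (x * y)
      neg = solve-∀
      neg′ : ∀ x → - 1ℤ * x ≡ - x
      neg′ = solve-∀
      flip : dot (k ∘ a) ω ≡ - dot k ω
      flip = trans (dot-def (k ∘ a) ω) (trans (sym (Σ-a (λ d → k (a d) * ω d)))
        (trans (Σ-cong (λ d → trans (cong₂ (λ x y → k x * y) (aa d) (anti cω d)) (neg (k d) (ω d))))
          (trans (Σ-* (- 1ℤ) (λ d → k d * ω d)) (trans (neg′ (Σ′ (λ d → k d * ω d))) (cong -_ (sym (dot-def k ω)))))))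
      total : dot k ω ≡ sumL ω (dartsOf c)
      total = trans (count-sum (lookup (dartsOf c)) ω (allFin (length (dartsOf c))))
        (cong (sumL ω) (trans (map-tabulate id (lookup (dartsOf c))) (tabulate-lookup (dartsOf c))))

    -- Stokes. As `g` is constant on faces, three times its pairing with `ω` pairs it with the sums
    -- of `ω` around triangles, which are zero.
    boundary-orth : ∀ {ω} → Cocycle ω → ∀ {c} → IsBoundary M c → dot c ω ≡ 0ℤ
    boundary-orth {ω} cω {c} (g , gf , e) = trans (dot-cong {y = ω} (λ d → trans (e d) (one (g d) (g (a d)))) (λ _ → refl))
      (trans (dot-linˡ ω 1ℤ (- 1ℤ) g (g ∘ a)) (trans (cong₂ (λ x y → 1ℤ * x + - 1ℤ * y) S0 (trans flip (cong -_ S0))) refl))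
      where
      one : ∀ x y → x - y ≡ 1ℤ * x + - 1ℤ * y
      one = solve-∀
      neg : ∀ x y → x * - y ≡ - 1ℤ * (x * y)
      neg = solve-∀
      neg′ : ∀ x → - 1ℤ * x ≡ - x
      neg′ = solve-∀
      flip : dot (g ∘ a) ω ≡ - dot g ω
      flip = trans (dot-def (g ∘ a) ω) (trans (sym (Σ-a (λ d → g (a d) * ω d)))
        (trans (Σ-cong (λ d → trans (cong₂ (λ x y → g x * y) (aa d) (anti cω d)) (neg (g d) (ω d))))
          (trans (Σ-* (- 1ℤ) (λ d → g d * ω d)) (trans (neg′ (Σ′ (λ d → g d * ω d))) (cong -_ (sym (dot-def g ω)))))))
      S : ℤ
      S = Σ′ (λ d → g d * ω d)
      S₁ : Σ′ (λ d → g d * ω (f d)) ≡ S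
      S₁ = trans (Σ-cong (λ d → cong (_* ω (f d)) (sym (gf d)))) (Σ-f (λ d → g d * ω d))
      S₂ : Σ′ (λ d → g d * ω (f (f d))) ≡ S
      S₂ = trans (Σ-cong (λ d → cong (_* ω (f (f d))) (sym (gf d)))) (trans (Σ-f (λ d → g d * ω (f d))) S₁)
      dist : ∀ x y z w → x * y + x * z + x * w ≡ x * (y + z + w)
      dist = solve-∀
      three : ∀ x → + 3 * x ≡ x + x + x
      three = solve-∀
      S0 : dot g ω ≡ 0ℤ
      S0 = trans (dot-def g ω) (*≡0⇒ʳ {+ 3} (λ ()) (trans (three S) (trans (cong₂ (λ x y → S + x + y) (sym S₁) (sym S₂))
        (trans (cong (_+ Σ′ (λ d → g d * ω (f (f d)))) (sym (Σ-add (λ d → g d * ω d) (λ d → g d * ω (f d)))))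
        (trans (sym (Σ-add (λ d → g d * ω d + g d * ω (f d)) (λ d → g d * ω (f (f d)))))
        (Σ-0 (λ d → trans (dist (g d) (ω d) (ω (f d)) (ω (f (f d)))) (trans (cong (g d *_) (closed cω d)) (ℤₚ.*-zeroʳ (g d))))))))))

  module _ {ω η} (cω : Cocycle ω) (cη : Cocycle η) where

    det : List Dart → List Dart → ℤ
    det xs ys = sumL ω xs * sumL η ys - sumL η xs * sumL ω ys

    private
      halve : ∀ {x} → + 2 * x ≡ 0ℤ → x ≡ 0ℤ
      halve = *≡0⇒ʳ {+ 2} (λ ())

      not-contractible : ∀ c c′ → det (dartsOf c) (dartsOf c′) ≢ 0ℤ → ¬ Contractible M (toCycle c) × ¬ Contractible M (toCycle c′)
      not-contractible c c′ ne =
        (λ B → ne (trans (cong₂ (λ x y → x * sumL η (dartsOf c′) - y * sumL ω (dartsOf c′)) (zero-class cω c B) (zero-class cη c B)) (z₁ (sumL η (dartsOf c′)) (sumL ω (dartsOf c′))))) ,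
        (λ B → ne (trans (cong₂ (λ x y → sumL ω (dartsOf c) * y - sumL η (dartsOf c) * x) (zero-class cω c′ B) (zero-class cη c′ B)) (z₂ (sumL ω (dartsOf c)) (sumL η (dartsOf c)))))
        where
        z₁ : ∀ x y → 0ℤ * x - 0ℤ * y ≡ 0ℤ
        z₁ = solve-∀
        z₂ : ∀ x y → x * 0ℤ - y * 0ℤ ≡ 0ℤ
        z₂ = solve-∀
        zero-class : ∀ {θ} → Cocycle θ → ∀ c → Contractible M (toCycle c) → sumL θ (dartsOf c) ≡ 0ℤ
        zero-class cθ c B = halve (trans (sym (chain-sum cθ c)) (boundary-orth cθ B))

      not-homotopic : ∀ c c′ → det (dartsOf c) (dartsOf c′) ≢ 0ℤ → ¬ Homotopic M (toCycle c) (toCycle c′)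
      not-homotopic c c′ ne = [ (λ B → ne (trans (cong₂ (λ x y → x * sumL η (dartsOf c′) - y * sumL ω (dartsOf c′)) (same cω B) (same cη B))
            (z (sumL ω (dartsOf c′)) (sumL η (dartsOf c′))))) ,
          (λ B → ne (trans (cong₂ (λ x y → x * sumL η (dartsOf c′) - y * sumL ω (dartsOf c′)) (opp cω B) (opp cη B))
            (z′ (sumL ω (dartsOf c′)) (sumL η (dartsOf c′))))) ]′
        where
        z : ∀ x y → x * y - y * x ≡ 0ℤ
        z = solve-∀
        z′ : ∀ x y → - x * y - - y * x ≡ 0ℤ
        z′ = solve-∀
        one : ∀ x y → x - y ≡ 1ℤ * x + - 1ℤ * y
        one = solve-∀
        one′ : ∀ x y → x + y ≡ 1ℤ * x + 1ℤ * y
        one′ = solve-∀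
        fact : ∀ x y → + 2 * (x - y) ≡ 1ℤ * (+ 2 * x) + - 1ℤ * (+ 2 * y)
        fact = solve-∀
        fact′ : ∀ x y → + 2 * (x - - y) ≡ 1ℤ * (+ 2 * x) + 1ℤ * (+ 2 * y)
        fact′ = solve-∀
        same : ∀ {θ} → Cocycle θ → IsBoundary M (λ d → chainOf M (toCycle c) d - chainOf M (toCycle c′) d) → sumL θ (dartsOf c) ≡ sumL θ (dartsOf c′)
        same {θ} cθ B = ℤₚ.i-j≡0⇒i≡j _ _ (halve (trans (fact (sumL θ (dartsOf c)) (sumL θ (dartsOf c′)))
          (trans (cong₂ (λ x y → 1ℤ * x + - 1ℤ * y) (sym (chain-sum cθ c)) (sym (chain-sum cθ c′)))
          (trans (sym (dot-linˡ θ 1ℤ (- 1ℤ) (chainOf M (toCycle c)) (chainOf M (toCycle c′))))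
          (trans (dot-cong {y = θ} (λ d → sym (one (chainOf M (toCycle c) d) (chainOf M (toCycle c′) d))) (λ _ → refl)) (boundary-orth cθ B))))))
        opp : ∀ {θ} → Cocycle θ → IsBoundary M (λ d → chainOf M (toCycle c) d + chainOf M (toCycle c′) d) → sumL θ (dartsOf c) ≡ - sumL θ (dartsOf c′)
        opp {θ} cθ B = ℤₚ.i-j≡0⇒i≡j _ _ (halve (trans (fact′ (sumL θ (dartsOf c)) (sumL θ (dartsOf c′)))
          (trans (cong₂ (λ x y → 1ℤ * x + 1ℤ * y) (sym (chain-sum cθ c)) (sym (chain-sum cθ c′)))
          (trans (sym (dot-linˡ θ 1ℤ 1ℤ (chainOf M (toCycle c)) (chainOf M (toCycle c′))))
          (trans (dot-cong {y = θ} (λ d → sym (one′ (chainOf M (toCycle c) d) (chainOf M (toCycle c′) d))) (λ _ → refl)) (boundary-orth cθ B))))))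

      edge-disjoint : ∀ c c′ → Disjoint (dartsOf c) (dartsOf c′) → EdgeDisjoint M (toCycle c) (toCycle c′)
      edge-disjoint c c′ D i j = apart⇒distinct (D (∈-lookup {xs = dartsOf c} i) (∈-lookup {xs = dartsOf c′} j))

    conclude : ∀ c₁ c₂ c₃ → det (dartsOf c₁) (dartsOf c₂) ≢ 0ℤ → det (dartsOf c₁) (dartsOf c₃) ≢ 0ℤ → det (dartsOf c₂) (dartsOf c₃) ≢ 0ℤ →
      Disjoint (dartsOf c₁) (dartsOf c₂) → Disjoint (dartsOf c₁) (dartsOf c₃) → Disjoint (dartsOf c₂) (dartsOf c₃) → ThreeDisjointCycles M
    conclude c₁ c₂ c₃ n₁₂ n₁₃ n₂₃ D₁₂ D₁₃ D₂₃ = toCycle c₁ , toCycle c₂ , toCycle c₃ ,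
      proj₁ (not-contractible c₁ c₂ n₁₂) , proj₂ (not-contractible c₁ c₂ n₁₂) , proj₂ (not-contractible c₁ c₃ n₁₃) ,
      not-homotopic c₁ c₂ n₁₂ , not-homotopic c₁ c₃ n₁₃ , not-homotopic c₂ c₃ n₂₃ ,
      edge-disjoint c₁ c₂ D₁₂ , edge-disjoint c₁ c₃ D₁₃ , edge-disjoint c₂ c₃ D₂₃

-- Cocycles in a gauge

module Gauge (M : Map) (T : IsToroidalTriangulation M) where
  open Cycles M T
  open Map M using (n)
  open ClosedTrail

  Potential : Set
  Potential = Fin nv → ℤ

  gauge : Vec n → Potential → Vec n
  gauge ω π d = ω d - (π (hd d) - π (vtx d))

  hd-face : ∀ d → hd d ≡ vtx (f d)
  hd-face = vtx-face

  hd-ff : ∀ d → hd (f (f d)) ≡ vtx d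
  hd-ff d = trans (vtx-face (f (f d))) (cong vtx (fff d))

  gauge-cocycle : ∀ {ω} → Cocycle ω → ∀ π → Cocycle (gauge ω π)
  gauge-cocycle {ω} c π = record
    { anti = λ d → trans (cong₂ (λ x y → x - (π y - π (hd d))) (anti c d) (cong vtx (aa d))) (eq (ω d) (π (vtx d)) (π (hd d)))
    ; closed = λ d → trans (cong₂ _+_ (cong₂ _+_ (cong (λ t → ω d - (π t - π (vtx d))) (hd-face d))
          (cong (λ t → ω (f d) - (π t - π (vtx (f d)))) (hd-face (f d))))
          (cong (λ t → ω (f (f d)) - (π t - π (vtx (f (f d))))) (hd-ff d)))
        (trans (eq′ (ω d) (ω (f d)) (ω (f (f d))) (π (vtx d)) (π (vtx (f d))) (π (vtx (f (f d))))) (closed c d)) }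
    where
    eq : ∀ x p q → - x - (p - q) ≡ - (x - (q - p))
    eq = solve-∀
    eq′ : ∀ x y z p q r → x - (q - p) + (y - (r - q)) + (z - (p - r)) ≡ x + y + z
    eq′ = solve-∀

  W-gauge : ∀ ω π {η} → Cocycle η → W (gauge ω π) η ≡ W ω η
  W-gauge ω π {η} c = trans (W-sub ω (λ d → π (hd d) - π (vtx d)) η) (trans (cong (λ t → W ω η - t) exact) (eq (W ω η)))
    where
    eq : ∀ x → x - 0ℤ ≡ x
    eq = solve-∀
    neg : ∀ x y → x - y ≡ - y - - x
    neg = solve-∀
    exact : W (λ d → π (hd d) - π (vtx d)) η ≡ 0ℤ
    exact = trans (Σ-cong (λ d → cong (_* (η (f d) - η (f (f d)))) (neg (π (hd d)) (π (vtx d)))))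
      (W-exact (λ d → - π (vtx d)) (λ d → cong (λ t → - π t) (vtx-s d)) c)

  sum-gauge : ∀ ω π {u ds v} → Walk u ds v → sumL ω ds ≡ sumL (gauge ω π) ds + (π v - π u)
  sum-gauge ω π {u} [] = eq (π u)
    where
    eq : ∀ x → 0ℤ ≡ 0ℤ + (x - x)
    eq = solve-∀
  sum-gauge ω π {v = v} (_∷_ {d = d} {ds = ds} refl p) = trans (cong (λ t → ω d + t) (sum-gauge ω π p)) (eq (ω d) (sumL (gauge ω π) ds) (π v) (π (hd d)) (π (vtx d)))
    where
    eq : ∀ x s v h u → x + (s + (v - h)) ≡ x - (h - u) + s + (v - u)
    eq = solve-∀

  sum-gauge-closed : ∀ ω π {u ds} → Walk u ds u → sumL ω ds ≡ sumL (gauge ω π) ds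
  sum-gauge-closed ω π {u} {ds} p = trans (sum-gauge ω π p) (eq (sumL (gauge ω π) ds) (π u))
    where
    eq : ∀ x y → x + (y - y) ≡ x
    eq = solve-∀

  sum-zero : ∀ {θ : Vec n} {ds} → All (λ d → θ d ≡ 0ℤ) ds → sumL θ ds ≡ 0ℤ
  sum-zero [] = refl
  sum-zero (e ∷ es) = cong₂ _+_ e (sum-zero es)

  module _ {ω η} (cω : Cocycle ω) (cη : Cocycle η) (π ρ : Potential) where

    Zero : Dart → Set
    Zero d = gauge ω π d ≡ 0ℤ × gauge η ρ d ≡ 0ℤ

    zero? : ∀ d → Dec (Zero d)
    zero? d = (gauge ω π d ℤ.≟ 0ℤ) ×-dec (gauge η ρ d ℤ.≟ 0ℤ)

    Zero-a : ∀ {d} → Zero d → Zero (a d)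
    Zero-a {d} (p , q) = trans (anti (gauge-cocycle cω π) d) (cong -_ p) , trans (anti (gauge-cocycle cη ρ) d) (cong -_ q)

    Zero-same : ∀ {x y} → ed x ≡ ed y → Zero y → Zero x
    Zero-same e z with ed-same (sym e)
    ... | inj₁ refl = z
    ... | inj₂ refl = Zero-a z

    -- On two consecutive sides of a triangle this is one third of the contribution of the triangle
    -- to `W` of the gauged cocycles.
    area : Dart → Dart → ℤ
    area x y = gauge ω π x * gauge η ρ y - gauge η ρ x * gauge ω π y

    area-zeroˡ : ∀ {x} y → Zero x → area x y ≡ 0ℤ
    area-zeroˡ y (p , q) = trans (cong₂ (λ s t → s * gauge η ρ y - t * gauge ω π y) p q) (eq (gauge η ρ y) (gauge ω π y))
      where
      eq : ∀ x y → 0ℤ * x - 0ℤ * y ≡ 0ℤ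
      eq = solve-∀

    area-zeroʳ : ∀ x {y} → Zero y → area x y ≡ 0ℤ
    area-zeroʳ x (p , q) = trans (cong₂ (λ s t → gauge ω π x * t - gauge η ρ x * s) p q) (eq (gauge ω π x) (gauge η ρ x))
      where
      eq : ∀ x y → x * 0ℤ - y * 0ℤ ≡ 0ℤ
      eq = solve-∀

    area-apart : ∀ {x y} → area x y ≢ 0ℤ → Apart x y
    area-apart {x} {y} ne e with ed-same e
    ... | inj₁ refl = ne (eq (gauge ω π x) (gauge η ρ x))
      where
      eq : ∀ x y → x * y - y * x ≡ 0ℤ
      eq = solve-∀
    ... | inj₂ refl = ne (trans (cong₂ (λ s t → gauge ω π x * t - gauge η ρ x * s) (anti (gauge-cocycle cω π) x) (anti (gauge-cocycle cη ρ) x)) (eq (gauge ω π x) (gauge η ρ x)))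
      where
      eq : ∀ x y → x * - y - y * - x ≡ 0ℤ
      eq = solve-∀

    -- Each of three connectors X, Y, Z = X + Y between three vertices of a closed trail is closed up by an arc of the trail.
    module Finish {b} (C : ClosedTrail b) (null : All Zero (darts C)) (X Y z₀ : Dart) (zs : List Dart) {P₃}
      (X-ends : hd X ≡ vtx Y) (Y-end : hd Y ≡ P₃)
      (V₁ : Vis C (vtx X)) (V₂ : Vis C (vtx Y)) (V₃ : Vis C P₃)
      (nonzero : area X Y ≢ 0ℤ)
      (z-walk : Walk (vtx X) (z₀ ∷ zs) P₃) (z-simple : AllPairs (λ d e → vtx d ≢ vtx e) (z₀ ∷ zs)) (z-trail : Trail (z₀ ∷ zs))
      (z-inner : All (λ e → ¬ Vis C (vtx e)) zs)
      (z-apart : ∀ {e d} → e ∈ z₀ ∷ zs → Zero d → Vis C (vtx d) → Vis C (hd d) → Apart e d)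
      (z-X : ∀ {e} → e ∈ z₀ ∷ zs → Apart e X) (z-Y : ∀ {e} → e ∈ z₀ ∷ zs → Apart e Y)
      (sumω : sumL (gauge ω π) (z₀ ∷ zs) ≡ gauge ω π X + gauge ω π Y) (sumη : sumL (gauge η ρ) (z₀ ∷ zs) ≡ gauge η ρ X + gauge η ρ Y) where

      -- Visited ends keep the arcs apart from a connector through an unvisited vertex.
      Q : Dart → Set
      Q d = Zero d × Vis C (vtx d) × Vis C (hd d)

      private
        Q-a : ∀ {d} → Q d → Q (a d)
        Q-a {d} (z , p , q) = Zero-a z , q , subst (Vis C) (sym (hd-a d)) p

        all-Q : All Q (darts C)
        all-Q = All.tabulate (λ d∈ → All.lookup null d∈ , tail∈verts (walk C) d∈ , head∈verts (walk C) d∈)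

      module _ (triangle : Triangle Q (vtx X) (vtx Y) P₃) where
        private
          open Triangle triangle

          X-apart : ∀ {ds} → All Q ds → ∀ {d} → d ∈ ds → Apart X d
          X-apart qs d∈ e = nonzero (area-zeroˡ Y (Zero-same e (proj₁ (All.lookup qs d∈))))

          Y-apart : ∀ {ds} → All Q ds → ∀ {d} → d ∈ ds → Apart Y d
          Y-apart qs d∈ e = nonzero (area-zeroʳ X (Zero-same e (proj₁ (All.lookup qs d∈))))

          Z-apart : ∀ {ds} → All Q ds → Disjoint (z₀ ∷ zs) ds
          Z-apart qs e∈ d∈ = let z , p , q = All.lookup qs d∈ in z-apart e∈ z p q

          tails : ∀ {u ds v} → Path u ds v → ∀ {e} → vtx e ≡ v → All (λ d → vtx e ≢ vtx d) ds
          tails p refl = All.tabulate (λ d∈ q → tail≢end p d∈ (sym q))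

          c₁ c₂ c₃ : SimpleCycle
          c₁ = mkCycle X t₁ (refl ∷ subst (λ u → Walk u t₁ (vtx X)) (sym X-ends) (Path⇒Walk path₁))
            (tails path₁ refl ∷ tails-distinct path₁) (All.tabulate (X-apart all₁) ∷ trail₁)
          c₂ = mkCycle Y t₂ (refl ∷ subst (λ u → Walk u t₂ (vtx Y)) (sym Y-end) (Path⇒Walk path₂))
            (tails path₂ refl ∷ tails-distinct path₂) (All.tabulate (Y-apart all₂) ∷ trail₂)
          c₃ = mkCycle z₀ (zs ++ t₃) (z-walk ++ʷ Path⇒Walk path₃)
            (AllPairsₚ.++⁺ z-simple (tails-distinct path₃) (tails path₃ (first-tail z-walk) ∷ All.map (λ ne → All.tabulate (λ d∈ q → ne (subst (Vis C) (sym q) (proj₁ (proj₂ (All.lookup all₃ d∈)))))) z-inner))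
            (trail-++ z-trail trail₃ (Z-apart all₃))
            where
            first-tail : ∀ {u d ds v} → Walk u (d ∷ ds) v → vtx d ≡ u
            first-tail (e ∷ _) = e

          class₁ : ∀ θ μ {d ds u} → Walk u (d ∷ ds) u → All (λ d → gauge θ μ d ≡ 0ℤ) ds → sumL θ (d ∷ ds) ≡ gauge θ μ d
          class₁ θ μ {d} w z = trans (sum-gauge-closed θ μ w) (trans (cong (λ t → gauge θ μ d + t) (sum-zero z)) (ℤₚ.+-identityʳ (gauge θ μ d)))

          class₃ : ∀ θ μ → All (λ d → gauge θ μ d ≡ 0ℤ) t₃ → ∀ {t} → sumL (gauge θ μ) (z₀ ∷ zs) ≡ t → sumL θ (z₀ ∷ zs ++ t₃) ≡ t
          class₃ θ μ z {t} e = trans (sum-gauge-closed θ μ (z-walk ++ʷ Path⇒Walk path₃)) (trans (sumL-++ (gauge θ μ) (z₀ ∷ zs) t₃)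
            (trans (cong₂ _+_ e (sum-zero z)) (ℤₚ.+-identityʳ t)))

          zω : ∀ {ds} → All Q ds → All (λ d → gauge ω π d ≡ 0ℤ) ds
          zω = All.map (proj₁ ∘ proj₁)

          zη : ∀ {ds} → All Q ds → All (λ d → gauge η ρ d ≡ 0ℤ) ds
          zη = All.map (proj₂ ∘ proj₁)

          open SimpleCycle

          ω₁ : sumL ω (X ∷ t₁) ≡ gauge ω π X
          ω₁ = class₁ ω π (isWalk c₁) (zω all₁)
          η₁ : sumL η (X ∷ t₁) ≡ gauge η ρ X
          η₁ = class₁ η ρ (isWalk c₁) (zη all₁)
          ω₂ : sumL ω (Y ∷ t₂) ≡ gauge ω π Y
          ω₂ = class₁ ω π (isWalk c₂) (zω all₂)
          η₂ : sumL η (Y ∷ t₂) ≡ gauge η ρ Y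
          η₂ = class₁ η ρ (isWalk c₂) (zη all₂)
          ω₃ : sumL ω (z₀ ∷ zs ++ t₃) ≡ gauge ω π X + gauge ω π Y
          ω₃ = class₃ ω π (zω all₃) sumω
          η₃ : sumL η (z₀ ∷ zs ++ t₃) ≡ gauge η ρ X + gauge η ρ Y
          η₃ = class₃ η ρ (zη all₃) sumη

          det-val : ∀ {xs ys p q r s} → sumL ω xs ≡ p → sumL η xs ≡ q → sumL ω ys ≡ r → sumL η ys ≡ s →
            det cω cη xs ys ≡ p * s - q * r
          det-val e₁ e₂ e₃ e₄ = cong₂ _-_ (cong₂ _*_ e₁ e₄) (cong₂ _*_ e₂ e₃)

        close : ThreeDisjointCycles M
        close = conclude cω cη c₁ c₂ c₃
          (λ e → nonzero (trans (sym (det-val {X ∷ t₁} {Y ∷ t₂} ω₁ η₁ ω₂ η₂)) e))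
          (λ e → nonzero (trans (sym (trans (det-val {X ∷ t₁} {z₀ ∷ zs ++ t₃} ω₁ η₁ ω₃ η₃) (eq₁ (gauge ω π X) (gauge η ρ X) (gauge ω π Y) (gauge η ρ Y)))) e))
          (λ e → nonzero (neg0 (trans (sym (trans (det-val {Y ∷ t₂} {z₀ ∷ zs ++ t₃} ω₂ η₂ ω₃ η₃) (eq₂ (gauge ω π X) (gauge η ρ X) (gauge ω π Y) (gauge η ρ Y)))) e)))
          D₁₂ D₁₃ D₂₃
          where
          eq₁ : ∀ p q r s → p * (q + s) - q * (p + r) ≡ p * s - q * r
          eq₁ = solve-∀
          eq₂ : ∀ p q r s → r * (q + s) - s * (p + r) ≡ - (p * s - q * r)
          eq₂ = solve-∀
          neg0 : ∀ {x} → - x ≡ 0ℤ → x ≡ 0ℤ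
          neg0 {x} e = trans (sym (ℤₚ.neg-involutive x)) (cong -_ e)
          D₁₂ : Disjoint (X ∷ t₁) (Y ∷ t₂)
          D₁₂ (here refl) (here refl) = area-apart nonzero
          D₁₂ (here refl) (there y∈) = X-apart all₂ y∈
          D₁₂ (there x∈) (here refl) = apart-sym (Y-apart all₁ x∈)
          D₁₂ (there x∈) (there y∈) = disjoint₁₂ x∈ y∈
          D₁₃ : Disjoint (X ∷ t₁) (z₀ ∷ zs ++ t₃)
          D₁₃ x∈ z∈ with ∈-++⁻ (z₀ ∷ zs) z∈
          D₁₃ (here refl) z∈ | inj₁ z∈′ = apart-sym (z-X z∈′)
          D₁₃ (here refl) z∈ | inj₂ t∈ = X-apart all₃ t∈
          D₁₃ (there x∈) z∈ | inj₁ z∈′ = apart-sym (Z-apart all₁ z∈′ x∈)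
          D₁₃ (there x∈) z∈ | inj₂ t∈ = disjoint₁₃ x∈ t∈
          D₂₃ : Disjoint (Y ∷ t₂) (z₀ ∷ zs ++ t₃)
          D₂₃ x∈ z∈ with ∈-++⁻ (z₀ ∷ zs) z∈
          D₂₃ (here refl) z∈ | inj₁ z∈′ = apart-sym (z-Y z∈′)
          D₂₃ (here refl) z∈ | inj₂ t∈ = Y-apart all₃ t∈
          D₂₃ (there x∈) z∈ | inj₁ z∈′ = apart-sym (Z-apart all₂ z∈′ x∈)
          D₂₃ (there x∈) z∈ | inj₂ t∈ = disjoint₂₃ x∈ t∈

      result : ThreeDisjointCycles M
      result = close (three-paths Q-a C all-Q V₁ V₂ V₃)

-- Triangulations without loops

module Loopless (M : Map) (T : IsToroidalTriangulation M) where
  open Gauge M T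
  open Cycles M T
  open Map M using (n)
  open ClosedTrail

  module _ (no-loops : ∀ d → vtx d ≢ hd d) {ω η} (cω : Cocycle ω) (cη : Cocycle η) (Wωη : W ω η ≢ 0ℤ) (base : Fin nv) (d₀ : Dart) (d₀-at-base : vtx d₀ ≡ base) where

    private
      record State : Set where
        constructor state
        field
          C : ClosedTrail base
          π ρ : Potential
          null : All (Zero cω cη π ρ) (darts C)

      -- Potentials at unvisited vertices are free. If the head of `d` is new, its potential can
      -- make `d` null; the potential at the opposite corner makes a second side null, and
      -- closedness the third, so that the triangle can be absorbed.
      Move : State → Dart → Set
      Move (state C π ρ _) d = Vis C (vtx d) × ¬ Vis C (vtx (f (f d))) × (¬ Vis C (vtx (f d)) ⊎ Zero cω cη π ρ d)

      move? : ∀ s d → Dec (Move s d)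
      move? (state C π ρ _) d = vis? C (vtx d) ×-dec (¬? (vis? C (vtx (f (f d)))) ×-dec (¬? (vis? C (vtx (f d))) ⊎-dec zero? cω cη π ρ d))

      upd : Potential → Fin nv → ℤ → Potential
      upd π r v w with w ≟ r
      ... | yes _ = v
      ... | no _ = π w

      upd-same : ∀ π r v → upd π r v r ≡ v
      upd-same π r v with r ≟ r
      ... | yes _ = refl
      ... | no ne = ⊥-elim (ne refl)

      upd-other : ∀ π {r w} v → w ≢ r → upd π r v w ≡ π w
      upd-other π {r} {w} v ne with w ≟ r
      ... | yes e = ⊥-elim (ne e)
      ... | no _ = refl

      gauge-upd : ∀ θ π {r} v {d} → vtx d ≢ r → hd d ≢ r → gauge θ (upd π r v) d ≡ gauge θ π d
      gauge-upd θ π v {d} ne ne′ = cong₂ (λ x y → θ d - (x - y)) (upd-other π v ne′) (upd-other π v ne)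

      Zero-upd : ∀ π ρ {r} v w {d} → vtx d ≢ r → hd d ≢ r → Zero cω cη π ρ d → Zero cω cη (upd π r v) (upd ρ r w) d
      Zero-upd π ρ v w ne ne′ (p , q) = trans (gauge-upd ω π v ne ne′) p , trans (gauge-upd η ρ w ne ne′) q

      null-upd : ∀ {C : ClosedTrail base} {π ρ r} v w → ¬ Vis C r → All (Zero cω cη π ρ) (darts C) → All (Zero cω cη (upd π r v) (upd ρ r w)) (darts C)
      null-upd {C} {π} {ρ} v w new null = All.tabulate (λ d∈ → Zero-upd π ρ v w
        (λ e → new (subst (Vis C) e (tail∈verts (walk C) d∈))) (λ e → new (subst (Vis C) e (head∈verts (walk C) d∈))) (All.lookup null d∈))

      Next : State → Set
      Next s = Σ[ s′ ∈ State ] ((∀ {w} → Vis (State.C s) w → Vis (State.C s′) w) × (∃[ w ] (¬ Vis (State.C s) w × Vis (State.C s′) w)))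

      third : ∀ {x y z} → x + y + z ≡ 0ℤ → x ≡ 0ℤ → z ≡ 0ℤ → y ≡ 0ℤ
      third {x} {y} {z} e refl refl = trans (eq y) e
        where
        eq : ∀ y → y ≡ 0ℤ + y + 0ℤ
        eq = solve-∀

      grow-null : ∀ s d → let open State s in Vis C (vtx d) → ¬ Vis C (vtx (f (f d))) → Zero cω cη π ρ d → Next s
      grow-null (state C π ρ null) d v nv zd = let C′ , mono , new , q = absorbed in
        state C′ π′ ρ′ (q (null-upd {C} _ _ nv null)) , mono , vtx z , nv , All.head new
        where
        z : Dart
        z = f (f d)
        v≢ : vtx d ≢ vtx z
        v≢ e = nv (subst (Vis C) e v)
        π′ ρ′ : Potential
        π′ = upd π (vtx z) (π (vtx d) - ω z)
        ρ′ = upd ρ (vtx z) (ρ (vtx d) - η z)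
        set : ∀ θ μ → gauge θ (upd μ (vtx z) (μ (vtx d) - θ z)) z ≡ 0ℤ
        set θ μ = trans (cong₂ (λ x y → θ z - (x - y)) (trans (cong (upd μ (vtx z) (μ (vtx d) - θ z)) (hd-ff d)) (upd-other μ (μ (vtx d) - θ z) v≢)) (upd-same μ (vtx z) (μ (vtx d) - θ z)))
          (eq (θ z) (μ (vtx d)))
          where
          eq : ∀ x y → x - (y - (y - x)) ≡ 0ℤ
          eq = solve-∀
        zx : Zero cω cη π′ ρ′ d
        zx = Zero-upd π ρ _ _ v≢ (λ e → no-loops (f d) (trans (sym (hd-face d)) (trans e (sym (hd-face (f d)))))) zd
        zz : Zero cω cη π′ ρ′ z
        zz = set ω π , set η ρ
        zy : Zero cω cη π′ ρ′ (f d)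
        zy = third (closed (gauge-cocycle cω π′) d) (proj₁ zx) (proj₁ zz) , third (closed (gauge-cocycle cη ρ′) d) (proj₂ zx) (proj₂ zz)
        absorbed : Grown (Zero cω cη π′ ρ′) C (vtx z ∷ [])
        absorbed = absorb (Zero-a cω cη π′ ρ′) C (hd-face d) (hd-face (f d)) (hd-ff d)
          (λ e → no-loops d (trans e (sym (hd-face d)))) (λ e → no-loops (f d) (trans e (sym (hd-face (f d))))) v≢
          v nv zx zy zz

      grow-fresh : ∀ s d → let open State s in Vis C (vtx d) → ¬ Vis C (vtx (f (f d))) → ¬ Vis C (vtx (f d)) → Next s
      grow-fresh (state C π ρ null) d v nv ny =
        grow-null (state C (upd π (vtx (f d)) (π (vtx d) + ω d)) (upd ρ (vtx (f d)) (ρ (vtx d) + η d)) (null-upd {C} _ _ ny null)) d v nv (set ω π , set η ρ)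
        where
        set : ∀ θ μ → gauge θ (upd μ (vtx (f d)) (μ (vtx d) + θ d)) d ≡ 0ℤ
        set θ μ = trans (cong₂ (λ x y → θ d - (x - y)) (trans (cong (upd μ (vtx (f d)) (μ (vtx d) + θ d)) (hd-face d)) (upd-same μ (vtx (f d)) (μ (vtx d) + θ d)))
            (upd-other μ (μ (vtx d) + θ d) (λ e → ny (subst (Vis C) e v))))
          (eq (θ d) (μ (vtx d)))
          where
          eq : ∀ x y → x - (y + x - y) ≡ 0ℤ
          eq = solve-∀

      grow : ∀ s d → Move s d → Next s
      grow s d (v , nv , inj₁ ny) = grow-fresh s d v nv ny
      grow s d (v , nv , inj₂ zd) = grow-null s d v nv zd

    -- When no triangle can be absorbed

    module Stuck (C : ClosedTrail base) (π₀ ρ₀ : Potential) (null₀ : All (Zero cω cη π₀ ρ₀) (darts C)) (stuck : ∀ d → ¬ Move (state C π₀ ρ₀ null₀) d) where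

      private
        V : Dart → Set
        V d = Vis C (vtx d)

        -- Otherwise the triangle of `a d` would have one visited and two unvisited corners and
        -- could be absorbed.
        next-neighbour : ∀ d → ¬ V d → Vis C (hd d) → Vis C (hd (s d))
        next-neighbour d nd vd with vis? C (hd (s d))
        ... | yes v = v
        ... | no nv = ⊥-elim (stuck (a d) (vd , (λ v → nv (subst (Vis C) (sym (trans (hd-face (s d)) (cong (vtx ∘ f) (sym (fa d))))) v)) ,
                inj₁ (λ v → nd (subst (Vis C) (trans (cong vtx (fa d)) (vtx-s d)) v))))

        -- `f (s d)` is the link edge between the ends of two consecutive spokes; were it null, its
        -- triangle could be absorbed.
        link-nonzero : ∀ d → ¬ V d → Vis C (hd d) → Vis C (hd (s d)) → ¬ Zero cω cη π₀ ρ₀ (f (s d))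
        link-nonzero d nd vd vsd z = stuck (f (s d)) (subst (Vis C) (hd-face (s d)) vsd ,
          (λ v → nd (subst (Vis C) (trans (cong vtx (fff (s d))) (vtx-s d)) v)) , inj₂ z)

        -- Connectedness: along an edge from a visited to an unvisited vertex, `next-neighbour`
        -- applies all the way around the latter.
        neighbours-visited : ∀ d → V d ⊎ (∀ e → vtx e ≡ vtx d → Vis C (hd e))
        neighbours-visited d = reach (connected d₀ d) (inj₁ (subst (Vis C) (sym d₀-at-base) (here refl)))
          where
          open IsToroidalTriangulation T using (connected)
          Good : Dart → Set
          Good d = V d ⊎ (∀ e → vtx e ≡ vtx d → Vis C (hd e))
          around : ∀ {d} → ¬ V d → Vis C (hd d) → ∀ k → Vis C (hd (iter M s k d)) × ¬ V (iter M s k d)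
          around nd vd zero = vd , nd
          around {d} nd vd (suc k) = let v , nv = around nd vd k in next-neighbour (iter M s k d) nv v , (λ v → nv (subst (Vis C) (vtx-s (iter M s k d)) v))
          good-s : ∀ {d} → Good d → Good (s d)
          good-s {d} (inj₁ v) = inj₁ (subst (Vis C) (sym (vtx-s d)) v)
          good-s {d} (inj₂ g) = inj₂ (λ e q → g e (trans q (vtx-s d)))
          good-a : ∀ {d} → Good d → Good (a d)
          good-a {d} (inj₂ g) = inj₁ (g d refl)
          good-a {d} (inj₁ v) with vis? C (hd d)
          ... | yes v′ = inj₁ v′
          ... | no nv = inj₂ (λ e q → let k , r = vtx-same {a d} {e} (sym q) in
                  subst (λ x → Vis C (hd x)) r (proj₁ (around nv (subst (Vis C) (sym (hd-a d)) v) k)))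
          reach : ∀ {d e} → Reach M d e → Good d → Good e
          reach here g = g
          reach (stepσ r) g = reach r (good-s g)
          reach (stepα r) g = reach r (good-a g)

        neighbour : ∀ d → ¬ V d → Vis C (hd d)
        neighbour d nd = [ (λ v → ⊥-elim (nd v)) , (λ g → g d refl) ]′ (neighbours-visited d)

        -- At an unvisited vertex the potential is normalised so that the representative spoke
        -- becomes null, which is possible because its other end is visited.
        extend : Vec n → Potential → Potential
        extend θ μ v with vis? C v
        ... | yes _ = μ v
        ... | no _ = μ (hd (vrep v)) - θ (vrep v)

        extend-vis : ∀ θ μ {v} → Vis C v → extend θ μ v ≡ μ v
        extend-vis θ μ {v} vv with vis? C v
        ... | yes _ = refl
        ... | no nv = ⊥-elim (nv vv)

        extend-new : ∀ θ μ {v} → ¬ Vis C v → extend θ μ v ≡ μ (hd (vrep v)) - θ (vrep v)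
        extend-new θ μ {v} nv with vis? C v
        ... | yes vv = ⊥-elim (nv vv)
        ... | no _ = refl

        π ρ : Potential
        π = extend ω π₀
        ρ = extend η ρ₀

        gauge-extend : ∀ θ μ {d} → V d → Vis C (hd d) → gauge θ (extend θ μ) d ≡ gauge θ μ d
        gauge-extend θ μ {d} v v′ = cong₂ (λ x y → θ d - (x - y)) (extend-vis θ μ v′) (extend-vis θ μ v)

        rep-zero : ∀ θ μ {v} → ¬ Vis C v → gauge θ (extend θ μ) (vrep v) ≡ 0ℤ
        rep-zero θ μ {v} nv = trans (cong₂ (λ x y → θ r - (x - y)) (extend-vis θ μ (neighbour r nr))
            (trans (cong (extend θ μ) (vtx-rep v)) (extend-new θ μ nv))) (eq (θ r) (μ (hd r)))
          where
          r = vrep v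
          nr : ¬ V r
          nr = nv ∘ subst (Vis C) (vtx-rep v)
          eq : ∀ x y → x - (y - (y - x)) ≡ 0ℤ
          eq = solve-∀

        null : All (Zero cω cη π ρ) (darts C)
        null = All.tabulate (λ d∈ → let v = tail∈verts (walk C) d∈ ; v′ = head∈verts (walk C) d∈ ; p , q = All.lookup null₀ d∈ in
          trans (gauge-extend ω π₀ v v′) p , trans (gauge-extend η ρ₀ v v′) q)

        A : Dart → Dart → ℤ
        A = area cω cη π ρ

        g h : Vec n
        g = gauge ω π
        h = gauge η ρ
        cg : Cocycle g
        cg = gauge-cocycle cω π
        ch : Cocycle h
        ch = gauge-cocycle cη ρ

        -- `W` is gauge invariant, and its summands in the form of `W-shift` are the areas.
        face-area : ∃[ d ] A d (f d) ≢ 0ℤ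
        face-area with Finₚ.any? (λ d → ¬? (A d (f d) ℤ.≟ 0ℤ))
        ... | yes p = p
        ... | no none = ⊥-elim (Wωη (trans (sym (trans (W-gauge ω π ch) unchanged)) (trans (W-shift g h) (Σ-0 vanish))))
          where
          unchanged : W ω h ≡ W ω η
          unchanged = trans (W-antisym ω h) (trans (cong -_ (W-gauge η ρ cω)) (trans (cong -_ (W-antisym η ω)) (ℤₚ.neg-involutive (W ω η))))
          vanish : ∀ d → g d * h (f d) - g (f d) * h d ≡ 0ℤ
          vanish d with A d (f d) ℤ.≟ 0ℤ
          ... | yes e = trans (eq (g d) (h (f d)) (g (f d)) (h d)) e
            where
            eq : ∀ x y z w → x * y - z * w ≡ x * y - w * z
            eq = solve-∀
          ... | no ne = ⊥-elim (none (d , ne))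

        rotate : ∀ d → A (f d) (f (f d)) ≡ A d (f d)
        rotate d = trans (cong₂ (λ x y → g (f d) * y - h (f d) * x) (solve₃ (g d) (g (f d)) (g (f (f d))) (closed cg d)) (solve₃ (h d) (h (f d)) (h (f (f d))) (closed ch d))) (eq (g d) (h d) (g (f d)) (h (f d)))
          where
          solve₃ : ∀ x y z → x + y + z ≡ 0ℤ → z ≡ - x - y
          solve₃ x y z e = trans (eq′ x y z) (trans (cong (λ t → t - x - y) e) (cong (_- y) (ℤₚ.+-identityˡ (- x))))
            where
            eq′ : ∀ x y z → z ≡ x + y + z - x - y
            eq′ = solve-∀
          eq : ∀ x x′ y y′ → y * (- x′ - y′) - y′ * (- x - y) ≡ x * y′ - x′ * y
          eq = solve-∀

        face-finish : ∀ d → V d → V (f d) → V (f (f d)) → A d (f d) ≢ 0ℤ → ThreeDisjointCycles M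
        face-finish d v₁ v₂ v₃ ne = Finish.result cω cη π ρ C null d (f d) z [] (hd-face d) (hd-face (f d)) v₁ v₂ v₃ ne
          (hd-ff d ∷ subst (λ u → Walk u [] (vtx (f (f d)))) (sym (hd-a (f (f d)))) []) ([] ∷ []) ([] ∷ []) []
          (λ { (here refl) zd _ _ e → ne′ (Zero-same cω cη π ρ {f (f d)} (trans (sym (ed-a (f (f d)))) e) zd) })
          (λ { (here refl) e → area-apart cω cη π ρ third-first (trans (sym (ed-a (f (f d)))) e) })
          (λ { (here refl) e → area-apart cω cη π ρ (λ q → ne (trans (sym (rotate d)) q)) (sym (trans (sym (ed-a (f (f d)))) e)) })
          (sides cg) (sides ch)
          where
          z : Dart
          z = a (f (f d))
          ne′ : ¬ Zero cω cη π ρ (f (f d))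
          ne′ zd = ne (trans (sym (rotate d)) (area-zeroʳ cω cη π ρ (f d) zd))
          third-first : A (f (f d)) d ≢ 0ℤ
          third-first q = ne (trans (sym (trans (rotate (f d)) (rotate d))) (trans (cong (A (f (f d))) (fff d)) q))
          sides : ∀ {θ} → Cocycle θ → θ z + 0ℤ ≡ θ d + θ (f d)
          sides {θ} c = trans (cong (_+ 0ℤ) (anti c (f (f d)))) (eq (θ d) (θ (f d)) (θ (f (f d))) (closed c d))
            where
            eq : ∀ x y z → x + y + z ≡ 0ℤ → - z + 0ℤ ≡ x + y
            eq x y z e = trans (eq′ x y z) (trans (cong (λ t → x + y - t) e) (ℤₚ.+-identityʳ (x + y)))
              where
              eq′ : ∀ x y z → - z + 0ℤ ≡ x + y - (x + y + z)
              eq′ = solve-∀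

        cocycle-link : ∀ {θ} → Cocycle θ → ∀ d → θ (s d) ≡ θ d - θ (f (s d))
        cocycle-link {θ} c d = eq (θ d) (θ (s d)) (θ (f (s d))) (trans (cong₂ (λ x y → x + θ y + θ (f (s d))) (sym (anti c d)) (sym (fa d)))
          (trans (cong (λ t → θ (a d) + θ (f (a d)) + θ (f t)) (sym (fa d))) (closed c (a d))))
          where
          eq : ∀ x y z → - x + y + z ≡ 0ℤ → y ≡ x - z
          eq x y z e = trans (eq′ x y z) (trans (cong (λ t → x - z + t) e) (ℤₚ.+-identityʳ (x - z)))
            where
            eq′ : ∀ x y z → y ≡ x - z + (- x + y + z)
            eq′ = solve-∀

        link : ∀ d → h (s d) ≡ h d - h (f (s d)) × g (s d) ≡ g d - g (f (s d))
        link d = cocycle-link ch d , cocycle-link cg d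

        -- Parallelism passes through a nonzero middle vector, as the integers have no zero
        -- divisors.
        parallel-trans : ∀ {x y u v p q} → ¬ (u ≡ 0ℤ × v ≡ 0ℤ) → x * v - y * u ≡ 0ℤ → u * q - v * p ≡ 0ℤ → x * q - y * p ≡ 0ℤ
        parallel-trans {x} {y} {u} {v} {p} {q} ne e₁ e₂ with u ℤ.≟ 0ℤ
        ... | no u≢0 = *≡0⇒ʳ u≢0 (trans (eq x y u v p q) (trans (cong₂ (λ s t → x * s + p * t) e₂ e₁) (z x p)))
          where
          eq : ∀ x y u v p q → u * (x * q - y * p) ≡ x * (u * q - v * p) + p * (x * v - y * u)
          eq = solve-∀
          z : ∀ x p → x * 0ℤ + p * 0ℤ ≡ 0ℤ
          z = solve-∀
        ... | yes u≡0 = *≡0⇒ʳ {v} (λ v≡0 → ne (u≡0 , v≡0)) (trans (eq x y u v p q) (trans (cong₂ (λ s t → y * s + q * t) e₂ e₁) (z y q)))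
          where
          eq : ∀ x y u v p q → v * (x * q - y * p) ≡ y * (u * q - v * p) + q * (x * v - y * u)
          eq = solve-∀
          z : ∀ x p → x * 0ℤ + p * 0ℤ ≡ 0ℤ
          z = solve-∀

        -- The gauge vanishes on one spoke; hence if the link edges are all parallel, so are the spokes.
        star-flat : ∀ v → ¬ Vis C v → (∀ c → vtx c ≡ v → A (f c) (f (s c)) ≡ 0ℤ) → ∀ c → vtx c ≡ v → A c (f c) ≡ 0ℤ
        star-flat v nv flat c e = let k , p = vtx-same {vrep v} {c} (trans (vtx-rep v) (sym e)) in subst (λ c → A c (f c) ≡ 0ℤ) p (go k)
          where
          at : ∀ k → vtx (iter M s k (vrep v)) ≡ v
          at zero = vtx-rep v
          at (suc k) = trans (vtx-s _) (at k)
          go : ∀ k → let c = iter M s k (vrep v) in A c (f c) ≡ 0ℤ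
          go zero = area-zeroˡ cω cη π ρ (f (vrep v)) (rep-zero ω π₀ nv , rep-zero η ρ₀ nv)
          -- The spokes `s c′` and `c′` differ by the link edge `f (s c′)`, so both have the same
          -- area with it. By induction `c′` is parallel to the previous link edge, which is
          -- nonzero, hence also to this one.
          go (suc k) = trans (cong₂ (λ x y → x * h (f (s c′)) - y * g (f (s c′))) (proj₂ (link c′)) (proj₁ (link c′)))
            (trans (eq (g c′) (h c′) (g (f (s c′))) (h (f (s c′))))
              (parallel-trans {g c′} {h c′} {g (f c′)} {h (f c′)} link≢0 (go k) (flat c′ (at k))))
            where
            c′ : Dart
            c′ = iter M s k (vrep v)
            eq : ∀ x y p q → (x - p) * q - (y - q) * p ≡ x * q - y * p
            eq = solve-∀
            c′≡ : s (b c′) ≡ c′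
            c′≡ = sb c′
            new : ¬ V (b c′)
            new w = nv (subst (Vis C) (trans (sym (vtx-s (b c′))) (trans (cong vtx c′≡) (at k))) w)
            v-hd : Vis C (hd c′)
            v-hd = neighbour c′ (λ w → nv (subst (Vis C) (at k) w))
            v-prev : Vis C (hd (b c′))
            v-prev = neighbour (b c′) new
            v-link : V (f c′)
            v-link = subst (Vis C) (hd-face c′) v-hd
            v-link′ : Vis C (hd (f c′))
            v-link′ = subst (Vis C) (trans (cong vtx (aa (f (f c′)))) (sym (hd-face (f c′)))) v-prev
            link≢0 : ¬ (g (f c′) ≡ 0ℤ × h (f c′) ≡ 0ℤ)
            link≢0 (p , q) = link-nonzero (b c′) new v-prev (subst (Vis C ∘ hd) (sym c′≡) v-hd)
              (subst (λ x → Zero cω cη π₀ ρ₀ (f x)) (sym c′≡)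
                (trans (sym (gauge-extend ω π₀ v-link v-link′)) p , trans (sym (gauge-extend η ρ₀ v-link v-link′)) q))

        -- The link edges `f (s c)` and `f c` join the heads of the spokes `s c`, `c` and `b c`. The
        -- third connector enters the centre along `a (s c)` and leaves along `b c`, so it is apart
        -- from every edge with two visited ends.
        star-finish : ∀ c → ¬ V c → A (f c) (f (s c)) ≢ 0ℤ → ThreeDisjointCycles M
        star-finish c nc ne = Finish.result cω cη π ρ C null (f (s c)) (f c) (a (s c)) (b c ∷ []) X-ends (hd-face (f c))
          (subst (Vis C) (hd-face (s c)) v₁) (subst (Vis C) (hd-face c) v₂) v₃
          (λ e → ne (anti-area e))
          (hd-face (s c) ∷ (trans (vtx-b c) (sym (trans (hd-a (s c)) (vtx-s c))) ∷ subst (λ u → Walk u [] (vtx (f (f c)))) (sym (hd-a (f (f c)))) []))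
          (((λ e → nb (subst (Vis C) e v₁)) ∷ []) ∷ ([] ∷ []))
          ((spokes-apart ∷ []) ∷ ([] ∷ []))
          (nb ∷ [])
          (λ { (here refl) _ p q → unvisited-apart (inj₂ n-hd) p q ; (there (here refl)) _ p q → unvisited-apart (inj₁ nb) p q })
          (λ { (here refl) → unvisited-apart (inj₂ n-hd) X-vis X-vis′ ; (there (here refl)) → unvisited-apart (inj₁ nb) X-vis X-vis′ })
          (λ { (here refl) → unvisited-apart (inj₂ n-hd) Y-vis Y-vis′ ; (there (here refl)) → unvisited-apart (inj₁ nb) Y-vis Y-vis′ })
          (sides cg) (sides ch)
          where
          vtx-b : ∀ c → vtx (b c) ≡ vtx c
          vtx-b c = trans (sym (vtx-s (b c))) (cong vtx (sb c))
          ac : f (f (s c)) ≡ a c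
          ac = trans (sym (aa (f (f (s c))))) (cong a (bs c))
          X-ends : hd (f (s c)) ≡ vtx (f c)
          X-ends = trans (hd-face (f (s c))) (trans (cong vtx ac) (hd-face c))
          nb : ¬ V (b c)
          nb v = nc (subst (Vis C) (vtx-b c) v)
          ns : ¬ V (s c)
          ns v = nc (subst (Vis C) (vtx-s c) v)
          n-hd : ¬ Vis C (hd (a (s c)))
          n-hd v = ns (subst (Vis C) (hd-a (s c)) v)
          v₁ : Vis C (hd (s c))
          v₁ = neighbour (s c) ns
          v₂ : Vis C (hd c)
          v₂ = neighbour c nc
          v₃ : V (f (f c))
          v₃ = subst (Vis C) (cong vtx (aa (f (f c)))) (neighbour (b c) nb)
          X-vis : V (f (s c))
          X-vis = subst (Vis C) (hd-face (s c)) v₁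
          Y-vis : V (f c)
          Y-vis = subst (Vis C) (hd-face c) v₂
          X-vis′ : Vis C (hd (f (s c)))
          X-vis′ = subst (Vis C) (sym X-ends) Y-vis
          Y-vis′ : Vis C (hd (f c))
          Y-vis′ = subst (Vis C) (sym (hd-face (f c))) v₃
          unvisited-apart : ∀ {e d} → ¬ V e ⊎ ¬ Vis C (hd e) → V d → Vis C (hd d) → Apart e d
          unvisited-apart {e} n p q r with ed-same r | n
          ... | inj₁ refl | inj₁ n₁ = n₁ p
          ... | inj₁ refl | inj₂ n₂ = n₂ q
          ... | inj₂ refl | inj₁ n₁ = n₁ (subst (Vis C) (hd-a e) q)
          ... | inj₂ refl | inj₂ n₂ = n₂ p
          prev : ∀ {θ} → Cocycle θ → θ c ≡ θ (b c) - θ (f c)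
          prev {θ} c′ = trans (cong θ (sym (sb c))) (trans (cocycle-link c′ (b c)) (cong (λ x → θ (b c) - θ (f x)) (sb c)))
          spokes-apart : Apart (a (s c)) (b c)
          spokes-apart r with ed-same r
          ... | inj₁ e = nb (subst (Vis C) (cong vtx (sym e)) v₁)
          -- Here `b c` and `s c` coincide; the two link edges then have opposite values and zero
          -- area.
          ... | inj₂ e = ne (trans (cong₂ (λ x y → x * h (f (s c)) - y * g (f (s c))) (opposite cg same) (opposite ch same)) (eq (g (f (s c))) (h (f (s c)))))
            where
            same : b c ≡ s c
            same = trans e (aa (s c))
            opposite : ∀ {θ} → Cocycle θ → b c ≡ s c → θ (f c) ≡ - θ (f (s c))
            opposite {θ} c′ q = solve₁ (θ c) (θ (s c)) (θ (f (s c))) (θ (f c)) (cocycle-link c′ c) (trans (prev c′) (cong (λ x → θ x - θ (f c)) q))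
              where
              solve₁ : ∀ x y p q → y ≡ x - p → x ≡ y - q → q ≡ - p
              solve₁ x y p q refl e = trans (eq′ x p q) (trans (cong (λ t → x - p - t) (sym e)) (eq″ x p q))
                where
                eq′ : ∀ x p q → q ≡ x - p - (x - p - q)
                eq′ = solve-∀
                eq″ : ∀ x p q → x - p - x ≡ - p
                eq″ = solve-∀
            eq : ∀ x y → - x * y - - y * x ≡ 0ℤ
            eq = solve-∀
          anti-area : A (f (s c)) (f c) ≡ 0ℤ → A (f c) (f (s c)) ≡ 0ℤ
          anti-area e = trans (eq (g (f c)) (h (f c)) (g (f (s c))) (h (f (s c)))) (cong -_ e)
            where
            eq : ∀ x y u v → x * v - y * u ≡ - (u * y - v * x)
            eq = solve-∀
          sides : ∀ {θ} → Cocycle θ → θ (a (s c)) + (θ (b c) + 0ℤ) ≡ θ (f (s c)) + θ (f c)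
          sides {θ} c′ = trans (cong (_+ (θ (b c) + 0ℤ)) (anti c′ (s c))) (solve₁ (θ c) (θ (s c)) (θ (f (s c))) (θ (f c)) (θ (b c)) (cocycle-link c′ c) (prev c′))
            where
            solve₁ : ∀ x y p q r → y ≡ x - p → x ≡ r - q → - y + (r + 0ℤ) ≡ p + q
            solve₁ x y p q r refl refl = eq p q r
              where
              eq : ∀ p q r → - (r - q - p) + (r + 0ℤ) ≡ p + q
              eq = solve-∀

      finish : ThreeDisjointCycles M
      finish = let d , ne = face-area in go d ne (vis? C (vtx d)) (vis? C (vtx (f d))) (vis? C (vtx (f (f d))))
        where
        flat-or : ∀ v → ¬ Vis C v → (∃[ c ] (vtx c ≡ v × A (f c) (f (s c)) ≢ 0ℤ)) ⊎ (∀ c → vtx c ≡ v → A (f c) (f (s c)) ≡ 0ℤ)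
        flat-or v nv with Finₚ.any? (λ c → (vtx c ≟ v) ×-dec ¬? (A (f c) (f (s c)) ℤ.≟ 0ℤ))
        ... | yes p = inj₁ p
        ... | no none = inj₂ (λ c e → flat c e)
          where
          flat : ∀ c → vtx c ≡ v → A (f c) (f (s c)) ≡ 0ℤ
          flat c e with A (f c) (f (s c)) ℤ.≟ 0ℤ
          ... | yes z = z
          ... | no nz = ⊥-elim (none (c , e , nz))
        star : ∀ d → ¬ V d → A d (f d) ≢ 0ℤ → ThreeDisjointCycles M
        star d nd ne with flat-or (vtx d) nd
        ... | inj₁ (c , e , nz) = star-finish c (λ v → nd (subst (Vis C) e v)) nz
        ... | inj₂ flat = ⊥-elim (ne (star-flat (vtx d) nd flat d refl))
        go : ∀ d → A d (f d) ≢ 0ℤ → Dec (V d) → Dec (V (f d)) → Dec (V (f (f d))) → ThreeDisjointCycles M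
        go d ne (no n₁) _ _ = star d n₁ ne
        go d ne (yes _) (no n₂) _ = star (f d) n₂ (λ e → ne (trans (sym (rotate d)) e))
        go d ne (yes _) (yes _) (no n₃) = star (f (f d)) n₃ (λ e → ne (trans (sym (trans (rotate (f d)) (rotate d))) e))
        go d ne (yes v₁) (yes v₂) (yes v₃) = face-finish d v₁ v₂ v₃ ne

    three-cycles : ThreeDisjointCycles M
    three-cycles = saturate {S = State} (λ s → Vis (State.C s)) (λ s → vis? (State.C s)) step
      (state (closedTrail [] [] []) (λ _ → 0ℤ) (λ _ → 0ℤ) [])
      where
      step : ∀ s → ThreeDisjointCycles M ⊎ Next s
      step s@(state C π ρ null) with Finₚ.any? (move? s)
      ... | yes (d , m) = inj₂ (grow s d m)
      ... | no none = inj₁ (Stuck.finish C π ρ null (λ d m → none (d , m)))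

-- Triangulations with loops

module LoopCase (M : Map) (T : IsToroidalTriangulation M) (l : Fin (Map.n M)) (k′ : ℕ)
  (closes : iter M (sig M) (suc k′) l ≡ alp M l)
  (minimal : ∀ j → j ℕ.< suc k′ → ∀ d → iter M (sig M) j d ≢ alp M d) where
  open IsToroidalTriangulation T using (triangular)
  open Cycles M T
  open Map M using (n; α-nofix)
  private module O = Orbits M s s-inj

  -- Runs from `S 0 = l` to `S k = a l`. `minimal` ranges over all darts, so no loop closes up after
  -- fewer rotations.
  S : ℕ → Dart
  S i = iter M s i l

  k : ℕ
  k = suc k′

  S-+ : ∀ i j → S (i ℕ.+ j) ≡ iter M s i (S j)
  S-+ i j = O.it-+ i j l

  -- Cutting out a repetition would reach `a l` in fewer rotations.
  S-inj : ∀ {i j} → i ℕ.< j → j ℕ.≤ k → S i ≢ S j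
  S-inj {i} {j} i<j j≤k e = minimal (k ℕ.∸ j ℕ.+ i) (subst (k ℕ.∸ j ℕ.+ i ℕ.<_) (ℕₚ.m∸n+n≡m j≤k) (ℕₚ.+-monoʳ-< (k ℕ.∸ j) i<j)) l
    (trans (S-+ (k ℕ.∸ j) i) (trans (cong (iter M s (k ℕ.∸ j)) e) (trans (sym (S-+ (k ℕ.∸ j) j)) (trans (cong S (ℕₚ.m∸n+n≡m j≤k)) closes))))

  S-≢ : ∀ {i j} → i ℕ.≤ k → j ℕ.≤ k → i ≢ j → S i ≢ S j
  S-≢ {i} {j} i≤k j≤k ne with ℕₚ.<-cmp i j
  ... | Rel.tri< i<j _ _ = S-inj i<j j≤k
  ... | Rel.tri≈ _ e _ = ⊥-elim (ne e)
  ... | Rel.tri> _ _ j<i = S-inj j<i i≤k ∘ sym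

  -- Such an edge would be a loop cutting off a smaller sector.
  no-inner-loop : ∀ {i j} → i ℕ.< k → j ℕ.< k → S j ≢ a (S i)
  no-inner-loop {i} {j} i<k j<k e with ℕₚ.≤-total i j
  ... | inj₁ i≤j = minimal (j ℕ.∸ i) (ℕₚ.≤-<-trans (ℕₚ.m∸n≤m j i) j<k) (S i)
          (trans (sym (S-+ (j ℕ.∸ i) i)) (trans (cong S (ℕₚ.m∸n+n≡m i≤j)) e))
  ... | inj₂ j≤i = minimal (i ℕ.∸ j) (ℕₚ.≤-<-trans (ℕₚ.m∸n≤m i j) i<k) (S j)
          (trans (sym (S-+ (i ℕ.∸ j) j)) (trans (cong S (ℕₚ.m∸n+n≡m j≤i)) (trans (sym (aa (S i))) (cong a (sym e)))))

  l-loop : vtx (a l) ≡ vtx l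
  l-loop = sym (same-vtx (k , closes))

  η : Vec n
  η = proj₁ (loop-class l l-loop)
  cη : Cocycle η
  cη = proj₁ (proj₂ (loop-class l l-loop))
  ηl≢0 : η l ≢ 0ℤ
  ηl≢0 = proj₂ (proj₂ (loop-class l l-loop))

  -- Indices 1 to `k′`: both darts of `l` are left out and stay at the bottom.
  InS : Dart → Set
  InS d = Σ[ i ∈ Fin k′ ] S (suc (toℕ i)) ≡ d

  inS? : ∀ d → Dec (InS d)
  inS? d = Finₚ.any? (λ i → S (suc (toℕ i)) ≟ d)

  index<k : ∀ (i : Fin k′) → suc (toℕ i) ℕ.< k
  index<k i = ℕ.s≤s (Finₚ.toℕ<n i)

  inS : ∀ {i} → 1 ℕ.≤ i → i ℕ.< k → InS (S i)
  inS {suc i} _ (ℕ.s≤s i<k′) = Fin.fromℕ< i<k′ , cong (S ∘ suc) (Finₚ.toℕ-fromℕ< i<k′)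

  l∉S : ¬ InS l
  l∉S (i , e) = S-inj {0} {suc (toℕ i)} (ℕ.s≤s ℕ.z≤n) (ℕₚ.<⇒≤ (index<k i)) (sym e)

  al∉S : ¬ InS (a l)
  al∉S (i , e) = S-inj {suc (toℕ i)} {k} (index<k i) ℕₚ.≤-refl (trans e (sym closes))

  a-S∉S : ∀ {d} → InS d → ¬ InS (a d)
  a-S∉S (i , refl) (j , e) = no-inner-loop (index<k i) (index<k j) e

  vtx-S : ∀ i → vtx (S i) ≡ vtx l
  vtx-S zero = refl
  vtx-S (suc i) = trans (vtx-s (S i)) (vtx-S i)

  -- The base of the loop l is split in two: the darts of S start at top, all other darts there at bottom.
  top bottom : Fin (suc nv)
  top = zero
  bottom = suc (vtx l)

  opaque
    vt : Dart → Fin (suc nv)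
    vt d with inS? d
    ... | yes _ = top
    ... | no _ = suc (vtx d)

    vt-S : ∀ {d} → InS d → vt d ≡ top
    vt-S {d} p with inS? d
    ... | yes _ = refl
    ... | no ¬p = ⊥-elim (¬p p)

    vt-∉ : ∀ {d} → ¬ InS d → vt d ≡ suc (vtx d)
    vt-∉ {d} ¬p with inS? d
    ... | yes p = ⊥-elim (¬p p)
    ... | no _ = refl

    top⇒S : ∀ {d} → vt d ≡ top → InS d
    top⇒S {d} e with inS? d
    ... | yes p = p
    top⇒S {d} () | no _

  merge : Fin (suc nv) → Fin nv
  merge zero = vtx l
  merge (suc v) = v

  merge-vt : ∀ d → merge (vt d) ≡ vtx d
  merge-vt d with inS? d
  ... | yes p@(i , e) = trans (cong merge (vt-S p)) (trans (sym (vtx-S (suc (toℕ i)))) (cong vtx e))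
  ... | no ¬p = cong merge (vt-∉ ¬p)

  module Q = Walks a aa vt ed ed-a ed-same
  open Q using () renaming (_∷_ to infixr 5 _◂_; [] to ◂[])

  -- `f d` follows `a d` in the rotation, so both are on the same side of the split except where the
  -- sector begins, at `a d = l`, and where it ends, at `f d = a l`.
  corner : ∀ {d} → d ≢ a l → f d ≢ a l → Q.hd d ≡ vt (f d)
  corner {d} d≢ fd≢ with inS? (a d) | inS? (f d)
  ... | yes p | yes q = trans (vt-S p) (sym (vt-S q))
  ... | no ¬p | no ¬q = trans (vt-∉ ¬p) (trans (cong suc (vtx-face d)) (sym (vt-∉ ¬q)))
  ... | yes (i , e) | no ¬q with suc (suc (toℕ i)) ℕₚ.<? k
  ...   | yes lt = ⊥-elim (¬q (subst InS (cong s e) (inS (ℕ.s≤s ℕ.z≤n) lt)))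
  ...   | no ≮ = ⊥-elim (fd≢ (trans (cong s (sym e)) (trans (cong S (ℕₚ.≤-antisym (index<k i) (ℕₚ.≮⇒≥ ≮))) closes)))
  corner {d} d≢ fd≢ | no ¬p | yes (zero , e) = ⊥-elim (d≢ (trans (sym (aa d)) (cong a (s-inj (sym e)))))
  corner {d} d≢ fd≢ | no ¬p | yes (suc i , e) = ⊥-elim (¬p (subst InS (s-inj e) (inS (ℕ.s≤s ℕ.z≤n) (ℕₚ.<-trans (ℕₚ.n<1+n _) (index<k (suc i))))))

  vt-l : vt l ≡ bottom
  vt-l = vt-∉ l∉S

  vt-al : vt (a l) ≡ bottom
  vt-al = trans (vt-∉ al∉S) (cong suc l-loop)

  first last : Dart
  first = S 1
  last = S k′

  f-al : f (a l) ≡ first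
  f-al = fa l

  f-a-last : f (a last) ≡ a l
  f-a-last = trans (fa last) closes

  f-first : f first ≡ a last
  f-first = trans (cong f (sym f-al)) (f-inj (trans (fff (a l)) (sym f-a-last)))

  -- Closedness on the triangle with sides `a l`, `first` and `a last`.
  top-face : η first - η last ≡ η l
  top-face = solve₁ (trans (cong₂ (λ x y → η (a l) + x + y) (cong η (sym f-al)) (trans (sym (anti cη last)) (cong η (sym (trans (cong f f-al) f-first)))))
      (closed cη (a l))) (anti cη l)
    where
    solve₁ : ∀ {x y z w} → w + x + - y ≡ 0ℤ → w ≡ - z → x - y ≡ z
    solve₁ {x} {y} {z} e refl = trans (eq x y z) (trans (cong (λ t → z + t) e) (ℤₚ.+-identityʳ z))
      where
      eq : ∀ x y z → x - y ≡ z + (- z + x + - y)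
      eq = solve-∀

  1≤k′ : 1 ℕ.≤ k′
  1≤k′ = ℕₚ.n≢0⇒n>0 (λ e → proj₂ (triangular (a l)) (trans f-al (trans (cong (S ∘ suc) (sym e)) closes)))

  first≢last : first ≢ last
  first≢last e = ηl≢0 (trans (sym top-face) (trans (cong (λ d → η d - η last) e) (ℤₚ.+-inverseʳ (η last))))

  first∈S : InS first
  first∈S = inS ℕₚ.≤-refl (ℕ.s≤s 1≤k′)

  last∈S : InS last
  last∈S = inS 1≤k′ ℕₚ.≤-refl

  hd-first : Q.hd first ≡ Q.hd last
  hd-first = trans (corner (λ e → al∉S (subst InS e first∈S)) (λ e → l∉S (subst InS (a-inj (trans (sym f-first) e)) last∈S))) (cong vt f-first)

  -- The dual cocycle of the loop

  χ : Vec n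
  χ d = Σ′ (λ (i : Fin k′) → δ (S (suc (toℕ i))) d)

  χ-S : ∀ {d} → InS d → χ d ≡ 1ℤ
  χ-S (i , refl) = trans (Σ-cong (λ j → trans (same j) (sym (ℤₚ.*-identityʳ (δ i j))))) (Σ-δ i (λ _ → 1ℤ))
    where
    same : ∀ j → δ (S (suc (toℕ j))) (S (suc (toℕ i))) ≡ δ i j
    same j with i ≟ j
    ... | yes refl = δ-refl (S (suc (toℕ i)))
    ... | no ne = δ-≢ (S-≢ (ℕₚ.<⇒≤ (index<k j)) (ℕₚ.<⇒≤ (index<k i)) (λ e → ne (sym (Finₚ.toℕ-injective (ℕₚ.suc-injective e)))))

  χ-∉ : ∀ {d} → ¬ InS d → χ d ≡ 0ℤ
  χ-∉ ¬p = Σ-0 (λ i → δ-≢ (λ e → ¬p (i , e)))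

  -- Departures from the sector minus arrivals. `χ` lives on darts rather than vertices, which is
  -- why `θ` need not be exact.
  θ : Vec n
  θ d = χ d - χ (a d)

  telescope : ∀ (g : ℕ → ℤ) m → Σ′ (λ (i : Fin m) → g (toℕ i) - g (suc (toℕ i))) ≡ g 0 - g m
  telescope g zero = trans (Σ-empty _) (sym (ℤₚ.+-inverseʳ (g 0)))
  telescope g (suc m) = trans (Σ-suc (λ i → g (toℕ i) - g (suc (toℕ i)))) (trans (cong (λ t → g 0 - g 1 + t) (telescope (g ∘ suc) m)) (eq (g 0) (g 1) (g (suc m))))
    where
    eq : ∀ x y z → x - y + (y - z) ≡ x - z
    eq = solve-∀

  χ-step : ∀ e → χ (s e) - χ e ≡ δ l e - δ last e
  χ-step e = trans (sym (Σ-sub (λ (i : Fin k′) → δ (S (suc (toℕ i))) (s e)) (λ i → δ (S (suc (toℕ i))) e)))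
    (trans (Σ-cong (λ i → cong (_- δ (S (suc (toℕ i))) e) (δ-eq {S (suc (toℕ i))} {s e} {S (toℕ i)} {e} s-inj (cong s))))
      (telescope (λ i → δ (S i) e) k′))

  cθ : Cocycle θ
  cθ = record
    { anti = λ d → trans (cong (λ t → χ (a d) - χ t) (aa d)) (eq (χ d) (χ (a d)))
    ; closed = λ d → trans (eq₃ (χ d) (χ (a d)) (χ (f d)) (χ (a (f d))) (χ (f (f d))) (χ (a (f (f d)))))
        (trans (cong₂ _+_ (cong₂ _+_ (step d) (step (f d))) (trans (cong (λ t → χ t - χ (a (f (f d)))) (sym (fff d))) (trans (step (f (f d))) (cong (λ t → δ (a l) (f (f d)) - δ (a l) t) (fff d)))))
          (eq₀ (δ (a l) d) (δ (a l) (f d)) (δ (a l) (f (f d))))) }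
    where
    eq : ∀ x y → y - x ≡ - (x - y)
    eq = solve-∀
    eq₃ : ∀ x x′ y y′ z z′ → (x - x′) + (y - y′) + (z - z′) ≡ (y - x′) + (z - y′) + (x - z′)
    eq₃ = solve-∀
    eq₀ : ∀ x y z → (x - y) + (y - z) + (z - x) ≡ 0ℤ
    eq₀ = solve-∀
    -- From `a d` to its successor `f d` the indicator changes only at the ends of the sector. Both
    -- changes are expressed through `a l`, so that they cancel around a triangle.
    step : ∀ d → χ (f d) - χ (a d) ≡ δ (a l) d - δ (a l) (f d)
    step d = trans (χ-step (a d)) (cong₂ _-_ (δ-eq {l} {a d} {a l} {d} (λ e → trans (cong a e) (aa d)) (λ e → trans (sym (aa l)) (cong a e)))
      (δ-eq {last} {a d} {a l} {f d} (λ e → trans (sym closes) (cong s e)) (λ e → s-inj (trans closes e))))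

  -- θ is Poincaré dual to l.
  W-θ : W θ η ≡ + 6 * η l
  W-θ = trans (W-coboundary χ cη) (trans (cong (+ 2 *_) total) (eq (η l)))
    where
    eq : ∀ x → + 2 * (+ 3 * x) ≡ + 6 * x
    eq = solve-∀
    G : Dart → ℤ
    G d = η (b d) - η (s d)
    bS : ∀ i → b (S (suc i)) ≡ S i
    bS i = bs (S i)
    total : Σ′ (λ d → χ d * G d) ≡ + 3 * η l
    total = trans (Σ-cong (λ d → trans (ℤₚ.*-comm (χ d) (G d)) (sym (Σ-* (G d) (λ i → δ (S (suc (toℕ i))) d)))))
      (trans (Σ-comm (λ d (i : Fin k′) → G d * δ (S (suc (toℕ i))) d))
      (trans (Σ-cong (λ i → trans (Σ-cong (λ d → ℤₚ.*-comm (G d) (δ (S (suc (toℕ i))) d))) (trans (Σ-δ (S (suc (toℕ i))) G) (pair (toℕ i)))))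
      -- What survives is `η l + η first` minus `η last + η (a l)`, which is three times `η l` by
      -- `top-face`.
      (trans (telescope (λ i → η (S i) + η (S (suc i))) k′) (eq₂ (η l) (η first) (η last) (η (S k)) top-face (trans (cong η closes) (anti cη l))))))
      where
      pair : ∀ i → G (S (suc i)) ≡ (η (S i) + η (S (suc i))) - (η (S (suc i)) + η (S (suc (suc i))))
      pair i = trans (cong (λ t → η t - η (S (suc (suc i)))) (bS i)) (eq₁ (η (S i)) (η (S (suc i))) (η (S (suc (suc i)))))
        where
        eq₁ : ∀ x y z → x - z ≡ (x + y) - (y + z)
        eq₁ = solve-∀
      eq₂ : ∀ x y z w → y - z ≡ x → w ≡ - x → (x + y) - (z + w) ≡ + 3 * x
      eq₂ x y z w e refl = trans (eq₃ x y z) (trans (cong (λ t → x + t + x) e) (eq₄ x))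
        where
        eq₃ : ∀ x y z → (x + y) - (z + - x) ≡ x + (y - z) + x
        eq₃ = solve-∀
        eq₄ : ∀ x → x + x + x ≡ + 3 * x
        eq₄ = solve-∀

  η-cancel : ∀ {x y} → x ≡ a y → ∀ {θ} → Cocycle θ → θ y + θ x ≡ 0ℤ
  η-cancel {y = y} refl {θ} c = trans (cong (λ t → θ y + t) (anti c y)) (ℤₚ.+-inverseʳ (θ y))

  -- The third side of a triangle with two glued sides is a null loop.
  no-folded-triangle : ∀ d → vtx (a (f d)) ≡ vtx (f d) → f (f d) ≢ a d
  no-folded-triangle d loop e = let θ , c , ne = loop-class (f d) loop in
    ne (trans (eq (θ d) (θ (f d)) (θ (f (f d)))) (trans (cong₂ (λ x y → x - y) (closed c d) (η-cancel e c)) refl))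
    where
    eq : ∀ x y z → y ≡ (x + y + z) - (x + z)
    eq = solve-∀

  -- Growing a closed trail from the top

  private
    -- `first-vis` keeps growth away from the triangle of `a l`, the only one whose corners are torn
    -- by the split.
    record State : Set where
      constructor state
      field
        C : Q.ClosedTrail top
        first-vis : Q.ClosedTrail.Vis C (Q.hd first)
    open State

  Vis : State → Fin (suc nv) → Set
  Vis s = Q.ClosedTrail.Vis (C s)

  vis? : ∀ s w → Dec (Vis s w)
  vis? s = Q.ClosedTrail.vis? (C s)

  merge-≡ : ∀ {d e} → vt d ≡ vt e → vtx d ≡ vtx e
  merge-≡ {d} {e} p = trans (sym (merge-vt d)) (trans (cong merge p) (merge-vt e))

  private
    Next : State → Set
    Next s = Σ[ s′ ∈ State ] ((∀ {w} → Vis s w → Vis s′ w) × (∃[ w ] (¬ Vis s w × Vis s′ w)))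

    next : ∀ s {w ws} → ¬ Vis s w → Q.Grown (λ _ → ⊤) (C s) (w ∷ ws) → Next s
    next s {w} new (C′ , mono , (v ∷ _) , _) = state C′ (mono (first-vis s)) , mono , w , new , v

    start : State
    start = state (Q.closedTrail (first ∷ a last ∷ [])
        (vt-S first∈S ◂ sym hd-first ◂ subst (λ u → Q.Walk u [] top) (sym (trans (Q.hd-a last) (vt-S last∈S))) ◂[])
        ((apart ∷ []) ∷ ([] ∷ [])))
      (there (here refl))
      where
      apart : Q.Apart first (a last)
      apart e with ed-same e
      ... | inj₁ q = a-S∉S last∈S (subst InS (sym q) first∈S)
      ... | inj₂ q = first≢last (a-inj (sym q))

    -- Other loops may make corners of the triangle coincide; two sides then form a closed
    -- excursion, on distinct edges by `no-folded-triangle`. With distinct corners the triangle is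
    -- absorbed along a side whose tail is visited and whose opposite corner is new.
    grow : ∀ s → ¬ Vis s bottom → ∀ d → Vis s (vt d) → ¬ Vis s (Q.hd d) → Next s
    grow s nb d v nv = go (vt (f (f d)) ≟ vt (f d)) (vt (f (f d)) ≟ vt d) (vis? s (vt (f (f d))))
      where
      d≢al : d ≢ a l
      d≢al e = nb (subst (Vis s) (trans (cong vt e) vt-al) v)
      d≢first : d ≢ first
      d≢first e = nv (subst (Vis s ∘ Q.hd) (sym e) (first-vis s))
      fd≢al : f d ≢ a l
      fd≢al e = nv (subst (Vis s) (sym (trans (cong Q.hd (f-inj (trans e (sym f-a-last)))) (trans (Q.hd-a last) (vt-S last∈S)))) (here refl))
      ffd≢al : f (f d) ≢ a l
      ffd≢al e = d≢first (trans (sym (fff d)) (trans (cong f e) f-al))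
      e₁ : Q.hd d ≡ vt (f d)
      e₁ = corner d≢al fd≢al
      e₂ : Q.hd (f d) ≡ vt (f (f d))
      e₂ = corner fd≢al ffd≢al
      e₃ : Q.hd (f (f d)) ≡ vt d
      e₃ = trans (corner ffd≢al (λ e → d≢al (trans (sym (fff d)) e))) (cong vt (fff d))
      ny : ¬ Vis s (vt (f d))
      ny = nv ∘ subst (Vis s) (sym e₁)
      p≢u : vt d ≢ vt (f d)
      p≢u e = ny (subst (Vis s) e v)
      go : Dec (vt (f (f d)) ≡ vt (f d)) → Dec (vt (f (f d)) ≡ vt d) → Dec (Vis s (vt (f (f d)))) → Next s
      go (yes e) _ _ = next s nv (Q.excursion {λ _ → ⊤} (λ _ → tt) (C s) {es = d ∷ f (f d) ∷ []} v
          (refl ◂ trans e (sym e₁) ◂ subst (λ u → Q.Walk u [] (vt d)) (sym e₃) ◂[])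
          ((apart ∷ []) ∷ ([] ∷ []))
          (λ { (here refl) → Q.fresh (Q.ClosedTrail.walk (C s)) nv (inj₂ refl) ; (there (here refl)) → Q.fresh (Q.ClosedTrail.walk (C s)) ny (inj₁ e) })
          (tt ∷ (tt ∷ [])))
        where
        apart : Q.Apart d (f (f d))
        apart q with ed-same q
        ... | inj₁ r = p≢u (trans (cong vt (sym r)) e)
        ... | inj₂ r = no-folded-triangle d (trans (vtx-face (f d)) (merge-≡ e)) r
      go (no _) (yes e) _ = next s nv (Q.excursion {λ _ → ⊤} (λ _ → tt) (C s) {es = d ∷ f d ∷ []} v
          (refl ◂ sym e₁ ◂ subst (λ u → Q.Walk u [] (vt d)) (sym (trans e₂ e)) ◂[])
          ((apart ∷ []) ∷ ([] ∷ []))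
          (λ { (here refl) → Q.fresh (Q.ClosedTrail.walk (C s)) nv (inj₂ refl) ; (there (here refl)) → Q.fresh (Q.ClosedTrail.walk (C s)) ny (inj₁ refl) })
          (tt ∷ (tt ∷ [])))
        where
        apart : Q.Apart d (f d)
        apart q with ed-same q
        ... | inj₁ r = p≢u (cong vt (sym r))
        ... | inj₂ r = no-folded-triangle (f d) (trans (vtx-face (f (f d))) (trans (cong vtx (fff d)) (sym (merge-≡ e)))) (trans (fff d) (trans (sym (aa d)) (cong a (sym r))))
      go (no s≢u) (no s≢p) (yes vs) = next s ny (Q.absorb {λ _ → ⊤} (λ _ → tt) (C s) e₃ e₁ e₂ s≢p p≢u s≢u vs ny tt tt tt)
      go (no s≢u) (no s≢p) (no ns) = next s ns (Q.absorb {λ _ → ⊤} (λ _ → tt) (C s) e₁ e₂ e₃ p≢u (s≢u ∘ sym) (s≢p ∘ sym) v ns tt tt tt)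

    -- Otherwise θ is the coboundary of the indicator function of the visited vertices.
    not-stuck : ∀ s → ¬ Vis s bottom → ¬ (∀ d → Vis s (vt d) → Vis s (Q.hd d))
    not-stuck s nb closed-under = *-≢0 {+ 6} (λ ()) ηl≢0 (trans (sym W-θ) (trans (Σ-cong (λ d → cong (_* (η (f d) - η (f (f d)))) (exact d)))
      (W-exact (λ d → - P (vtx d)) (λ d → cong (λ t → - P t) (vtx-s d)) cη)))
      where
      I : Fin (suc nv) → ℤ
      I w with vis? s w
      ... | yes _ = 1ℤ
      ... | no _ = 0ℤ
      I-yes : ∀ {w} → Vis s w → I w ≡ 1ℤ
      I-yes {w} v with vis? s w
      ... | yes _ = refl
      ... | no nv = ⊥-elim (nv v)
      I-no : ∀ {w} → ¬ Vis s w → I w ≡ 0ℤ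
      I-no {w} nv with vis? s w
      ... | yes v = ⊥-elim (nv v)
      ... | no _ = refl
      P : Fin nv → ℤ
      P v = I (suc v)
      label : ∀ d → I (vt d) ≡ χ d + P (vtx d)
      label d with inS? d
      ... | yes p@(i , e) = trans (trans (cong I (vt-S p)) (I-yes (here refl))) (sym (cong₂ _+_ (χ-S p) (trans (cong P (trans (cong vtx (sym e)) (vtx-S (suc (toℕ i))))) (I-no nb))))
      ... | no ¬p = trans (cong I (vt-∉ ¬p)) (sym (trans (cong (_+ P (vtx d)) (χ-∉ ¬p)) (ℤₚ.+-identityˡ (P (vtx d)))))
      constant : ∀ d → I (vt d) ≡ I (Q.hd d)
      constant d with vis? s (vt d)
      ... | yes v = sym (I-yes (closed-under d v))
      ... | no nv = sym (I-no (λ v → nv (subst (Vis s) (Q.hd-a d) (closed-under (a d) v))))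
      exact : ∀ d → θ d ≡ - P (vtx d) - - P (vtx (a d))
      exact d = solve₁ (χ d) (χ (a d)) (P (vtx d)) (P (vtx (a d))) (trans (sym (label d)) (trans (constant d) (label (a d))))
        where
        solve₁ : ∀ x y p q → x + p ≡ y + q → x - y ≡ - p - - q
        solve₁ x y p q e = trans (eq x y p) (trans (cong (λ t → t - y - p) e) (eq′ y p q))
          where
          eq : ∀ x y p → x - y ≡ x + p - y - p
          eq = solve-∀
          eq′ : ∀ y p q → y + q - y - p ≡ - p - - q
          eq′ = solve-∀

  trail-to-bottom : Σ[ C ∈ Q.ClosedTrail top ] Q.ClosedTrail.Vis C bottom
  trail-to-bottom = saturate {S = State} Vis vis? step start
    where
    step : ∀ s → (Σ[ C ∈ Q.ClosedTrail top ] Q.ClosedTrail.Vis C bottom) ⊎ Next s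
    step s with vis? s bottom
    ... | yes v = inj₁ (C s , v)
    ... | no nb with Finₚ.any? (λ d → vis? s (vt d) ×-dec ¬? (vis? s (Q.hd d)))
    ...   | yes (d , v , nv) = inj₂ (grow s nb d v nv)
    ...   | no none = ⊥-elim (not-stuck s nb (λ d v → decide (vis? s (Q.hd d)) (λ nv → none (d , v , nv))))
      where
      decide : ∀ {A : Set} → Dec A → ¬ ¬ A → A
      decide (yes x) _ = x
      decide (no ¬x) ¬¬x = ⊥-elim (¬¬x ¬x)

  -- Two disjoint paths from top to bottom

  private
    top∉S : ∀ {x} → InS x → Q.hd x ≢ top
    top∉S p e = a-S∉S p (top⇒S e)

    start-unique : ∀ {d ds v y} → Q.Path top (d ∷ ds) v → y ∈ d ∷ ds → vt y ≡ top → y ≡ d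
    start-unique _ (here e) _ = e
    start-unique {d} {ds} (Q.cons _ top∉ p) (there y∈) e = ⊥-elim (top∉ (subst (_∈ Q.verts (Q.hd d) ds) e (Q.tail∈verts (Q.Path⇒Walk p) y∈)))

    -- A path from `top` never returns there, so its first dart is its only edge at the sector.
    spoke-apart : ∀ {d ds v x y} → Q.Path top (d ∷ ds) v → InS x → x ≢ d → y ∈ d ∷ ds → Q.Apart x y
    spoke-apart {x = x} p x∈S x≢d y∈ e with ed-same e
    ... | inj₁ refl = x≢d (start-unique p y∈ (vt-S x∈S))
    ... | inj₂ refl = Q.head≢start p y∈ (trans (Q.hd-a x) (vt-S x∈S))

    respoke : ∀ {d ds es v x} → InS x → Q.Path top (d ∷ ds) v → Q.Path (Q.hd x) es v → es ⊆ ds → Q.Path top (x ∷ es) v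
    respoke {d} {ds} {es} {v} {x} x∈S (Q.cons _ top∉ _) q sub = Q.cons (vt-S x∈S) new q
      where
      new : top ∉ Q.verts (Q.hd x) es
      new (here e) = top∉S x∈S (sym e)
      new (there m) = let y , y∈ , e = ∈-map⁻ Q.hd m in top∉ (there (subst (_∈ map Q.hd ds) (sym e) (∈-map⁺ Q.hd (Q.⊆⇒∈ sub y∈))))

    link-apart : ∀ {d ds v e h z} → Q.Path top (d ∷ ds) v → vt e ≡ h → h ≢ top → h ∉ Q.verts (Q.hd d) ds → z ∈ d ∷ ds → Q.Apart e z
    link-apart {d} {ds} {e = e} p refl h≢ h∉ z∈ r with ed-same r
    link-apart (Q.cons e₀ _ p) refl h≢ h∉ (here refl) r | inj₁ refl = h≢ e₀
    link-apart (Q.cons _ _ p) refl h≢ h∉ (there z∈) r | inj₁ refl = h∉ (Q.tail∈verts (Q.Path⇒Walk p) z∈)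
    link-apart {d} {ds} {e = e} p refl h≢ h∉ z∈ r | inj₂ refl = h∉ (subst (_∈ Q.verts (Q.hd d) ds) (Q.hd-a e) (∈-map⁺ Q.hd z∈))

    -- The indices place the first darts of the paths in the sector; at `i = 0` one path starts with
    -- `first`.
    record Pair (i : ℕ) : Set where
      constructor pair
      field
        {j} : ℕ
        {αs βs} : List Dart
        i<j : i ℕ.< j
        j<k′ : j ℕ.< k′
        α-path : Q.Path top (S (suc i) ∷ αs) bottom
        β-path : Q.Path top (S (suc j) ∷ βs) bottom
        α-trail : Q.Trail (S (suc i) ∷ αs)
        β-trail : Q.Trail (S (suc j) ∷ βs)
        αβ-disjoint : Q.Disjoint (S (suc i) ∷ αs) (S (suc j) ∷ βs)

    S≢ : ∀ {i j} → i ℕ.< j → j ℕ.< k′ → S (suc i) ≢ S (suc j)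
    S≢ i<j j<k′ = S-inj (ℕ.s≤s i<j) (ℕ.s≤s (ℕₚ.<⇒≤ j<k′))

    cons-disjoint : ∀ {x : Dart} {xs ys} → (∀ {y} → y ∈ ys → Q.Apart x y) → Q.Disjoint xs ys → Q.Disjoint (x ∷ xs) ys
    cons-disjoint p D (here refl) y∈ = p y∈
    cons-disjoint p D (there x∈) y∈ = D x∈ y∈

    -- Turns one of the two paths across the triangle at top preceding its first dart.
    push-step : ∀ i → Pair (suc i) → Pair i
    push-step i (pair {j} {αs} {βs} i<j j<k′ pα pβ tα tβ D) =
      go pα pβ (h ∈?ˡ Q.verts (Q.hd y) αs) (h ∈?ˡ Q.verts (Q.hd (S (suc j))) βs)
      where
      open import Data.List.Membership.DecPropositional (_≟_ {suc nv}) using () renaming (_∈?_ to _∈?ˡ_)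
      x y : Dart
      x = S (suc i)
      y = S (suc (suc i))
      h : Fin (suc nv)
      h = Q.hd x
      i<k′ : suc i ℕ.< k′
      i<k′ = ℕₚ.<-trans i<j j<k′
      x∈S : InS x
      x∈S = inS (ℕ.s≤s ℕ.z≤n) (ℕₚ.<-trans i<k′ (ℕₚ.n<1+n k′))
      y∈S : InS y
      y∈S = inS (ℕ.s≤s ℕ.z≤n) (ℕ.s≤s i<k′)
      x≢y : x ≢ y
      x≢y = S≢ (ℕₚ.n<1+n i) i<k′
      x≢z : x ≢ S (suc j)
      x≢z = S≢ (ℕₚ.<-trans (ℕₚ.n<1+n i) i<j) j<k′
      e : Dart
      e = a (f y)
      fy≢al : f y ≢ a l
      fy≢al q = a-S∉S last∈S (subst InS (f-inj (trans q (sym f-a-last))) y∈S)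
      ffy : f (f y) ≡ a x
      ffy = trans (sym (aa (f (f y)))) (cong a (bs x))
      vt-e : vt e ≡ h
      vt-e = trans (corner fy≢al (λ q → l∉S (subst InS (a-inj (trans (sym ffy) q)) x∈S))) (cong vt ffy)
      hd-e : Q.hd e ≡ Q.hd y
      hd-e = trans (Q.hd-a (f y)) (sym (corner (λ q → al∉S (subst InS q y∈S)) fy≢al))
      go : Q.Path top (y ∷ αs) bottom → Q.Path top (S (suc j) ∷ βs) bottom → Dec (h ∈ Q.verts (Q.hd y) αs) → Dec (h ∈ Q.verts (Q.hd (S (suc j))) βs) → Pair i
      -- The head of `x` lies on the first path, which is shortened to start with `x`.
      go (Q.cons _ _ p) _ (yes m) _ = let es , q , sub = Q.suffix p m in
        pair (ℕₚ.<-trans (ℕₚ.n<1+n i) i<j) j<k′ (respoke x∈S pα q sub) pβ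
          (All.tabulate (λ z∈ → spoke-apart pα x∈S x≢y (there (Q.⊆⇒∈ sub z∈))) ∷ Q.trail-⊆ sub (AllPairs.tail tα)) tβ
          (cons-disjoint (spoke-apart pβ x∈S x≢z) (λ z∈ → D (there (Q.⊆⇒∈ sub z∈))))
      -- The head of `x` lies on the second path, which takes `x` over; the paths swap roles, the
      -- old first one now having index `suc i`.
      go _ (Q.cons _ _ p) (no _) (yes m) = let es , q , sub = Q.suffix p m in
        pair (ℕₚ.n<1+n i) i<k′ (respoke x∈S pβ q sub) pα
          (All.tabulate (λ z∈ → spoke-apart pβ x∈S x≢z (there (Q.⊆⇒∈ sub z∈))) ∷ Q.trail-⊆ sub (AllPairs.tail tβ)) tα
          (cons-disjoint (spoke-apart pα x∈S x≢y) (λ z∈ w∈ r → D w∈ (there (Q.⊆⇒∈ sub z∈)) (sym r)))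
      go (Q.cons _ top∉ p) _ (no ∉α) (no ∉β) =
        pair (ℕₚ.<-trans (ℕₚ.n<1+n i) i<j) j<k′
          (Q.cons (vt-S x∈S) new (Q.cons vt-e (∉α ∘ subst (λ u → h ∈ Q.verts u αs) hd-e) (subst (λ u → Q.Path u αs bottom) (sym hd-e) p))) pβ
          ((x-e ∷ All.tabulate (λ z∈ → spoke-apart pα x∈S x≢y (there z∈))) ∷ (All.tabulate (λ z∈ → link-apart pα vt-e (top∉S x∈S) ∉α (there z∈)) ∷ AllPairs.tail tα)) tβ
          (cons-disjoint (spoke-apart pβ x∈S x≢z) (cons-disjoint (link-apart pβ vt-e (top∉S x∈S) ∉β) (λ z∈ → D (there z∈))))
        where
        new : top ∉ Q.verts (Q.hd x) (e ∷ αs)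
        new (here q) = top∉S x∈S (sym q)
        new (there (here q)) = top∉S y∈S (trans (sym hd-e) (sym q))
        new (there (there m)) = top∉ (there m)
        x-e : Q.Apart x e
        x-e q with ed-same q
        ... | inj₁ r = top∉S x∈S (trans (sym vt-e) (trans (cong vt r) (vt-S x∈S)))
        ... | inj₂ r = top∉S y∈S (trans (sym hd-e) (trans (cong Q.hd r) (trans (Q.hd-a x) (vt-S x∈S))))

    push : ∀ i → Pair i → Pair 0
    push zero p = p
    push (suc i) p = push i (push-step i p)

    first-step : ∀ {ds} → Q.Path top ds bottom → Σ[ i ∈ ℕ ] Σ[ es ∈ List Dart ] (i ℕ.< k′ × ds ≡ S (suc i) ∷ es)
    first-step (Q.cons e _ _) = let i , q = top⇒S e in toℕ i , _ , Finₚ.toℕ<n i , cong (_∷ _) (sym q)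

    -- The trail is cut at `bottom` and its second half reversed; edge-disjointness makes the first
    -- darts differ.
    some-pair : Σ[ i ∈ ℕ ] Pair i
    some-pair = from (proj₁ trail-to-bottom) (proj₂ trail-to-bottom)
      where
      build : ∀ {α β} → Q.Path top α bottom → Q.Path top β bottom → Q.Trail α → Q.Trail β → Q.Disjoint α β → Σ[ i ∈ ℕ ] Pair i
      build pα pβ tα tβ D with first-step pα | first-step pβ
      ... | i , _ , i<k′ , refl | j , _ , j<k′ , refl with ℕₚ.<-cmp i j
      ...   | Rel.tri< i<j _ _ = i , pair i<j j<k′ pα pβ tα tβ D
      ...   | Rel.tri> _ _ j<i = j , pair j<i i<k′ pβ pα tβ tα (λ y∈ x∈ → D x∈ y∈ ∘ sym)
      ...   | Rel.tri≈ _ refl _ = ⊥-elim (D (here refl) (here refl) refl)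
      from : (C : Q.ClosedTrail top) → Q.ClosedTrail.Vis C bottom → Σ[ i ∈ ℕ ] Pair i
      from C v = let xs , ys , r , p , q = Q.split (Q.ClosedTrail.walk C) v
                     _ , pα , sα = Q.simplify p
                     _ , pβ , sβ = Q.simplify (Q.Walk-rev q)
                     tx , ty , D = Q.trail-++⁻ xs (subst Q.Trail r (Q.ClosedTrail.trail C))
                 in build pα pβ (Q.trail-⊆ sα tx) (Q.trail-⊆ sβ (Q.trail-rev ty)) (Q.disjoint-⊆ sα sβ (Q.disjoint-rev ys D))

    -- Gluing the split vertex again

    merge-walk : ∀ {u ds v} → Q.Walk u ds v → Walk (merge u) ds (merge v)
    merge-walk ◂[] = []
    merge-walk {v = v} (_◂_ {d = d} {ds = ds} refl p) = sym (merge-vt d) ∷ subst (λ u → Walk u ds (merge v)) (merge-vt (a d)) (merge-walk p)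

    -- Gluing identifies only `top` with `bottom`, and no dart of a path to `bottom` starts there.
    merge-tails : ∀ {ds} → All (λ d → vt d ≢ bottom) ds → AllPairs (λ d e → vt d ≢ vt e) ds → AllPairs (λ d e → vtx d ≢ vtx e) ds
    merge-tails [] [] = []
    merge-tails (n ∷ ns) (p ∷ ps) = All.tabulate (λ e∈ q → All.lookup p e∈ (separate n (All.lookup ns e∈) q)) ∷ merge-tails ns ps
      where
      separate : ∀ {d e} → vt d ≢ bottom → vt e ≢ bottom → vtx d ≡ vtx e → vt d ≡ vt e
      separate {d} {e} nd ne q with inS? d | inS? e
      ... | yes p | yes p′ = trans (vt-S p) (sym (vt-S p′))
      ... | no ¬p | no ¬p′ = trans (vt-∉ ¬p) (trans (cong suc q) (sym (vt-∉ ¬p′)))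
      ... | yes (i , r) | no ¬p = ⊥-elim (ne (trans (vt-∉ ¬p) (cong suc (trans (sym q) (trans (cong vtx (sym r)) (vtx-S (suc (toℕ i))))))))
      ... | no ¬p | yes (i , r) = ⊥-elim (nd (trans (vt-∉ ¬p) (cong suc (trans q (trans (cong vtx (sym r)) (vtx-S (suc (toℕ i))))))))

    cycle : ∀ {d ds} → Q.Path top (d ∷ ds) bottom → Q.Trail (d ∷ ds) → SimpleCycle
    cycle {d} {ds} p t = mkCycle d ds (merge-walk (Q.Path⇒Walk p)) (merge-tails (All.tabulate (Q.tail≢end p)) (Q.tails-distinct p)) t

    l-cycle : SimpleCycle
    l-cycle = mkCycle l [] (refl ∷ subst (λ u → Walk u [] (vtx l)) (sym l-loop) []) ([] ∷ []) ([] ∷ [])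

    θ-l : sumL θ (l ∷ []) ≡ 0ℤ
    θ-l = trans (ℤₚ.+-identityʳ (θ l)) (cong₂ _-_ (χ-∉ l∉S) (χ-∉ al∉S))

    -- The first dart leaves the sector, and no later dart starts or ends in it.
    θ-path : ∀ {d ds} → Q.Path top (d ∷ ds) bottom → sumL θ (d ∷ ds) ≡ 1ℤ
    θ-path {d} {ds} p@(Q.cons e top∉ q) = cong₂ _+_ (cong₂ _-_ (χ-S (top⇒S e)) (χ-∉ (a-S∉S (top⇒S e)))) (rest ds (λ y∈ → y∈))
      where
      rest : ∀ es → (∀ {y} → y ∈ es → y ∈ ds) → sumL θ es ≡ 0ℤ
      rest [] _ = refl
      rest (y ∷ es) sub = cong₂ _+_ (cong₂ _-_
          (χ-∉ (λ y∈S → top∉ (subst (_∈ Q.verts (Q.hd d) ds) (vt-S y∈S) (Q.tail∈verts (Q.Path⇒Walk q) (sub (here refl))))))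
          (χ-∉ (λ ay∈S → Q.head≢start p (there (sub (here refl))) (vt-S ay∈S))))
        (rest es (sub ∘ there))

    l-apart : ∀ {d ds} → Q.Path top (d ∷ ds) bottom → Disjoint (l ∷ []) (d ∷ ds)
    l-apart p (here refl) y∈ e with ed-same e
    ... | inj₁ refl = Q.tail≢end p y∈ vt-l
    ... | inj₂ refl = Q.tail≢end p y∈ vt-al

    -- Against `θ` and `η` the loop has periods 0 and `η l`, while both paths have `θ`-period 1. The
    -- determinants are `- η l`, twice, and the difference of the `η`-periods of the paths.
    finish : ∀ {d ds c cs} → Q.Path top (d ∷ ds) bottom → Q.Path top (c ∷ cs) bottom → Q.Trail (d ∷ ds) → Q.Trail (c ∷ cs) →
      Q.Disjoint (d ∷ ds) (c ∷ cs) → sumL η (d ∷ ds) ≢ sumL η (c ∷ cs) → ThreeDisjointCycles M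
    finish {d} {ds} {c} {cs} p q tp tq D ne = conclude cθ cη l-cycle (cycle p tp) (cycle q tq)
      (det-l p) (det-l q)
      (λ e → ne (sym (ℤₚ.i-j≡0⇒i≡j _ _ (trans (sym (trans (cong₂ (λ x y → x * sumL η (c ∷ cs) - sumL η (d ∷ ds) * y) (θ-path p) (θ-path q)) (eq (sumL η (c ∷ cs)) (sumL η (d ∷ ds))))) e))))
      (l-apart p) (l-apart q) D
      where
      eq : ∀ x y → 1ℤ * x - y * 1ℤ ≡ x - y
      eq = solve-∀
      eq′ : ∀ x y → 0ℤ * x - (y + 0ℤ) * 1ℤ ≡ - y
      eq′ = solve-∀
      det-l : ∀ {d ds} → Q.Path top (d ∷ ds) bottom → det cθ cη (l ∷ []) (d ∷ ds) ≢ 0ℤ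
      det-l {d} {ds} p e = ηl≢0 (trans (sym (ℤₚ.neg-involutive (η l))) (cong -_ (trans (sym (trans (cong₂ (λ x y → x * sumL η (d ∷ ds) - (η l + 0ℤ) * y) θ-l (θ-path p)) (eq′ (sumL η (d ∷ ds)) (η l)))) e)))

    -- The first and the last dart of S have the same head, and their classes differ by that of l.
    finish-pair : Pair 0 → ThreeDisjointCycles M
    finish-pair (pair {j} {αs} {βs} 0<j j<k′ pα@(Q.cons _ _ α) pβ@(Q.cons _ _ β) tα tβ D)
      with sumL η (first ∷ αs) ℤ.≟ sumL η (S (suc j) ∷ βs) | suc j ℕ.≟ k′
    ... | no ne | _ = finish pα pβ tα tβ D ne
    -- `last` is free, so the first path may start with it; if the periods agreed again, `η first`
    -- would equal `η last`.
    ... | yes e | no j≢ = finish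
          (respoke last∈S pα (subst (λ u → Q.Path u αs bottom) hd-first α) ⊆-refl) pβ
          (All.tabulate (λ z∈ → spoke-apart pα last∈S (first≢last ∘ sym) (there z∈)) ∷ AllPairs.tail tα) tβ
          (cons-disjoint (spoke-apart pβ last∈S (S-≢ (ℕₚ.n≤1+n k′) (ℕ.s≤s (ℕₚ.<⇒≤ j<k′)) (j≢ ∘ sym))) (λ z∈ → D (there z∈)))
          (λ e′ → ηl≢0 (trans (sym top-face) (solve₁ {η first} {η last} {sumL η αs} (trans e (sym e′)))))
      where
      solve₁ : ∀ {x y z} → x + z ≡ y + z → x - y ≡ 0ℤ
      solve₁ {x} {y} {z} q = trans (eq x y z) (trans (cong (λ t → t - (y + z)) q) (ℤₚ.+-inverseʳ (y + z)))
        where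
        eq : ∀ x y z → x - y ≡ x + z - (y + z)
        eq = solve-∀
    -- `last` starts the second path: the paths exchange their first darts, which changes the
    -- difference of periods by twice `η l`, up to sign.
    ... | yes e | yes refl = finish
          (respoke last∈S pα (subst (λ u → Q.Path u αs bottom) hd-first α) ⊆-refl)
          (respoke first∈S pβ (subst (λ u → Q.Path u βs bottom) (sym hd-first) β) ⊆-refl)
          (All.tabulate (λ z∈ r → D (there z∈) (here refl) (sym r)) ∷ AllPairs.tail tα)
          (All.tabulate (λ z∈ → D (here refl) (there z∈)) ∷ AllPairs.tail tβ)
          (λ { (here refl) (here refl) r → D (here refl) (here refl) (sym r)
             ; (here refl) (there w∈) → All.lookup (AllPairs.head tβ) w∈
             ; (there z∈) (here refl) r → All.lookup (AllPairs.head tα) z∈ (sym r)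
             ; (there z∈) (there w∈) → D (there z∈) (there w∈) })
          (λ e′ → *-≢0 {+ 2} (λ ()) ηl≢0 (trans (cong (+ 2 *_) (sym top-face)) (solve₂ {η first} {η last} {sumL η αs} {sumL η βs} e e′)))
      where
      solve₂ : ∀ {x y p q} → x + p ≡ y + q → y + p ≡ x + q → + 2 * (x - y) ≡ 0ℤ
      solve₂ {x} {y} {p} {q} u v = trans (eq x y p q) (trans (cong₂ (λ s t → (s - (y + q)) - (t - (x + q))) u v) (eq′ (x + q) (y + q)))
        where
        eq : ∀ x y p q → + 2 * (x - y) ≡ (x + p - (y + q)) - (y + p - (x + q))
        eq = solve-∀
        eq′ : ∀ s t → (t - t) - (s - s) ≡ 0ℤ
        eq′ = solve-∀

  three-cycles : ThreeDisjointCycles M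
  three-cycles = finish-pair (push (proj₁ some-pair) (proj₂ some-pair))

least : ∀ {P : ℕ → Set} → (∀ k → Dec (P k)) → ∀ k → P k → ∃[ m ] (P m × (∀ j → j ℕ.< m → ¬ P j))
least {P} P? = <-rec _ go
  where
  go : ∀ k → (∀ {j} → j ℕ.< k → P j → ∃[ m ] (P m × (∀ j → j ℕ.< m → ¬ P j))) → P k → ∃[ m ] (P m × (∀ j → j ℕ.< m → ¬ P j))
  go k rec p with ℕₚ.anyUpTo? P? k
  ... | yes (j , j<k , q) = rec j<k q
  ... | no none = k , p , λ j j<k q → none (j , j<k , q)

three-disjoint-cycles : ∀ M → IsToroidalTriangulation M → ThreeDisjointCycles M
three-disjoint-cycles M T = loops? (Finₚ.any? (λ d → vtx d ≟ vtx (a d)))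
  where
  open Cycles M T
  d₀ : Dart
  d₀ = Fin.fromℕ< (IsToroidalTriangulation.nonempty T)
  Closing : ℕ → Set
  Closing k = ∃[ d ] iter M s k d ≡ a d
  shortest : ∃[ k ] (Closing k × (∀ j → j ℕ.< k → ¬ Closing j)) → ThreeDisjointCycles M
  shortest (zero , (d , p) , _) = ⊥-elim (Map.α-nofix M d (sym p))
  shortest (suc k , (l , p) , minimal) = LoopCase.three-cycles M T l k p (λ j j<k d q → minimal j j<k (d , q))
  loops? : Dec (∃[ d ] vtx d ≡ vtx (a d)) → ThreeDisjointCycles M
  loops? (no none) = let ω , η , cω , cη , ne = independent-cocycles in
    Loopless.three-cycles M T (λ d e → none (d , e)) cω cη ne (vtx d₀) d₀ refl
  loops? (yes (d , e)) = let k , p = vtx-same e in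
    -- The minimum is taken over all darts at once, not only over rotations of `d`.
    shortest (least (λ k → Finₚ.any? (λ d → iter M s k d ≟ a d)) k (d , p))

theorem11 : (M : Map) → IsToroidalTriangulation M →
    Σ[ C₁ ∈ Cycle M ] Σ[ C₂ ∈ Cycle M ] Σ[ C₃ ∈ Cycle M ]
    ((¬ Contractible M C₁) × (¬ Contractible M C₂) × (¬ Contractible M C₃) ×
    (¬ Homotopic M C₁ C₂) × (¬ Homotopic M C₁ C₃) × (¬ Homotopic M C₂ C₃) ×
    EdgeDisjoint M C₁ C₂ × EdgeDisjoint M C₁ C₃ × EdgeDisjoint M C₂ C₃)
theorem11 = three-disjoint-cycles
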